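{- $$b_{\sup}\le\frac12-\frac{2}{(2+(1+2\sqrt2)\pi)^2}=0.489\ldots.$$
   Context: Write $[n]=\{1,\dots,n\}$ and $A+A=\{a+b:a,b\in A\}$ for $A\subseteq\mathbb{Z}$. For $\epsilon>0$ and a positive integer $k$ let $N(\epsilon,k)=\max\{n : \text{there is } A\subseteq\mathbb{Z},\ |A|=k,\ |(A+A)\cap[n]|\ge(1-\epsilon)n\}$. Define $b_{\sup}=\limsup_{\epsilon\to0,\ k\to\infty} N(\epsilon,k)/k^2$, i.e. $b_{\sup}=\inf_{\delta>0}\sup\{N(\epsilon,k)/k^2 : 0<\epsilon<\delta,\ k>1/\delta\}$. -}

module Defs where

open import Data.Nat as ℕ using (ℕ; zero; suc)
open import Data.Integer as ℤ using (ℤ; +_; -[1+_])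
open import Data.Rational using (ℚ; _/_; _+_; _*_; _-_; _≤_; _<_; 0ℚ; 1ℚ; ½)
open import Data.Bool using (Bool; true; false; if_then_else_)
open import Data.Bool.ListAction using (any)
open import Data.List using (List; length)
open import Data.List.Relation.Unary.Unique.Propositional using (Unique)
open import Data.Product using (_×_; Σ)
open import Relation.Nullary.Decidable using (⌊_⌋)
open import Relation.Binary.PropositionalEquality using (_≡_)

ℕtoℚ : ℕ → ℚ
ℕtoℚ n = + n / 1

inSumset : List ℤ → ℤ → Bool
inSumset A m = any (λ a → any (λ b → ⌊ a ℤ.+ b ℤ.≟ m ⌋) A) A

countUpTo : (ℕ → Bool) → ℕ → ℕ
countUpTo f zero = 0
countUpTo f (suc n) = countUpTo f n ℕ.+ (if f (suc n) then 1 else 0)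

sumsetCount : List ℤ → ℕ → ℕ
sumsetCount A n = countUpTo (λ i → inSumset A (+ i)) n

-- "n is admissible for (ε,k)": there is A ⊆ ℤ with |A| = k
-- (a duplicate-free list of length k) and |(A+A) ∩ [n]| ≥ (1-ε) n.
-- N(ε,k) is the maximum of such n.
Admissible : ℚ → ℕ → ℕ → Set
Admissible ε k n = Σ (List ℤ) λ A →
  Unique A × length A ≡ k × ((1ℚ - ε) * ℕtoℚ n ≤ ℕtoℚ (sumsetCount A n))

leibnizTerm : ℕ → ℚ
leibnizTerm i = (if even i then + 4 else ℤ.- (+ 4)) / suc (i ℕ.+ i)
  where
  even : ℕ → Bool
  even zero = true
  even (suc zero) = false
  even (suc (suc m)) = even m

leibniz : ℕ → ℚ
leibniz zero = 0ℚ
leibniz (suc j) = leibniz j + leibnizTerm j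

-- p ≥ π : the partial sums with an even number of terms increase to π
AtLeastPi : ℚ → Set
AtLeastPi p = ∀ m → leibniz (m ℕ.+ m) ≤ p

AtLeastSqrt2 : ℚ → Set
AtLeastSqrt2 s = 0ℚ ≤ s × ℕtoℚ 2 ≤ s * s

-- For s ≥ 0, p > 0, with D = 2 + (1+2s)p > 0:
--   1/2 - 2/D² < q   ⇔   (1/2 - q)·D² < 2
constBelow : ℚ → ℚ → ℚ → Set
constBelow s p q = (½ - q) * D * D < ℕtoℚ 2
  where
  D : ℚ
  D = ℕtoℚ 2 + (1ℚ + ℕtoℚ 2 * s) * p

-- c < q  for the real number c = 1/2 - 2/(2+(1+2√2)π)²
-- (c is continuous and increasing in √2 and π, so c < q iff some
--  rational upper bounds s ≥ √2, p ≥ π already give c(s,p) < q)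
ConstLt : ℚ → Set
ConstLt q = Σ ℚ λ s → Σ ℚ λ p → AtLeastSqrt2 s × AtLeastPi p × constBelow s p q

{-# OPTIONS --safe #-}
-- Write f(x) = Σ_{a∈A} x^a and Δ = k² - 2n.  If A + A covers almost all of [n], its representation function
-- differs from twice the indicator function of [n] by about Δ at most in ℓ¹-norm, and that indicator is
-- orthogonal to m ↦ e(jm/n); hence |f(e(j/n))|² ≤ Δ for 0 < j < n.  For the same reason at most √2·√Δ
-- elements of A satisfy a ≤ 0 or 2a > n, because two of the same kind have their sum outside [n].  All
-- others have sin(2πa/n) ≥ 0, so Σ_a |sin(2πa/n)| ≤ (1 + 2√2)√Δ, whereas the expansion
-- |sin t| = 2/π - (4/π) Σ_j cos(2jt)/(4j²-1) gives Σ_a |sin(2πa/n)| ≥ (2/π)(k - √Δ).  Therefore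
-- k ≤ (1 + (1/2 + √2)π)√Δ, which is the theorem.
--
-- To stay inside ℚ, e(1/n) is replaced by a rational point of the unit circle very close to it, and |sin| by the
-- Taylor sections of √(1 - cos²).  The Fourier coefficients of cos^i are transition probabilities of a random
-- walk, the mean of the J-th section is Wallis' (2J+1)(binom(2J,J)/4^J)², and an identity telescoping in J
-- compares it with the partial sums of Leibniz' series.
module Submission where

open import Defs
open import Data.Bool using (Bool; true; false; if_then_else_; _∨_) renaming (T to IsTrue)
open import Data.Empty using (⊥; ⊥-elim)
open import Data.Integer as ℤ using (ℤ; -[1+_])
import Data.Integer.Properties as ℤP
open import Data.List using (List; []; _∷_; length)
open import Data.List.Membership.Propositional using (_∈_; find)
open import Data.List.Relation.Unary.Any using (here; there)
open import Data.List.Relation.Unary.Any.Properties using (any⁻)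
open import Data.Nat as ℕ using (ℕ; zero; suc; z≤n; s≤s)
import Data.Nat.DivMod as ℕD
import Data.Nat.Properties as ℕP
open import Data.Product using (Σ; _×_; _,_; proj₁; proj₂)
open import Data.Rational as ℚ using (ℚ; _+_; _*_; _-_; -_; _≤_; _<_; 0ℚ; 1ℚ; ½)
open import Data.Rational.Properties
import Data.Rational.Unnormalised as ℚᵘ
import Data.Rational.Unnormalised.Properties as ℚᵘP
open import Data.Sum using (_⊎_; inj₁; inj₂; [_,_]′)
open import Data.Unit using (tt)
open import Relation.Binary.PropositionalEquality
  using (_≡_; _≢_; refl; sym; trans; cong; cong₂; subst; subst₂; module ≡-Reasoning)
open import Relation.Nullary using (¬_; Dec; yes; no; contradiction)
open import Relation.Nullary.Decidable using (⌊_⌋; dec⇒maybe; toWitness)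
open import Tactic.RingSolver using (solve-∀)
open import Tactic.RingSolver.Core.AlmostCommutativeRing using (AlmostCommutativeRing; fromCommutativeRing)

-- Everything known about A + A enters through `sumset-bound`, an upper bound for the sum of a test
-- function φ over all pairs from A. It is applied to a function built from the squared transform,
-- to the indicator of the complement of [n], and to zero. The Taylor section is bounded below by
-- upper bounds on moments alone, since its coefficients after the constant are nonpositive.
-- Orthogonality weakens to power sums of absolute value at most 1, for finitely many frequencies;
-- this is what the summand 2 pays for. The order of choices makes this consistent. A rational q
-- above the constant leaves a slack; the slack fixes the degree J of the section and with it the
-- number L of frequencies. Only then come δ, k and n, and the point of the circle is chosen last,
-- as fine as n and L require.

ringℚ : AlmostCommutativeRing _ _
ringℚ = fromCommutativeRing +-*-commutativeRing (λ x → dec⇒maybe (0ℚ ≟ x))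

-- Ordered arithmetic of ℚ

2ℚ : ℚ
2ℚ = ℕtoℚ 2

infixl 6 _⊞_
infixl 7 _⊠_

_⊞_ : ∀ {a b} → 0ℚ ≤ a → 0ℚ ≤ b → 0ℚ ≤ a + b
_⊞_ = +-mono-≤

_⊠_ : ∀ {a b} → 0ℚ ≤ a → 0ℚ ≤ b → 0ℚ ≤ a * b
_⊠_ {a} {b} 0≤a 0≤b =
  nonNegative⁻¹ (a * b)
    {{nonNeg*nonNeg⇒nonNeg a {{ℚ.nonNegative 0≤a}} b {{ℚ.nonNegative 0≤b}}}}

diff : ∀ {a b} → a ≤ b → 0ℚ ≤ b - a
diff {a} {b} a≤b = subst (_≤ b - a) (+-inverseʳ a) (+-monoˡ-≤ (- a) a≤b)

-- An inequality a ≤ b is certified by writing b - a as a sum of products of nonnegative terms; an equation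
-- may enter such a sum with any coefficient, whatever its sign.
vanish : ∀ {x y} k → x ≡ y → 0ℚ ≤ k * (x - y)
vanish {x} k refl = ≤-reflexive (sym (trans (cong (k *_) (+-inverseʳ x)) (*-zeroʳ k)))

≤-by : ∀ {a b t} → 0ℚ ≤ t → b ≡ a + t → a ≤ b
≤-by {a} {t = t} 0≤t refl = subst (_≤ a + t) (+-identityʳ a) (+-monoʳ-≤ a 0≤t)

<-by : ∀ {a b t} → 0ℚ < t → b ≡ a + t → a < b
<-by {a} {t = t} 0<t refl = subst (_< a + t) (+-identityʳ a) (+-monoʳ-< a 0<t)

diff< : ∀ {a b} → a < b → 0ℚ < b - a
diff< {a} {b} a<b = subst (_< b - a) (+-inverseʳ a) (+-monoˡ-< (- a) a<b)

pos* : ∀ {a b} → 0ℚ < a → 0ℚ < b → 0ℚ < a * b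
pos* {a} {b} 0<a 0<b =
  positive⁻¹ (a * b) {{pos*pos⇒pos a {{ℚ.positive 0<a}} b {{ℚ.positive 0<b}}}}

square-nonneg : ∀ a → 0ℚ ≤ a * a
square-nonneg a with ≤-total 0ℚ a
... | inj₁ 0≤a = 0≤a ⊠ 0≤a
... | inj₂ a≤0 = subst (0ℚ ≤_) (eq a) (diff a≤0 ⊠ diff a≤0)
  where
  eq : ∀ a → (0ℚ - a) * (0ℚ - a) ≡ a * a
  eq = solve-∀ ringℚ

square-cancel-≤ : ∀ {a b} → 0ℚ ≤ b → a * a ≤ b * b → a ≤ b
square-cancel-≤ {a} {b} 0≤b aa≤bb with a ≤? b
... | yes a≤b = a≤b
... | no a≰b = ⊥-elim (<-irrefl refl (≤-<-trans aa≤bb (<-by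
        (+-mono-<-≤ (pos* d d) (0≤b ⊠ <⇒≤ d ⊞ 0≤b ⊠ <⇒≤ d)) (eq a b))))
  where
  d : 0ℚ < a - b
  d = diff< (≰⇒> a≰b)
  eq : ∀ a b → a * a ≡ b * b + ((a - b) * (a - b) + (b * (a - b) + b * (a - b)))
  eq = solve-∀ ringℚ

*-cancel-≤ : ∀ {a b c} → 0ℚ < c → c * a ≤ c * b → a ≤ b
*-cancel-≤ {c = c} 0<c = *-cancelˡ-≤-pos c {{ℚ.positive 0<c}}

abstract
  reciprocal : ∀ {a} → 0ℚ < a → Σ ℚ λ b → 0ℚ < b × a * b ≡ 1ℚ
  reciprocal {a} 0<a = ℚ.1/_ a {{nz}} , positive⁻¹ _ {{1/pos⇒pos a {{ℚ.positive 0<a}}}} , *-inverseʳ a {{nz}}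
    where
    nz : ℚ.NonZero a
    nz = ℚ.>-nonZero 0<a

ℕtoℚ-+ : ∀ m n → ℕtoℚ (m ℕ.+ n) ≡ ℕtoℚ m + ℕtoℚ n
ℕtoℚ-+ m n = toℚᵘ-injective (ℚᵘP.≃-trans (toℚᵘ-fromℚᵘ (ℚᵘ.mkℚᵘ (ℤ.+ (m ℕ.+ n)) 0))
  (ℚᵘP.≃-trans (ℚᵘ.*≡* (cong (ℤ._* ℤ.+ 1) (trans (ℤP.pos-+ m n)
      (cong₂ ℤ._+_ (sym (ℤP.*-identityʳ (ℤ.+ m))) (sym (ℤP.*-identityʳ (ℤ.+ n)))))))
  (ℚᵘP.≃-sym (ℚᵘP.≃-trans (toℚᵘ-homo-+ (ℕtoℚ m) (ℕtoℚ n))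
    (ℚᵘP.+-cong (toℚᵘ-fromℚᵘ (ℚᵘ.mkℚᵘ (ℤ.+ m) 0)) (toℚᵘ-fromℚᵘ (ℚᵘ.mkℚᵘ (ℤ.+ n) 0)))))))

ℕtoℚ-suc : ∀ n → ℕtoℚ (suc n) ≡ 1ℚ + ℕtoℚ n
ℕtoℚ-suc = ℕtoℚ-+ 1

ℕtoℚ-* : ∀ m n → ℕtoℚ (m ℕ.* n) ≡ ℕtoℚ m * ℕtoℚ n
ℕtoℚ-* zero n = sym (*-zeroˡ (ℕtoℚ n))
ℕtoℚ-* (suc m) n = begin
  ℕtoℚ (n ℕ.+ m ℕ.* n)          ≡⟨ ℕtoℚ-+ n (m ℕ.* n) ⟩
  ℕtoℚ n + ℕtoℚ (m ℕ.* n)       ≡⟨ cong (ℕtoℚ n +_) (ℕtoℚ-* m n) ⟩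
  ℕtoℚ n + ℕtoℚ m * ℕtoℚ n      ≡⟨ eq (ℕtoℚ n) (ℕtoℚ m) ⟩
  (1ℚ + ℕtoℚ m) * ℕtoℚ n        ≡⟨ cong (_* ℕtoℚ n) (sym (ℕtoℚ-suc m)) ⟩
  ℕtoℚ (suc m) * ℕtoℚ n         ∎
  where
  open ≡-Reasoning
  eq : ∀ n m → n + m * n ≡ (1ℚ + m) * n
  eq = solve-∀ ringℚ

0≤1 : 0ℚ ≤ 1ℚ
0≤1 = toWitness {a? = 0ℚ ≤? 1ℚ} _

0<1 : 0ℚ < 1ℚ
0<1 = toWitness {a? = 0ℚ <? 1ℚ} _

ℕtoℚ-nonneg : ∀ n → 0ℚ ≤ ℕtoℚ n
ℕtoℚ-nonneg zero = ≤-refl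
ℕtoℚ-nonneg (suc n) = subst (0ℚ ≤_) (sym (ℕtoℚ-suc n)) (0≤1 ⊞ ℕtoℚ-nonneg n)

ℕtoℚ-mono : ∀ {m n} → m ℕ.≤ n → ℕtoℚ m ≤ ℕtoℚ n
ℕtoℚ-mono {n = n} z≤n = ℕtoℚ-nonneg n
ℕtoℚ-mono (s≤s {m} {n} m≤n) = subst₂ _≤_ (sym (ℕtoℚ-suc m)) (sym (ℕtoℚ-suc n)) (+-monoʳ-≤ 1ℚ (ℕtoℚ-mono m≤n))

ℕtoℚ-pos : ∀ n → 0ℚ < ℕtoℚ (suc n)
ℕtoℚ-pos n = <-≤-trans 0<1 (ℕtoℚ-mono {1} {suc n} (s≤s z≤n))

ℕtoℚ-cancel-< : ∀ {m n} → ℕtoℚ m < ℕtoℚ n → m ℕ.< n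
ℕtoℚ-cancel-< {m} {n} m<n = ℕP.≰⇒> (λ n≤m → <-irrefl refl (<-≤-trans m<n (ℕtoℚ-mono n≤m)))

ℕtoℚ-cancel-≤ : ∀ {m n} → ℕtoℚ m ≤ ℕtoℚ n → m ℕ.≤ n
ℕtoℚ-cancel-≤ {m} {n} m≤n with m ℕ.≤? n
... | yes h = h
... | no h = ⊥-elim (<-irrefl refl (<-≤-trans (<-≤-trans (<-by 0<1 (trans (ℕtoℚ-suc n) (+-comm 1ℚ (ℕtoℚ n)))) (ℕtoℚ-mono (ℕP.≰⇒> h))) m≤n))

abstract
  archimedean : ∀ x → Σ ℕ λ n → x ≤ ℕtoℚ n
  archimedean x@record{} = ℤ.∣ ℚ.↥ x ∣ , toℚᵘ-cancel-≤ (ℚᵘP.≤-trans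
    (ℚᵘ.*≤* (ℤP.≤-trans (ℤP.≤-reflexive (ℤP.*-identityʳ (ℚ.↥ x))) (bound (ℚ.↥ x) (ℚ.↧ₙ x))))
    (ℚᵘP.≤-reflexive (ℚᵘP.≃-sym (toℚᵘ-fromℚᵘ (ℚᵘ.mkℚᵘ (ℤ.+ ℤ.∣ ℚ.↥ x ∣) 0)))))
    where
    bound : ∀ i d .{{_ : ℕ.NonZero d}} → i ℤ.≤ ℤ.+ ℤ.∣ i ∣ ℤ.* ℤ.+ d
    bound (ℤ.+ m) d = subst (ℤ.+ m ℤ.≤_) (ℤP.pos-* m d) (ℤ.+≤+ (ℕP.m≤m*n m d))
    bound -[1+ m ] d = subst (-[1+ m ] ℤ.≤_) (ℤP.pos-* (suc m) d) ℤ.-≤+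

null : ∀ {x y} k → x ≡ y → k * (x - y) ≡ 0ℚ
null {x} k refl = trans (cong (k *_) (+-inverseʳ x)) (*-zeroʳ k)

≡-by : ∀ {a b t} → t ≡ 0ℚ → a ≡ b + t → a ≡ b
≡-by {b = b} refl refl = +-identityʳ b

infixl 6 _⊕_
_⊕_ : ∀ {x y} → x ≡ 0ℚ → y ≡ 0ℚ → x + y ≡ 0ℚ
refl ⊕ refl = refl

0≤½ : 0ℚ ≤ ½
0≤½ = toWitness {a? = 0ℚ ≤? ½} _

-- Return probabilities of a reflected random walk

-- The probability that a simple random walk on ℕ reflected at 0, started from l, is at 0 after i steps.
μ : ℕ → ℕ → ℚ
μ zero zero = 1ℚ
μ zero (suc l) = 0ℚ
μ (suc i) zero = μ i 1
μ (suc i) (suc l) = ½ * (μ i (suc (suc l)) + μ i l)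

μ-nonneg : ∀ i l → 0ℚ ≤ μ i l
μ-nonneg zero zero = 0≤1
μ-nonneg zero (suc l) = ≤-refl
μ-nonneg (suc i) zero = μ-nonneg i 1
μ-nonneg (suc i) (suc l) = 0≤½ ⊠ (μ-nonneg i (2 ℕ.+ l) ⊞ μ-nonneg i l)

-- Integration by parts: `μ i l` is the mean of cos^i(t) cos(lt), cos(lt) - cos((l+2)t) = 2 sin(t)
-- sin((l+1)t), and (i+1) cos^i sin is minus the derivative of cos^(i+1). The induction uses nothing
-- but the recursion of the walk.
μ-difference : ∀ i l → ℕtoℚ (suc i) * (μ i l - μ i (2 ℕ.+ l)) ≡ 2ℚ * ℕtoℚ (suc l) * μ (suc i) (suc l)
μ-difference zero zero = refl
μ-difference zero (suc l) = eq (ℕtoℚ (2 ℕ.+ l))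
  where
  eq : ∀ a → 1ℚ * (0ℚ - 0ℚ) ≡ 2ℚ * a * (½ * (0ℚ + 0ℚ))
  eq = solve-∀ ringℚ
μ-difference (suc i) zero rewrite ℕtoℚ-suc (suc i) =
  ≡-by (null ½ (μ-difference i 1)) (eq (μ i 1) (μ i 3) (ℕtoℚ (suc i)))
  where
  eq : ∀ b d n → (1ℚ + n) * (b - ½ * (d + b)) ≡ 2ℚ * 1ℚ * (½ * (½ * (d + b) + b))
       + ½ * (n * (b - d) - 2ℚ * 2ℚ * (½ * (d + b)))
  eq = solve-∀ ringℚ
μ-difference (suc i) (suc l) rewrite ℕtoℚ-suc (suc i) | ℕtoℚ-suc (suc l) =
  ≡-by (null ½ (μ-difference i l) ⊕ null ½ hyp)
    (eq (μ i l) (μ i (2 ℕ.+ l)) (μ i (4 ℕ.+ l)) (ℕtoℚ (suc i)) (ℕtoℚ (suc l)))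
  where
  hyp : ℕtoℚ (suc i) * (μ i (2 ℕ.+ l) - μ i (4 ℕ.+ l)) ≡ 2ℚ * (1ℚ + (1ℚ + ℕtoℚ (suc l))) * μ (suc i) (3 ℕ.+ l)
  hyp = trans (μ-difference i (2 ℕ.+ l))
    (cong (λ x → 2ℚ * x * μ (suc i) (3 ℕ.+ l)) (trans (ℕtoℚ-suc (2 ℕ.+ l)) (cong (1ℚ +_) (ℕtoℚ-suc (suc l)))))
  eq : ∀ a b d n l → (1ℚ + n) * (½ * (b + a) - ½ * (d + b)) ≡ 2ℚ * (1ℚ + l) * (½ * (½ * (d + b) + ½ * (b + a)))
       + (½ * (n * (a - b) - 2ℚ * l * (½ * (b + a))) + ½ * (n * (b - d) - 2ℚ * (1ℚ + (1ℚ + l)) * (½ * (d + b))))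
  eq = solve-∀ ringℚ

-- Eliminates `μ i (2 + l)` between `μ-difference` and the recursion. It is the ratio of
-- neighbouring binomial coefficients, as `μ i l` is binom(i, (i-l)/2) / 2^i when i and l have the
-- same parity.
μ-parent : ∀ i l → (ℕtoℚ (suc i) + ℕtoℚ (suc l)) * μ (suc i) (suc l) ≡ ℕtoℚ (suc i) * μ i l
μ-parent i l = ≡-by (null (- ½) (μ-difference i l)) (eq (μ i l) (μ i (2 ℕ.+ l)) (ℕtoℚ (suc i)) (ℕtoℚ (suc l)))
  where
  eq : ∀ a b n l → (n + l) * (½ * (b + a)) ≡ n * a + (- ½) * (n * (a - b) - 2ℚ * l * (½ * (b + a)))
  eq = solve-∀ ringℚ

μ-antitone : ∀ i l → μ i (2 ℕ.+ l) ≤ μ i l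
μ-antitone i l = *-cancel-≤ (ℕtoℚ-pos i) (≤-by
  (vanish 1ℚ (μ-difference i l) ⊞ ℕtoℚ-nonneg 2 ⊠ ℕtoℚ-nonneg (suc l) ⊠ μ-nonneg (suc i) (suc l))
  (eq (μ i l) (μ i (2 ℕ.+ l)) (ℕtoℚ (suc i)) (2ℚ * ℕtoℚ (suc l) * μ (suc i) (suc l))))
  where
  eq : ∀ a b n r → n * a ≡ n * b + (1ℚ * (n * (a - b) - r) + r)
  eq = solve-∀ ringℚ

-- Doubling by two successors lets `μ` unfold at `double (suc n)`, so that `C-suc` is an instance of
-- `μ-parent`.
double : ℕ → ℕ
double zero = zero
double (suc n) = suc (suc (double n))

ℕtoℚ-double : ∀ n → ℕtoℚ (double n) ≡ 2ℚ * ℕtoℚ n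
ℕtoℚ-double zero = refl
ℕtoℚ-double (suc n) = begin
  ℕtoℚ (2 ℕ.+ double n)     ≡⟨ ℕtoℚ-+ 2 (double n) ⟩
  2ℚ + ℕtoℚ (double n)      ≡⟨ cong (2ℚ +_) (ℕtoℚ-double n) ⟩
  2ℚ + 2ℚ * ℕtoℚ n          ≡⟨ eq (ℕtoℚ n) ⟩
  2ℚ * (1ℚ + ℕtoℚ n)        ≡⟨ cong (2ℚ *_) (sym (ℕtoℚ-suc n)) ⟩
  2ℚ * ℕtoℚ (suc n)         ∎
  where
  open ≡-Reasoning
  eq : ∀ n → 2ℚ + 2ℚ * n ≡ 2ℚ * (1ℚ + n)
  eq = solve-∀ ringℚ

-- C i = binom(2i,i) / 4^i
C : ℕ → ℚ
C i = μ (double i) 0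

odd : ℕ → ℚ
odd i = ℕtoℚ (suc (double i))

odd-pos : ∀ i → 0ℚ < odd i
odd-pos i = ℕtoℚ-pos (double i)

odd-suc : ∀ i → odd (suc i) ≡ 2ℚ + odd i
odd-suc i = ℕtoℚ-+ 2 (suc (double i))

odd-linear : ∀ i → odd i ≡ 1ℚ + 2ℚ * ℕtoℚ i
odd-linear i = trans (ℕtoℚ-suc (double i)) (cong (1ℚ +_) (ℕtoℚ-double i))

C-nonneg : ∀ i → 0ℚ ≤ C i
C-nonneg i = μ-nonneg (double i) 0

C-suc : ∀ i → (odd i + 1ℚ) * C (suc i) ≡ odd i * C i
C-suc i = μ-parent (double i) 0

C-antitone : ∀ i → C (suc i) ≤ C i
C-antitone i = *-cancel-≤ (+-mono-< (odd-pos i) 0<1) (≤-by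
  (C-nonneg i ⊞ vanish (- 1ℚ) (C-suc i)) (eq (odd i) (C i) (C (suc i))))
  where
  eq : ∀ n c c' → (n + 1ℚ) * c ≡ (n + 1ℚ) * c' + (c + (- 1ℚ) * ((n + 1ℚ) * c' - n * c))
  eq = solve-∀ ringℚ

-- The mean of the polynomial 1 - Σ_{1≤i≤J} (C (i-1) - C i) cos^(2i), a Taylor section of |sin|; it decreases to 2/π.
wallis : ℕ → ℚ
wallis i = odd i * (C i * C i)

-- The next Taylor section subtracts `C i - C (suc i)` times cos^(2i+2), whose mean is `C (suc i)`;
-- hence the closed form `wallis` really is the mean of the section.
wallis-suc : ∀ i → wallis (suc i) ≡ wallis i - (C i - C (suc i)) * C (suc i)
wallis-suc i rewrite odd-suc i = ≡-by (null (C (suc i) + C i) (C-suc i)) (eq (odd i) (C i) (C (suc i)))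
  where
  eq : ∀ n c d → (2ℚ + n) * (d * d) ≡ n * (c * c) - (c - d) * d + (d + c) * ((n + 1ℚ) * d - n * c)
  eq = solve-∀ ringℚ

wallis≤1 : ∀ i → wallis i ≤ 1ℚ
wallis≤1 zero = ≤-refl
wallis≤1 (suc i) = ≤-trans (≤-by (diff (C-antitone i) ⊠ C-nonneg (suc i) ⊞ vanish (- 1ℚ) (wallis-suc i))
  (eq (wallis i) (wallis (suc i)) ((C i - C (suc i)) * C (suc i)))) (wallis≤1 i)
  where
  eq : ∀ w w' x → w ≡ w' + (x + (- 1ℚ) * (w' - (w - x)))
  eq = solve-∀ ringℚ

sign : ℕ → ℚ
sign zero = 1ℚ
sign (suc l) = - sign l

-- Wallis' product and Leibniz' series

4ℚ : ℚ
4ℚ = ℕtoℚ 4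

*-/-cancel : ∀ i d → ℕtoℚ (suc d) * (i ℚ./ suc d) ≡ i ℚ./ 1
*-/-cancel i d = toℚᵘ-injective (ℚᵘP.≃-trans (toℚᵘ-homo-* (ℕtoℚ (suc d)) (i ℚ./ suc d))
  (ℚᵘP.≃-trans (ℚᵘP.*-cong (toℚᵘ-fromℚᵘ (ℚᵘ.mkℚᵘ (ℤ.+ suc d) 0)) (toℚᵘ-fromℚᵘ (ℚᵘ.mkℚᵘ i d)))
  (ℚᵘP.≃-trans (ℚᵘ.*≡* (trans (ℤP.*-identityʳ _) (trans (ℤP.*-comm (ℤ.+ suc d) i)
     (cong (λ x → i ℤ.* ℤ.+ suc x) (sym (ℕP.+-identityʳ d))))))
  (ℚᵘP.≃-sym (toℚᵘ-fromℚᵘ (ℚᵘ.mkℚᵘ i 0))))))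

double≡+ : ∀ n → double n ≡ n ℕ.+ n
double≡+ zero = refl
double≡+ (suc n) = cong suc (trans (cong suc (double≡+ n)) (sym (ℕP.+-suc n n)))

-- The numerator of leibnizTerm is computed by a local function of Defs that has no name here.
-- Abstracting the denominator lets unification find the family of all fractions with that numerator.
mutual
  leibnizFraction : ℕ → ℕ → ℚ
  leibnizFraction = _

  leibnizFraction-term : ∀ l → leibnizFraction l (l ℕ.+ l) ≡ leibnizTerm l
  leibnizFraction-term l with l ℕ.+ l
  ... | n = refl

leibnizFraction-numerator : ∀ l n → ℕtoℚ (suc n) * leibnizFraction l n ≡ 4ℚ * sign l
leibnizFraction-numerator zero n = *-/-cancel (ℤ.+ 4) n
leibnizFraction-numerator (suc zero) n = *-/-cancel -[1+ 3 ] n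
leibnizFraction-numerator (suc (suc l)) n = trans (leibnizFraction-numerator l n) (eq (sign l))
  where
  eq : ∀ s → 4ℚ * s ≡ 4ℚ * (- (- s))
  eq = solve-∀ ringℚ

leibnizTerm-odd : ∀ l → odd l * leibnizTerm l ≡ 4ℚ * sign l
leibnizTerm-odd l = begin
  odd l * leibnizTerm l                                    ≡⟨ cong₂ (λ n t → ℕtoℚ (suc n) * t) (double≡+ l) (sym (leibnizFraction-term l)) ⟩
  ℕtoℚ (suc (l ℕ.+ l)) * leibnizFraction l (l ℕ.+ l)       ≡⟨ leibnizFraction-numerator l (l ℕ.+ l) ⟩
  4ℚ * sign l                                              ∎
  where open ≡-Reasoning

-- The analogue for a single frequency of the reduction formula (n+2) ∫|cos|^(n+2) = (n+1) ∫|cos|^n.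
-- The extra difference disappears only in the sum weighted by Leibniz' terms.
μ-step : ∀ n m → ℕtoℚ (2 ℕ.+ n) * μ (2 ℕ.+ n) (suc m)
       ≡ ℕtoℚ (suc n) * μ n (suc m) + ℕtoℚ (suc m) * (½ * (μ (suc n) m - μ (suc n) (2 ℕ.+ m)))
μ-step n m rewrite ℕtoℚ-suc (suc n) =
  ≡-by (null ½ h1 ⊕ null 1ℚ h2) (eq (μ (suc n) m) (μ (suc n) (2 ℕ.+ m)) (μ n (suc m)) (ℕtoℚ (suc n)) (ℕtoℚ (suc m)))
  where
  h1 : (1ℚ + ℕtoℚ (suc n)) * (μ (suc n) m - μ (suc n) (2 ℕ.+ m)) ≡ 2ℚ * ℕtoℚ (suc m) * μ (2 ℕ.+ n) (suc m)
  h1 = trans (cong (_* (μ (suc n) m - μ (suc n) (2 ℕ.+ m))) (sym (ℕtoℚ-suc (suc n)))) (μ-difference (suc n) m)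
  h2 : (ℕtoℚ (suc n) + (1ℚ + ℕtoℚ (suc m))) * μ (suc n) (2 ℕ.+ m) ≡ ℕtoℚ (suc n) * μ n (suc m)
  h2 = trans (cong (λ x → (ℕtoℚ (suc n) + x) * μ (suc n) (2 ℕ.+ m)) (sym (ℕtoℚ-suc (suc m)))) (μ-parent n (suc m))
  eq : ∀ x y z n m → (1ℚ + n) * (½ * (y + x)) ≡ n * z + m * (½ * (x - y))
       + (½ * ((1ℚ + n) * (x - y) - 2ℚ * m * (½ * (y + x))) + 1ℚ * ((n + (1ℚ + m)) * y - n * z))
  eq = solve-∀ ringℚ

-- The series Σ `leibnizTerm l` cos((2l+1)t) represents π sgn(cos t), so for odd n this is a
-- truncation of π times the mean of |cos|^n. For n = 2J+1 the full value would be 2 /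
-- (`odd J * C J`).
smoothedLeibniz : ℕ → ℕ → ℚ
smoothedLeibniz n zero = leibnizTerm 0 * μ n 1
smoothedLeibniz n (suc L) = smoothedLeibniz n L + leibnizTerm (suc L) * μ n (suc (double (suc L)))

-- The factor `odd l` coming from `μ-step` cancels the denominator of the Leibniz term. An
-- alternating sum remains, which telescopes to one boundary term at the cutoff L.
smoothedLeibniz-step : ∀ n L → ℕtoℚ (2 ℕ.+ n) * smoothedLeibniz (2 ℕ.+ n) L
  ≡ ℕtoℚ (suc n) * smoothedLeibniz n L + sign L * (μ n (suc (double L)) - μ n (3 ℕ.+ double L))
smoothedLeibniz-step n L = sum L
  where
  term : ∀ l → ℕtoℚ (2 ℕ.+ n) * (leibnizTerm l * μ (2 ℕ.+ n) (suc (double l)))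
    ≡ ℕtoℚ (suc n) * (leibnizTerm l * μ n (suc (double l))) + 2ℚ * sign l * (μ (suc n) (double l) - μ (suc n) (2 ℕ.+ double l))
  term l = ≡-by
    (null (leibnizTerm l) (μ-step n (double l)) ⊕ null (½ * (μ (suc n) (double l) - μ (suc n) (2 ℕ.+ double l))) (leibnizTerm-odd l))
    (eq (ℕtoℚ (2 ℕ.+ n)) (ℕtoℚ (suc n)) (leibnizTerm l) (μ (2 ℕ.+ n) (suc (double l))) (μ n (suc (double l)))
        (sign l) (μ (suc n) (double l) - μ (suc n) (2 ℕ.+ double l)) (odd l))
    where
    eq : ∀ n' n t m' m s d o → n' * (t * m') ≡ n * (t * m) + 2ℚ * s * d
         + (t * (n' * m' - (n * m + o * (½ * d))) + ½ * d * (o * t - 4ℚ * s))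
    eq = solve-∀ ringℚ
  sum : ∀ L → ℕtoℚ (2 ℕ.+ n) * smoothedLeibniz (2 ℕ.+ n) L
    ≡ ℕtoℚ (suc n) * smoothedLeibniz n L + sign L * (μ n (suc (double L)) - μ n (3 ℕ.+ double L))
  sum zero = trans (term 0) (eq (ℕtoℚ (suc n)) (leibnizTerm 0 * μ n 1) (μ n 1) (μ n 3))
    where
    eq : ∀ n a x y → n * a + 2ℚ * 1ℚ * (x - ½ * (y + x)) ≡ n * a + 1ℚ * (x - y)
    eq = solve-∀ ringℚ
  sum (suc L) = ≡-by (null 1ℚ (sum L) ⊕ null 1ℚ (term (suc L)))
    (eq (ℕtoℚ (2 ℕ.+ n)) (ℕtoℚ (suc n)) (smoothedLeibniz (2 ℕ.+ n) L) (smoothedLeibniz n L)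
        (leibnizTerm (suc L) * μ (2 ℕ.+ n) (3 ℕ.+ double L)) (leibnizTerm (suc L) * μ n (3 ℕ.+ double L))
        (sign L) (μ n (suc (double L))) (μ n (3 ℕ.+ double L)) (μ n (5 ℕ.+ double L)))
    where
    eq : ∀ n' n s' s t' t σ a b c → n' * (s' + t') ≡ n * (s + t) + - σ * (b - c)
         + (1ℚ * (n' * s' - (n * s + σ * (a - b)))
           + 1ℚ * (n' * t' - (n * t + 2ℚ * (- σ) * (½ * (b + a) - ½ * (c + b)))))
    eq = solve-∀ ringℚ

smoothedLeibniz-one : ∀ L → smoothedLeibniz 1 L ≡ 2ℚ
smoothedLeibniz-one zero = refl
smoothedLeibniz-one (suc L) = trans (cong (_+ leibnizTerm (suc L) * (½ * (0ℚ + 0ℚ))) (smoothedLeibniz-one L)) (eq (leibnizTerm (suc L)))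
  where
  eq : ∀ t → 2ℚ + t * (½ * (0ℚ + 0ℚ)) ≡ 2ℚ
  eq = solve-∀ ringℚ

-- For even L the boundary term is nonnegative by `μ-antitone`, so the product can only grow with J.
-- It starts at 2, because for J = 0 only the lowest frequency contributes.
smoothedLeibniz-lower : ∀ L → sign L ≡ 1ℚ → ∀ J → 2ℚ ≤ odd J * C J * smoothedLeibniz (suc (double J)) L
smoothedLeibniz-lower L even zero = ≤-reflexive (sym (trans (cong (1ℚ * 1ℚ *_) (smoothedLeibniz-one L)) refl))
smoothedLeibniz-lower L even (suc J) = ≤-trans (smoothedLeibniz-lower L even J) (≤-by
  (C-nonneg (suc J) ⊠ diff (μ-antitone (suc (double J)) (suc (double L)))
    ⊞ vanish (C (suc J)) h1 ⊞ vanish (smoothedLeibniz (suc (double J)) L) h2)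
  (eq (odd J) (odd (suc J)) (ℕtoℚ (2 ℕ.+ double J)) (C J) (C (suc J)) (smoothedLeibniz (suc (double J)) L)
      (smoothedLeibniz (3 ℕ.+ double J) L) (μ (suc (double J)) (suc (double L)) - μ (suc (double J)) (3 ℕ.+ double L))))
  where
  h1 : odd (suc J) * smoothedLeibniz (3 ℕ.+ double J) L ≡ ℕtoℚ (2 ℕ.+ double J) * smoothedLeibniz (suc (double J)) L
         + 1ℚ * (μ (suc (double J)) (suc (double L)) - μ (suc (double J)) (3 ℕ.+ double L))
  h1 = trans (smoothedLeibniz-step (suc (double J)) L) (cong (λ s → ℕtoℚ (2 ℕ.+ double J) * smoothedLeibniz (suc (double J)) L
         + s * (μ (suc (double J)) (suc (double L)) - μ (suc (double J)) (3 ℕ.+ double L))) even)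
  h2 : ℕtoℚ (2 ℕ.+ double J) * C (suc J) ≡ odd J * C J
  h2 = trans (cong (_* C (suc J)) (trans (ℕtoℚ-suc (suc (double J))) (+-comm 1ℚ (odd J)))) (C-suc J)
  eq : ∀ o o' n c c' s s' d → o' * c' * s' ≡ o * c * s + (c' * d + c' * (o' * s' - (n * s + 1ℚ * d)) + s * (n * c' - o * c))
  eq = solve-∀ ringℚ

μ-even≤C : ∀ J l → μ (double J) (double l) ≤ C J
μ-even≤C J zero = ≤-refl
μ-even≤C J (suc l) = ≤-trans (μ-antitone (double J) (double l)) (μ-even≤C J l)

½-mean : ∀ {a b c} → a ≤ c → b ≤ c → ½ * (a + b) ≤ c
½-mean {a} {b} {c} a≤c b≤c = ≤-by (0≤½ ⊠ (diff a≤c ⊞ diff b≤c)) (eq a b c)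
  where
  eq : ∀ a b c → c ≡ ½ * (a + b) + ½ * (c - a + (c - b))
  eq = solve-∀ ringℚ

μ-odd≤C : ∀ J l → μ (suc (double J)) (suc (double l)) ≤ C J
μ-odd≤C J l = ½-mean (μ-even≤C J (suc l)) (μ-even≤C J l)

0≤2 : 0ℚ ≤ 2ℚ
0≤2 = ℕtoℚ-nonneg 2

-- By `μ-difference` the j-th step down loses at most 2 (2j+1) `C J` after multiplication by
-- `odd J`, and the first l odd numbers add up to l². So for fixed l and large J all low frequencies
-- carry nearly the same weight `C J`.
μ-even-near-C : ∀ J l → odd J * (C J - μ (double J) (double l)) ≤ C J * (2ℚ * (ℕtoℚ l * ℕtoℚ l))
μ-even-near-C J zero = ≤-reflexive (eq (odd J) (C J))
  where
  eq : ∀ o c → o * (c - c) ≡ c * (2ℚ * (0ℚ * 0ℚ))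
  eq = solve-∀ ringℚ
μ-even-near-C J (suc l) rewrite ℕtoℚ-suc l = ≤-by
  (diff (μ-even-near-C J l) ⊞ 0≤2 ⊠ <⇒≤ (odd-pos l) ⊠ diff (μ-odd≤C J l)
    ⊞ vanish (- 1ℚ) (μ-difference (double J) (double l)) ⊞ vanish (- (2ℚ * C J)) (odd-linear l))
  (eq (odd J) (C J) (μ (double J) (double l)) (μ (double J) (2 ℕ.+ double l)) (odd l) (μ (suc (double J)) (suc (double l))) (ℕtoℚ l))
  where
  eq : ∀ o c a b p m l → c * (2ℚ * ((1ℚ + l) * (1ℚ + l))) ≡ o * (c - b)
       + (c * (2ℚ * (l * l)) - o * (c - a) + 2ℚ * p * (c - m)
          + (- 1ℚ) * (o * (a - b) - 2ℚ * p * m) + - (2ℚ * c) * (p - (1ℚ + 2ℚ * l)))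
  eq = solve-∀ ringℚ

μ-odd-near-C : ∀ J l → odd J * (C J - μ (suc (double J)) (suc (double l))) ≤ C J * (2ℚ * (ℕtoℚ (suc l) * ℕtoℚ (suc l)))
μ-odd-near-C J l = subst (_≤ bound (suc l)) (eq (odd J) (C J) (μ (double J) (double l)) (μ (double J) (2 ℕ.+ double l)))
  (½-mean (μ-even-near-C J (suc l)) (≤-trans (μ-even-near-C J l) (C-nonneg J ⊠-mono≤)))
  where
  bound : ℕ → ℚ
  bound l = C J * (2ℚ * (ℕtoℚ l * ℕtoℚ l))
  _⊠-mono≤ : 0ℚ ≤ C J → bound l ≤ bound (suc l)
  0≤c ⊠-mono≤ = ≤-by (0≤c ⊠ (0≤1 ⊞ ℕtoℚ-nonneg l ⊞ ℕtoℚ-nonneg l) ⊠ 0≤2)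
    (trans (cong (λ x → C J * (2ℚ * (x * x))) (ℕtoℚ-suc l)) (eq' (C J) (ℕtoℚ l)))
    where
    eq' : ∀ c l → c * (2ℚ * ((1ℚ + l) * (1ℚ + l))) ≡ c * (2ℚ * (l * l)) + c * (1ℚ + l + l) * 2ℚ
    eq' = solve-∀ ringℚ
  eq : ∀ o c a b → ½ * (o * (c - b) + o * (c - a)) ≡ o * (c - ½ * (b + a))
  eq = solve-∀ ringℚ

sign-±1 : ∀ l → sign l ≡ 1ℚ ⊎ sign l ≡ - 1ℚ
sign-±1 zero = inj₁ refl
sign-±1 (suc l) with sign l | sign-±1 l
... | _ | inj₁ refl = inj₂ refl
... | _ | inj₂ refl = inj₁ refl

-1≤sign : ∀ l → - 1ℚ ≤ sign l
-1≤sign l with sign l | sign-±1 l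
... | _ | inj₁ refl = toWitness {a? = - 1ℚ ≤? 1ℚ} _
... | _ | inj₂ refl = ≤-refl

0≤4 : 0ℚ ≤ 4ℚ
0≤4 = ℕtoℚ-nonneg 4

-4≤leibnizTerm : ∀ l → - 4ℚ ≤ leibnizTerm l
-4≤leibnizTerm l = *-cancel-≤ (odd-pos l) (≤-by
  (0≤4 ⊠ diff (-1≤sign l) ⊞ 0≤4 ⊠ (0≤2 ⊠ ℕtoℚ-nonneg l) ⊞ vanish 1ℚ (leibnizTerm-odd l) ⊞ vanish 4ℚ (odd-linear l))
  (eq (odd l) (leibnizTerm l) (sign l) (ℕtoℚ l)))
  where
  eq : ∀ o t s l → o * t ≡ o * (- 4ℚ) + (4ℚ * (s - (- 1ℚ)) + 4ℚ * (2ℚ * l) + 1ℚ * (o * t - 4ℚ * s) + 4ℚ * (o - (1ℚ + 2ℚ * l)))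
  eq = solve-∀ ringℚ

smoothingError : ℕ → ℚ
smoothingError zero = 4ℚ * 2ℚ
smoothingError (suc L) = smoothingError L + 4ℚ * (2ℚ * (ℕtoℚ (2 ℕ.+ L) * ℕtoℚ (2 ℕ.+ L)))

-- Replacing each weight by `C J` leaves a partial sum of Leibniz' series. The terms have both
-- signs, but all are at least -4, so the one-sided estimate of `μ-odd-near-C` suffices. The error
-- lacks the factor `odd J` and is negligible for large J.
smoothedLeibniz-upper : ∀ J L → odd J * smoothedLeibniz (suc (double J)) L ≤ C J * (odd J * leibniz (suc L) + smoothingError L)
smoothedLeibniz-upper J = sum
  where
  term : ∀ l → odd J * (leibnizTerm l * μ (suc (double J)) (suc (double l)))
             ≤ C J * (odd J * leibnizTerm l + 4ℚ * (2ℚ * (ℕtoℚ (suc l) * ℕtoℚ (suc l))))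
  term l = ≤-by
    (<⇒≤ (odd-pos J) ⊠ diff (-4≤leibnizTerm l) ⊠ diff (μ-odd≤C J l) ⊞ 0≤4 ⊠ diff (μ-odd-near-C J l))
    (eq (odd J) (C J) (leibnizTerm l) (μ (suc (double J)) (suc (double l))) (2ℚ * (ℕtoℚ (suc l) * ℕtoℚ (suc l))))
    where
    eq : ∀ o c t m b → c * (o * t + 4ℚ * b) ≡ o * (t * m) + (o * (t - (- 4ℚ)) * (c - m) + 4ℚ * (c * b - o * (c - m)))
    eq = solve-∀ ringℚ
  sum : ∀ L → odd J * smoothedLeibniz (suc (double J)) L ≤ C J * (odd J * leibniz (suc L) + smoothingError L)
  sum zero = subst (λ x → odd J * smoothedLeibniz (suc (double J)) 0 ≤ C J * (odd J * x + smoothingError 0))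
    (sym (+-identityˡ (leibnizTerm 0))) (term 0)
  sum (suc L) = ≤-by (diff (sum L) ⊞ diff (term (suc L)))
    (eq (odd J) (C J) (smoothedLeibniz (suc (double J)) L) (leibnizTerm (suc L) * μ (suc (double J)) (3 ℕ.+ double L))
        (leibniz (suc L)) (leibnizTerm (suc L)) (smoothingError L) (4ℚ * (2ℚ * (ℕtoℚ (2 ℕ.+ L) * ℕtoℚ (2 ℕ.+ L)))))
    where
    eq : ∀ o c s m z t q r → c * (o * (z + t) + (q + r)) ≡ o * (s + m)
         + (c * (o * z + q) - o * s + (c * (o * t + r) - o * m))
    eq = solve-∀ ringℚ

wallis-leibniz : ∀ J L → sign L ≡ 1ℚ → 2ℚ ≤ wallis J * leibniz (suc L) + C J * C J * smoothingError L
wallis-leibniz J L even = ≤-by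
  (diff (smoothedLeibniz-lower L even J) ⊞ C-nonneg J ⊠ diff (smoothedLeibniz-upper J L))
  (eq (odd J) (C J) (smoothedLeibniz (suc (double J)) L) (leibniz (suc L)) (smoothingError L))
  where
  eq : ∀ o c s z q → o * (c * c) * z + c * c * q ≡ 2ℚ + (o * c * s - 2ℚ + c * (c * (o * z + q) - o * s))
  eq = solve-∀ ringℚ

-- Taylor sections of |sin|

infixr 8 _^_
_^_ : ℚ → ℕ → ℚ
x ^ zero = 1ℚ
x ^ suc n = x * x ^ n

^-nonneg : ∀ {x} n → 0ℚ ≤ x → 0ℚ ≤ x ^ n
^-nonneg zero 0≤x = 0≤1
^-nonneg (suc n) 0≤x = 0≤x ⊠ ^-nonneg n 0≤x

^-double : ∀ x n → x ^ double n ≡ (x * x) ^ n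
^-double x zero = refl
^-double x (suc n) = trans (cong (λ y → x * (x * y)) (^-double x n)) (sym (*-assoc x x ((x * x) ^ n)))

-- walkSection x i l = Σ_{j≤i} μ j l * x^j
walkSection : ℚ → ℕ → ℕ → ℚ
walkSection x zero l = μ 0 l
walkSection x (suc i) zero = 1ℚ + x * walkSection x i 1
walkSection x (suc i) (suc l) = x * (½ * (walkSection x i (2 ℕ.+ l) + walkSection x i l))

walkSection-suc : ∀ x i l → walkSection x (suc i) l ≡ walkSection x i l + μ (suc i) l * x ^ suc i
walkSection-suc x zero zero = eq x
  where
  eq : ∀ x → 1ℚ + x * 0ℚ ≡ 1ℚ + 0ℚ * (x * 1ℚ)
  eq = solve-∀ ringℚ
walkSection-suc x zero (suc l) = eq x (μ 0 l)
  where
  eq : ∀ x m → x * (½ * (0ℚ + m)) ≡ 0ℚ + ½ * (0ℚ + m) * (x * 1ℚ)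
  eq = solve-∀ ringℚ
walkSection-suc x (suc i) zero = trans (cong (λ y → 1ℚ + x * y) (walkSection-suc x i 1)) (eq x (walkSection x i 1) (μ (suc i) 1) (x ^ suc i))
  where
  eq : ∀ x w m p → 1ℚ + x * (w + m * p) ≡ 1ℚ + x * w + m * (x * p)
  eq = solve-∀ ringℚ
walkSection-suc x (suc i) (suc l) = trans
  (cong₂ (λ y z → x * (½ * (y + z))) (walkSection-suc x i (2 ℕ.+ l)) (walkSection-suc x i l))
  (eq x (walkSection x i (2 ℕ.+ l)) (walkSection x i l) (μ (suc i) (2 ℕ.+ l)) (μ (suc i) l) (x ^ suc i))
  where
  eq : ∀ x w w' m m' p → x * (½ * ((w + m * p) + (w' + m' * p))) ≡ x * (½ * (w + w')) + ½ * (m + m') * (x * p)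
  eq = solve-∀ ringℚ

invSqrtSection : ℕ → ℚ → ℚ
invSqrtSection zero u = 1ℚ
invSqrtSection (suc J) u = invSqrtSection J u + C (suc J) * u ^ suc J

-- The coefficients of the inverse square root are the `μ j 0` with even j; the odd powers only add
-- nonnegative terms. The gain is the walk's recursion in l, on which `walkSection-bound` runs its
-- induction.
invSqrtSection≤walkSection : ∀ {x} → 0ℚ ≤ x → ∀ J → invSqrtSection J (x * x) ≤ walkSection x (double J) 0
invSqrtSection≤walkSection 0≤x zero = ≤-refl
invSqrtSection≤walkSection {x} 0≤x (suc J) = ≤-by
  (diff (invSqrtSection≤walkSection 0≤x J) ⊞ μ-nonneg (suc (double J)) 0 ⊠ ^-nonneg (suc (double J)) 0≤x
    ⊞ vanish 1ℚ (walkSection-suc x (double J) 0) ⊞ vanish 1ℚ (walkSection-suc x (suc (double J)) 0)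
    ⊞ vanish (C (suc J)) (^-double x (suc J)))
  (eq (walkSection x (2 ℕ.+ double J) 0) (walkSection x (suc (double J)) 0) (walkSection x (double J) 0)
      (invSqrtSection J (x * x)) (C (suc J)) ((x * x) ^ suc J) (x ^ double (suc J)) (μ (suc (double J)) 0 * x ^ suc (double J)))
  where
  eq : ∀ w w' w'' v c p q r → w ≡ v + c * p + (w'' - v + r + 1ℚ * (w' - (w'' + r)) + 1ℚ * (w - (w' + c * q)) + c * (q - p))
  eq = solve-∀ ringℚ

-- With x = 2r/(1+r²) and v = (1-r²)/(1+r²), the function l ↦ r^l / v solves the recursion of the
-- full series, so it dominates its sections.
walkSection-bound : ∀ {x v r} → 0ℚ ≤ x → 0ℚ ≤ v → 0ℚ ≤ r → r * (1ℚ + v) ≡ x → r * r * (1ℚ + v) ≡ 1ℚ - v →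
  ∀ i l → v * walkSection x i l ≤ r ^ l
walkSection-bound {x} {v} {r} 0≤x 0≤v 0≤r h1 h2 = go
  where
  go : ∀ i l → v * walkSection x i l ≤ r ^ l
  go zero zero = ≤-by (0≤r ⊠ 0≤r ⊠ (0≤1 ⊞ 0≤v) ⊞ vanish (- 1ℚ) h2) (eq v r)
    where
    eq : ∀ v r → 1ℚ ≡ v * 1ℚ + (r * r * (1ℚ + v) + (- 1ℚ) * (r * r * (1ℚ + v) - (1ℚ - v)))
    eq = solve-∀ ringℚ
  go zero (suc l) = ≤-by (^-nonneg (suc l) 0≤r) (eq v (r ^ suc l))
    where
    eq : ∀ v r → r ≡ v * 0ℚ + r
    eq = solve-∀ ringℚ
  go (suc i) zero = ≤-by (0≤x ⊠ diff (go i 1) ⊞ vanish r h1 ⊞ vanish (- 1ℚ) h2) (eq x v r (walkSection x i 1))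
    where
    eq : ∀ x v r w → 1ℚ ≡ v * (1ℚ + x * w)
         + (x * (r * 1ℚ - v * w) + r * (r * (1ℚ + v) - x) + (- 1ℚ) * (r * r * (1ℚ + v) - (1ℚ - v)))
    eq = solve-∀ ringℚ
  go (suc i) (suc l) = ≤-by
    (0≤½ ⊠ 0≤x ⊠ (diff (go i (2 ℕ.+ l)) ⊞ diff (go i l))
      ⊞ vanish (½ * (r ^ l * (r * r + 1ℚ))) h1 ⊞ vanish (- (½ * (r ^ l * r))) h2)
    (eq x v r (r ^ l) (walkSection x i (2 ℕ.+ l)) (walkSection x i l))
    where
    eq : ∀ x v r p w w' → r * p ≡ v * (x * (½ * (w + w')))
         + (½ * x * ((r * (r * p) - v * w) + (p - v * w'))
            + ½ * (p * (r * r + 1ℚ)) * (r * (1ℚ + v) - x) + - (½ * (p * r)) * (r * r * (1ℚ + v) - (1ℚ - v)))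
    eq = solve-∀ ringℚ

invSqrtSection-bound : ∀ {x v} → 0ℚ ≤ x → 0ℚ ≤ v → x * x + v * v ≡ 1ℚ → ∀ J → v * invSqrtSection J (x * x) ≤ 1ℚ
-- The r of `walkSection-bound` is x / (1 + v), the tangent of the half-angle, and so is rational
-- together with x and v.
invSqrtSection-bound {x} {v} 0≤x 0≤v unit J with reciprocal (+-mono-<-≤ 0<1 0≤v)
... | w , 0<w , inv = ≤-trans
    (≤-by (0≤v ⊠ diff (invSqrtSection≤walkSection 0≤x J)) (eq₀ v (invSqrtSection J (x * x)) (walkSection x (double J) 0)))
    (walkSection-bound 0≤x 0≤v (0≤x ⊠ <⇒≤ 0<w) h1 h2 (double J) 0)
  where
  eq₀ : ∀ v a b → v * b ≡ v * a + v * (b - a)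
  eq₀ = solve-∀ ringℚ
  h1 : x * w * (1ℚ + v) ≡ x
  h1 = ≡-by (null x inv) (eq x w v)
    where
    eq : ∀ x w v → x * w * (1ℚ + v) ≡ x + x * ((1ℚ + v) * w - 1ℚ)
    eq = solve-∀ ringℚ
  h2 : x * w * (x * w) * (1ℚ + v) ≡ 1ℚ - v
  h2 = ≡-by (null (x * (x * w)) inv ⊕ null w unit ⊕ null (1ℚ - v) inv) (eq x w v)
    where
    eq : ∀ x w v → x * w * (x * w) * (1ℚ + v) ≡ 1ℚ - v + (x * (x * w) * ((1ℚ + v) * w - 1ℚ)
         + w * (x * x + v * v - 1ℚ) + (1ℚ - v) * ((1ℚ + v) * w - 1ℚ))
    eq = solve-∀ ringℚ

-- A Taylor section of |sin| in powers of cos, up to its last term: with c = cos t, it equals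
-- 1 - Σ_{1≤i≤J} (C (i-1) - C i) c^(2i) - C J c^(2J+2).
minorant : ℕ → ℚ → ℚ
minorant J c = (1ℚ - c * c) * invSqrtSection J (c * c)

minorant-≤ : ∀ {c v} → 0ℚ ≤ v → c * c + v * v ≡ 1ℚ → ∀ J → minorant J c ≤ v
minorant-≤ {c} {v} 0≤v unit J = ≤-by (0≤v ⊠ diff v*section≤1 ⊞ vanish (invSqrtSection J (c * c)) unit) (eq c v (invSqrtSection J (c * c)))
  where
  eq : ∀ c v s → v ≡ (1ℚ - c * c) * s + (v * (1ℚ - v * s) + s * (c * c + v * v - 1ℚ))
  eq = solve-∀ ringℚ
  square-neg : ∀ c → (0ℚ - c) * (0ℚ - c) ≡ c * c
  square-neg = solve-∀ ringℚ
  v*section≤1 : v * invSqrtSection J (c * c) ≤ 1ℚ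
  v*section≤1 with ≤-total 0ℚ c
  ... | inj₁ 0≤c = invSqrtSection-bound 0≤c 0≤v unit J
  ... | inj₂ c≤0 = subst (λ y → v * invSqrtSection J y ≤ 1ℚ) (square-neg c)
    (invSqrtSection-bound (diff c≤0) 0≤v (trans (cong (_+ v * v) (square-neg c)) unit) J)

-- Moments of finite sums

∑ : ∀ {A : Set} → List A → (A → ℚ) → ℚ
∑ [] f = 0ℚ
∑ (a ∷ as) f = f a + ∑ as f

module _ {A : Set} where

  ∑-mono : ∀ (as : List A) {f g} → (∀ a → f a ≤ g a) → ∑ as f ≤ ∑ as g
  ∑-mono [] f≤g = ≤-refl
  ∑-mono (a ∷ as) f≤g = +-mono-≤ (f≤g a) (∑-mono as f≤g)

  ∑-cong : ∀ (as : List A) {f g} → (∀ a → f a ≡ g a) → ∑ as f ≡ ∑ as g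
  ∑-cong [] f≡g = refl
  ∑-cong (a ∷ as) f≡g = cong₂ _+_ (f≡g a) (∑-cong as f≡g)

  ∑-+ : ∀ (as : List A) f g → ∑ as (λ a → f a + g a) ≡ ∑ as f + ∑ as g
  ∑-+ [] f g = refl
  ∑-+ (a ∷ as) f g = trans (cong (f a + g a +_) (∑-+ as f g)) (eq (f a) (g a) (∑ as f) (∑ as g))
    where
    eq : ∀ a b c d → a + b + (c + d) ≡ a + c + (b + d)
    eq = solve-∀ ringℚ

  ∑-* : ∀ (as : List A) c f → ∑ as (λ a → c * f a) ≡ c * ∑ as f
  ∑-* [] c f = sym (*-zeroʳ c)
  ∑-* (a ∷ as) c f = trans (cong (c * f a +_) (∑-* as c f)) (sym (*-distribˡ-+ c (f a) (∑ as f)))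

  ∑-const : ∀ (as : List A) c → ∑ as (λ _ → c) ≡ ℕtoℚ (length as) * c
  ∑-const [] c = sym (*-zeroˡ c)
  ∑-const (a ∷ as) c = trans (cong (c +_) (∑-const as c)) (trans (eq c (ℕtoℚ (length as))) (cong (_* c) (sym (ℕtoℚ-suc (length as)))))
    where
    eq : ∀ c n → c + n * c ≡ (1ℚ + n) * c
    eq = solve-∀ ringℚ

  -- The moments of c, where T is the sequence of Chebyshev polynomials evaluated at c.
  module Moments (as : List A) (c : A → ℚ) (T : ℕ → A → ℚ)
    (T-zero : ∀ a → T 0 a ≡ 1ℚ) (T-one : ∀ a → T 1 a ≡ c a)
    (T-step : ∀ l a → T (2 ℕ.+ l) a ≡ 2ℚ * c a * T (suc l) a - T l a)
    (L : ℕ) (e : ℚ) (bound : ∀ l → suc l ℕ.≤ L → ∑ as (T (suc l)) ≤ e) where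

    private
      k : ℚ
      k = ℕtoℚ (length as)

    -- For i = 0 the bounds are k = e + 1 (k - e) when l = 0 and e = e + 0 (k - e) otherwise.
    -- Multiplication by c averages the neighbours l and l + 2 of `suc l` exactly as `μ` does; since
    -- the two weights add up to 1, the error e is not amplified.
    moment-T : ∀ i l → i ℕ.+ l ℕ.≤ L → ∑ as (λ a → c a ^ i * T l a) ≤ e + μ i l * (k - e)
    moment-T zero zero _ = ≤-reflexive (trans (∑-cong as (λ a → trans (*-identityˡ (T 0 a)) (T-zero a))) (trans (∑-const as 1ℚ) (eq k e)))
      where
      eq : ∀ k e → k * 1ℚ ≡ e + 1ℚ * (k - e)
      eq = solve-∀ ringℚ
    moment-T zero (suc l) l<L = subst₂ _≤_ (∑-cong as (λ a → sym (*-identityˡ (T (suc l) a)))) (eq k e) (bound l l<L)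
      where
      eq : ∀ k e → e ≡ e + 0ℚ * (k - e)
      eq = solve-∀ ringℚ
    moment-T (suc i) zero h = subst (_≤ e + μ i 1 * (k - e)) (∑-cong as pointwise)
      (moment-T i 1 (subst (ℕ._≤ L) (sym (ℕP.+-suc i 0)) h))
      where
      pointwise : ∀ a → c a ^ i * T 1 a ≡ c a ^ suc i * T 0 a
      pointwise a = trans (cong (c a ^ i *_) (T-one a)) (trans (eq (c a) (c a ^ i)) (cong (c a ^ suc i *_) (sym (T-zero a))))
        where
        eq : ∀ c p → p * c ≡ c * p * 1ℚ
        eq = solve-∀ ringℚ
    moment-T (suc i) (suc l) h = ≤-by
      (0≤½ ⊠ (diff (moment-T i (2 ℕ.+ l) h₂) ⊞ diff (moment-T i l (ℕP.≤-trans (ℕP.+-monoʳ-≤ i (ℕP.m≤n+m l 2)) h₂))) ⊞ vanish (- 1ℚ) split)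
      (eq (∑ as (λ a → c a ^ suc i * T (suc l) a)) (∑ as (λ a → c a ^ i * T (2 ℕ.+ l) a)) (∑ as (λ a → c a ^ i * T l a))
          e (μ i (2 ℕ.+ l)) (μ i l) (k - e))
      where
      h₂ : i ℕ.+ (2 ℕ.+ l) ℕ.≤ L
      h₂ = subst (ℕ._≤ L) (sym (ℕP.+-suc i (suc l))) h
      pointwise : ∀ a → c a ^ suc i * T (suc l) a ≡ ½ * (c a ^ i * T (2 ℕ.+ l) a + c a ^ i * T l a)
      pointwise a = trans (eq' (c a) (c a ^ i) (T (suc l) a) (T l a))
        (cong (λ t → ½ * (c a ^ i * t + c a ^ i * T l a)) (sym (T-step l a)))
        where
        eq' : ∀ c p t t' → c * p * t ≡ ½ * (p * (2ℚ * c * t - t') + p * t')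
        eq' = solve-∀ ringℚ
      split : ∑ as (λ a → c a ^ suc i * T (suc l) a) ≡ ½ * (∑ as (λ a → c a ^ i * T (2 ℕ.+ l) a) + ∑ as (λ a → c a ^ i * T l a))
      split = trans (∑-cong as pointwise) (trans (∑-* as ½ _) (cong (½ *_) (∑-+ as _ _)))
      eq : ∀ s a b e m m' d → e + ½ * (m + m') * d ≡ s + (½ * (e + m * d - a + (e + m' * d - b)) + (- 1ℚ) * (s - ½ * (a + b)))
      eq = solve-∀ ringℚ

    moment : ∀ i → double i ℕ.≤ L → ∑ as (λ a → (c a * c a) ^ i) ≤ e + C i * (k - e)
    moment i h = subst (_≤ e + C i * (k - e)) (∑-cong as pointwise) (moment-T (double i) 0 (subst (ℕ._≤ L) (sym (ℕP.+-identityʳ (double i))) h))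
      where
      pointwise : ∀ a → c a ^ double i * T 0 a ≡ (c a * c a) ^ i
      pointwise a = trans (cong₂ _*_ (^-double (c a) i) (T-zero a)) (*-identityʳ _)

    -- The summand is 1 - Σ_{1≤i≤J} (C (i-1) - C i) c^(2i), so `moment` is needed only as an upper
    -- bound. The multiples of e collect to 1 - (C 0 - C J) = C J.
    taylor-lower : ∀ J → double J ℕ.≤ L →
      (k - e) * wallis J + C J * e ≤ ∑ as (λ a → minorant J (c a) + C J * (c a * c a) ^ suc J)
    taylor-lower zero _ = ≤-reflexive (trans (eq k e) (sym (trans (∑-cong as (λ a → eq' (c a * c a))) (∑-const as 1ℚ))))
      where
      eq : ∀ k e → (k - e) * (1ℚ * (1ℚ * 1ℚ)) + 1ℚ * e ≡ k * 1ℚ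
      eq = solve-∀ ringℚ
      eq' : ∀ u → (1ℚ - u) * 1ℚ + 1ℚ * (u * 1ℚ) ≡ 1ℚ
      eq' = solve-∀ ringℚ
    taylor-lower (suc J) h = ≤-by
      (diff (taylor-lower J (ℕP.≤-trans (ℕP.m≤n+m (double J) 2) h)) ⊞ diff (C-antitone J) ⊠ diff (moment (suc J) h)
        ⊞ vanish 1ℚ split ⊞ vanish (- (k - e)) (wallis-suc J))
      (eq k e (wallis J) (wallis (suc J)) (C J) (C (suc J)) (∑ as (λ a → minorant J (c a) + C J * (c a * c a) ^ suc J))
          (∑ as (λ a → (c a * c a) ^ suc J)) (∑ as (λ a → minorant (suc J) (c a) + C (suc J) * (c a * c a) ^ (2 ℕ.+ J))))
      where
      pointwise : ∀ a → minorant (suc J) (c a) + C (suc J) * (c a * c a) ^ (2 ℕ.+ J)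
        ≡ minorant J (c a) + C J * (c a * c a) ^ suc J + (C (suc J) - C J) * (c a * c a) ^ suc J
      pointwise a = eq' (c a * c a) (invSqrtSection J (c a * c a)) (C J) (C (suc J)) ((c a * c a) ^ suc J)
        where
        eq' : ∀ u v c d p → (1ℚ - u) * (v + d * p) + d * (u * p) ≡ (1ℚ - u) * v + c * p + (d - c) * p
        eq' = solve-∀ ringℚ
      split : ∑ as (λ a → minorant (suc J) (c a) + C (suc J) * (c a * c a) ^ (2 ℕ.+ J))
        ≡ ∑ as (λ a → minorant J (c a) + C J * (c a * c a) ^ suc J) + (C (suc J) - C J) * ∑ as (λ a → (c a * c a) ^ suc J)
      split = trans (∑-cong as pointwise) (trans (∑-+ as _ _) (cong (∑ as (λ a → minorant J (c a) + C J * (c a * c a) ^ suc J) +_) (∑-* as (C (suc J) - C J) _)))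
      eq : ∀ k e w w' c d s m s' → s' ≡ (k - e) * w' + d * e
           + (s - ((k - e) * w + c * e) + (c - d) * (e + d * (k - e) - m) + 1ℚ * (s' - (s + (d - c) * m))
              + - (k - e) * (w' - (w - (c - d) * d)))
      eq = solve-∀ ringℚ

    -- Removing the last power costs `C J` times its moment, and the two multiples `C J * e` cancel.
    minorant-mean : ∀ J → double (suc J) ℕ.≤ L → (k - e) * (wallis J - C J * C (suc J)) ≤ ∑ as (λ a → minorant J (c a))
    minorant-mean J h = ≤-by
      (diff (taylor-lower J (ℕP.≤-trans (ℕP.m≤n+m (double J) 2) h)) ⊞ C-nonneg J ⊠ diff (moment (suc J) h) ⊞ vanish (- 1ℚ) split)
      (eq k e (wallis J) (C J) (C (suc J)) (∑ as (λ a → minorant J (c a) + C J * (c a * c a) ^ suc J))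
          (∑ as (λ a → (c a * c a) ^ suc J)) (∑ as (λ a → minorant J (c a))))
      where
      split : ∑ as (λ a → minorant J (c a) + C J * (c a * c a) ^ suc J)
        ≡ ∑ as (λ a → minorant J (c a)) + C J * ∑ as (λ a → (c a * c a) ^ suc J)
      split = trans (∑-+ as _ _) (cong (∑ as (λ a → minorant J (c a)) +_) (∑-* as (C J) _))
      eq : ∀ k e w c d s m s' → s' ≡ (k - e) * (w - c * d)
           + (s - ((k - e) * w + c * e) + c * (e + d * (k - e) - m) + (- 1ℚ) * (s - (s' + c * m)))
      eq = solve-∀ ringℚ

-- Representation counts in A + A

module _ {A : Set} {f : A → ℚ} (0≤f : ∀ a → 0ℚ ≤ f a) where

  ∑-nonneg : ∀ as → 0ℚ ≤ ∑ as f
  ∑-nonneg [] = ≤-refl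
  ∑-nonneg (a ∷ as) = 0≤f a ⊞ ∑-nonneg as

  ∑-∈ : ∀ {as a} → a ∈ as → f a ≤ ∑ as f
  ∑-∈ {_ ∷ as} {a} (here refl) = ≤-by (∑-nonneg as) refl
  ∑-∈ {b ∷ as} {a} (there a∈as) = ≤-by (0≤f b ⊞ diff (∑-∈ a∈as)) (eq (f a) (f b) (∑ as f))
    where
    eq : ∀ x y s → y + s ≡ x + (y + (s - x))
    eq = solve-∀ ringℚ

  ∑-∈₂ : ∀ {as a b} → a ∈ as → b ∈ as → a ≢ b → f a + f b ≤ ∑ as f
  ∑-∈₂ (here refl) (here refl) a≢b = contradiction refl a≢b
  ∑-∈₂ {_ ∷ as} {a} {b} (here refl) (there b∈) _ = +-monoʳ-≤ (f a) (∑-∈ b∈)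
  ∑-∈₂ {_ ∷ as} {a} {b} (there a∈) (here refl) _ = subst (_≤ f b + ∑ as f) (+-comm (f b) (f a)) (+-monoʳ-≤ (f b) (∑-∈ a∈))
  ∑-∈₂ {c ∷ as} {a} {b} (there a∈) (there b∈) a≢b = ≤-by (0≤f c ⊞ diff (∑-∈₂ a∈ b∈ a≢b)) (eq (f a + f b) (f c) (∑ as f))
    where
    eq : ∀ x y s → y + s ≡ x + (y + (s - x))
    eq = solve-∀ ringℚ

∑-swap : ∀ {A B : Set} (as : List A) (bs : List B) (g : A → B → ℚ) →
  ∑ as (λ a → ∑ bs (g a)) ≡ ∑ bs (λ b → ∑ as (λ a → g a b))
∑-swap [] bs g = sym (trans (∑-const bs 0ℚ) (*-zeroʳ (ℕtoℚ (length bs))))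
∑-swap (a ∷ as) bs g = trans (cong (∑ bs (g a) +_) (∑-swap as bs g)) (sym (∑-+ bs (g a) (λ b → ∑ as (λ a' → g a' b))))

range : ℕ → List ℕ
range zero = []
range (suc n) = suc n ∷ range n

length-range : ∀ n → length (range n) ≡ n
length-range zero = refl
length-range (suc n) = cong suc (length-range n)

indicator : Bool → ℚ
indicator b = if b then 1ℚ else 0ℚ

indicator-nonneg : ∀ b → 0ℚ ≤ indicator b
indicator-nonneg true = 0≤1
indicator-nonneg false = ≤-refl

δ : ℤ → ℤ → ℚ
δ x y = indicator ⌊ x ℤ.≟ y ⌋

δ-nonneg : ∀ x y → 0ℚ ≤ δ x y
δ-nonneg x y = indicator-nonneg ⌊ x ℤ.≟ y ⌋

δ-≡ : ∀ {x y} → x ≡ y → δ x y ≡ 1ℚ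
δ-≡ {x} {y} x≡y with x ℤ.≟ y
... | yes _ = refl
... | no x≢y = contradiction x≡y x≢y

δ-≢ : ∀ {x y} → x ≢ y → δ x y ≡ 0ℚ
δ-≢ {x} {y} x≢y with x ℤ.≟ y
... | yes x≡y = contradiction x≡y x≢y
... | no _ = refl

module _ (ψ : ℤ → ℚ) (0≤ψ : ∀ i → 0ℚ ≤ ψ i) where

  private
    weight : ℤ → ℕ → ℚ
    weight x m = δ x (ℤ.+ m) * ψ (ℤ.+ m)

    weight-≢ : ∀ {x m} → x ≢ ℤ.+ m → weight x m ≡ 0ℚ
    weight-≢ {x} {m} x≢m = trans (cong (_* ψ (ℤ.+ m)) (δ-≢ x≢m)) (*-zeroˡ (ψ (ℤ.+ m)))

    ∑-δ-outside : ∀ x n → (∀ m → m ℕ.≤ n → x ≢ ℤ.+ m) → ∑ (range n) (weight x) ≡ 0ℚ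
    ∑-δ-outside x zero _ = refl
    ∑-δ-outside x (suc n) x≢ = cong₂ _+_ (weight-≢ (x≢ (suc n) ℕP.≤-refl)) (∑-δ-outside x n (λ m m≤n → x≢ m (ℕP.m≤n⇒m≤1+n m≤n)))

  ∑-δ≤ : ∀ x n → ∑ (range n) (λ m → δ x (ℤ.+ m) * ψ (ℤ.+ m)) ≤ ψ x
  ∑-δ≤ x zero = 0≤ψ x
  ∑-δ≤ x (suc n) with x ℤ.≟ ℤ.+ suc n
  ... | yes refl = ≤-reflexive (trans (cong₂ _+_ (*-identityˡ (ψ x)) (∑-δ-outside x n (λ m m≤n e → ℕP.<⇒≢ (s≤s m≤n) (sym (ℤP.+-injective e))))) (+-identityʳ (ψ x)))
  ... | no _ = subst (_≤ ψ x) (sym (trans (cong (_+ ∑ (range n) (weight x)) (*-zeroˡ (ψ (ℤ.+ suc n)))) (+-identityˡ _))) (∑-δ≤ x n)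

module Pairs (A : List ℤ) where

  ∑∑ : (ℤ → ℚ) → ℚ
  ∑∑ φ = ∑ A (λ a → ∑ A (λ b → φ (a ℤ.+ b)))

  pairs diagonal : ℤ → ℚ
  pairs x = ∑∑ (λ y → δ y x)
  diagonal x = ∑ A (λ a → δ (a ℤ.+ a) x)

  inSumset-witness : ∀ x → IsTrue (inSumset A x) → Σ ℤ λ a → Σ ℤ λ b → a ∈ A × b ∈ A × a ℤ.+ b ≡ x
  inSumset-witness x t with find (any⁻ _ A t)
  ... | a , a∈A , t' with find (any⁻ _ A t')
  ... | b , b∈A , t'' = a , b , a∈A , b∈A , toWitness t''

  -- Two distinct summands are counted in both orders; a sum a + a is counted a second time by
  -- `diagonal`.
  multiplicity : ∀ x → IsTrue (inSumset A x) → 2ℚ ≤ pairs x + diagonal x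
  multiplicity x t with inSumset-witness x t
  ... | a , b , a∈A , b∈A , refl with a ℤ.≟ b
  ... | yes refl = +-mono-≤ (≤-trans (row a a∈A refl) (∑-∈ (λ a → row-nonneg a) a∈A)) (subst (_≤ diagonal x) (δ-≡ refl) (∑-∈ (λ a → δ-nonneg (a ℤ.+ a) x) a∈A))
    where
    row-nonneg : ∀ a → 0ℚ ≤ ∑ A (λ b → δ (a ℤ.+ b) x)
    row-nonneg a = ∑-nonneg (λ b → δ-nonneg (a ℤ.+ b) x) A
    row : ∀ a {b} → b ∈ A → a ℤ.+ b ≡ x → 1ℚ ≤ ∑ A (λ b → δ (a ℤ.+ b) x)
    row a b∈A e = subst (_≤ ∑ A (λ b → δ (a ℤ.+ b) x)) (δ-≡ e) (∑-∈ (λ b → δ-nonneg (a ℤ.+ b) x) b∈A)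
  ... | no a≢b = ≤-by (diff (∑-∈₂ row-nonneg a∈A b∈A a≢b) ⊞ diff (row a b∈A refl) ⊞ diff (row b a∈A (ℤP.+-comm b a))
        ⊞ ∑-nonneg (λ a → δ-nonneg (a ℤ.+ a) x) A)
        (eq (∑ A (λ b → δ (a ℤ.+ b) x)) (∑ A (λ c → δ (b ℤ.+ c) x)) (pairs x) (diagonal x))
    where
    row-nonneg : ∀ a → 0ℚ ≤ ∑ A (λ b → δ (a ℤ.+ b) x)
    row-nonneg a = ∑-nonneg (λ b → δ-nonneg (a ℤ.+ b) x) A
    row : ∀ a {b} → b ∈ A → a ℤ.+ b ≡ x → 1ℚ ≤ ∑ A (λ b → δ (a ℤ.+ b) x)
    row a b∈A e = subst (_≤ ∑ A (λ b → δ (a ℤ.+ b) x)) (δ-≡ e) (∑-∈ (λ b → δ-nonneg (a ℤ.+ b) x) b∈A)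
    eq : ∀ r s p d → p + d ≡ 2ℚ + (p - (r + s) + (r - 1ℚ) + (s - 1ℚ) + d)
    eq = solve-∀ ringℚ

  missing : ℕ → ℚ
  missing n = ℕtoℚ n - ℕtoℚ (sumsetCount A n)

  ∑-missing : ∀ n → ∑ (range n) (λ m → 1ℚ - indicator (inSumset A (ℤ.+ m))) ≡ missing n
  ∑-missing zero = refl
  ∑-missing (suc n) = trans (cong₂ _+_ (cong (λ x → 1ℚ - x) (cast (inSumset A (ℤ.+ suc n)))) (∑-missing n))
    (trans (eq (ℕtoℚ (if inSumset A (ℤ.+ suc n) then 1 else 0)) (ℕtoℚ n) (ℕtoℚ (sumsetCount A n)))
      (sym (cong₂ _-_ (ℕtoℚ-suc n) (ℕtoℚ-+ (sumsetCount A n) (if inSumset A (ℤ.+ suc n) then 1 else 0)))))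
    where
    cast : ∀ b → indicator b ≡ ℕtoℚ (if b then 1 else 0)
    cast true = refl
    cast false = refl
    eq : ∀ i n s → 1ℚ - i + (n - s) ≡ 1ℚ + n - (s + i)
    eq = solve-∀ ringℚ

  k : ℚ
  k = ℕtoℚ (length A)

  module _ (ψ : ℤ → ℚ) (K : ℚ) (0≤ψ : ∀ i → 0ℚ ≤ ψ i) (ψ≤K : ∀ i → ψ i ≤ K) where

    private
      pull : ∀ {B : Set} (bs : List B) (g : B → ℤ) m → ∑ bs (λ b → δ (g b) (ℤ.+ m)) * ψ (ℤ.+ m) ≡ ∑ bs (λ b → δ (g b) (ℤ.+ m) * ψ (ℤ.+ m))
      pull bs g m = trans (*-comm _ (ψ (ℤ.+ m))) (trans (sym (∑-* bs (ψ (ℤ.+ m)) _)) (∑-cong bs (λ b → *-comm (ψ (ℤ.+ m)) _)))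

      column : ∀ {B : Set} (bs : List B) (g : B → ℤ) n → ∑ (range n) (λ m → ∑ bs (λ b → δ (g b) (ℤ.+ m)) * ψ (ℤ.+ m)) ≤ ∑ bs (λ b → ψ (g b))
      column bs g n = subst (_≤ ∑ bs (λ b → ψ (g b)))
        (sym (trans (∑-cong (range n) (pull bs g)) (∑-swap (range n) bs (λ m b → δ (g b) (ℤ.+ m) * ψ (ℤ.+ m)))))
        (∑-mono bs (λ b → ∑-δ≤ ψ 0≤ψ (g b) n))

    ∑-pairs : ∀ n → ∑ (range n) (λ m → pairs (ℤ.+ m) * ψ (ℤ.+ m)) ≤ ∑∑ ψ
    ∑-pairs n = subst (_≤ ∑∑ ψ)
      (sym (trans (∑-cong (range n) pull-row) (∑-swap (range n) A (λ m a → ∑ A (λ b → δ (a ℤ.+ b) (ℤ.+ m)) * ψ (ℤ.+ m)))))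
      (∑-mono A (λ a → column A (λ b → a ℤ.+ b) n))
      where
      pull-row : ∀ m → pairs (ℤ.+ m) * ψ (ℤ.+ m) ≡ ∑ A (λ a → ∑ A (λ b → δ (a ℤ.+ b) (ℤ.+ m)) * ψ (ℤ.+ m))
      pull-row m = trans (*-comm _ (ψ (ℤ.+ m))) (trans (sym (∑-* A (ψ (ℤ.+ m)) _)) (∑-cong A (λ a → *-comm (ψ (ℤ.+ m)) _)))

    -- A point of [n] in the sumset has weight at least 2 in `pairs` plus `diagonal`; at any other
    -- point the term 2K pays for 2ψ. Summing over the diagonal costs at most k K.
    covering-bound : ∀ n → 2ℚ * ∑ (range n) (λ m → ψ (ℤ.+ m)) ≤ ∑∑ ψ + k * K + 2ℚ * K * missing n
    covering-bound n = ≤-by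
      (diff (∑-mono (range n) pointwise) ⊞ diff (∑-pairs n) ⊞ diff (column A (λ a → a ℤ.+ a) n) ⊞ diff (∑-mono A (λ a → ψ≤K (a ℤ.+ a)))
        ⊞ vanish 1ℚ e₁ ⊞ vanish (- 1ℚ) e₂ ⊞ vanish (- (2ℚ * K)) (∑-missing n) ⊞ vanish (- 1ℚ) (∑-const A K))
      (eq (∑ (range n) (λ m → ψ (ℤ.+ m))) (∑∑ ψ) (∑ (range n) (λ m → pairs (ℤ.+ m) * ψ (ℤ.+ m))) (∑ (range n) (λ m → diagonal (ℤ.+ m) * ψ (ℤ.+ m)))
          (∑ A (λ a → ψ (a ℤ.+ a))) (∑ A (λ _ → K)) (k * K) (2ℚ * K) (missing n) (∑ (range n) (λ m → 1ℚ - indicator (inSumset A (ℤ.+ m))))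
          (∑ (range n) (λ m → 2ℚ * ψ (ℤ.+ m)))
          (∑ (range n) (λ m → pairs (ℤ.+ m) * ψ (ℤ.+ m) + diagonal (ℤ.+ m) * ψ (ℤ.+ m) + 2ℚ * K * (1ℚ - indicator (inSumset A (ℤ.+ m))))))
      where
      below : ∀ m b → (IsTrue b → 2ℚ ≤ pairs (ℤ.+ m) + diagonal (ℤ.+ m)) →
        2ℚ * ψ (ℤ.+ m) ≤ pairs (ℤ.+ m) * ψ (ℤ.+ m) + diagonal (ℤ.+ m) * ψ (ℤ.+ m) + 2ℚ * K * (1ℚ - indicator b)
      below m true h = ≤-by (0≤ψ (ℤ.+ m) ⊠ diff (h tt)) (eq' (ψ (ℤ.+ m)) (pairs (ℤ.+ m)) (diagonal (ℤ.+ m)) K)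
        where
        eq' : ∀ y p d c → p * y + d * y + 2ℚ * c * (1ℚ - 1ℚ) ≡ 2ℚ * y + y * (p + d - 2ℚ)
        eq' = solve-∀ ringℚ
      below m false h = ≤-by
        (0≤ψ (ℤ.+ m) ⊠ ∑-nonneg (λ a → ∑-nonneg (λ b → δ-nonneg (a ℤ.+ b) (ℤ.+ m)) A) A
          ⊞ 0≤ψ (ℤ.+ m) ⊠ ∑-nonneg (λ a → δ-nonneg (a ℤ.+ a) (ℤ.+ m)) A ⊞ 0≤2 ⊠ diff (ψ≤K (ℤ.+ m)))
        (eq' (ψ (ℤ.+ m)) (pairs (ℤ.+ m)) (diagonal (ℤ.+ m)) K)
        where
        eq' : ∀ y p d c → p * y + d * y + 2ℚ * c * (1ℚ - 0ℚ) ≡ 2ℚ * y + (y * p + y * d + 2ℚ * (c - y))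
        eq' = solve-∀ ringℚ
      pointwise : ∀ m → 2ℚ * ψ (ℤ.+ m) ≤ pairs (ℤ.+ m) * ψ (ℤ.+ m) + diagonal (ℤ.+ m) * ψ (ℤ.+ m) + 2ℚ * K * (1ℚ - indicator (inSumset A (ℤ.+ m)))
      pointwise m = below m (inSumset A (ℤ.+ m)) (multiplicity (ℤ.+ m))
      e₁ : ∑ (range n) (λ m → 2ℚ * ψ (ℤ.+ m)) ≡ 2ℚ * ∑ (range n) (λ m → ψ (ℤ.+ m))
      e₁ = ∑-* (range n) 2ℚ _
      e₂ : ∑ (range n) (λ m → pairs (ℤ.+ m) * ψ (ℤ.+ m) + diagonal (ℤ.+ m) * ψ (ℤ.+ m) + 2ℚ * K * (1ℚ - indicator (inSumset A (ℤ.+ m))))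
        ≡ ∑ (range n) (λ m → pairs (ℤ.+ m) * ψ (ℤ.+ m)) + ∑ (range n) (λ m → diagonal (ℤ.+ m) * ψ (ℤ.+ m))
          + 2ℚ * K * ∑ (range n) (λ m → 1ℚ - indicator (inSumset A (ℤ.+ m)))
      e₂ = trans (∑-+ (range n) _ _) (cong₂ _+_ (∑-+ (range n) _ _) (∑-* (range n) (2ℚ * K) _))
      eq : ∀ s pp p d da ka kk c mi mi' s2 big → pp + kk + c * mi ≡ 2ℚ * s
           + (big - s2 + (pp - p) + (da - d) + (ka - da) + 1ℚ * (s2 - 2ℚ * s) + (- 1ℚ) * (big - (p + d + c * mi'))
              + - c * (mi' - mi) + (- 1ℚ) * (ka - kk))
      eq = solve-∀ ringℚ

  -- Δ with its error terms: four times the number of missing points, and 2k for the diagonal.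
  excess : ℕ → ℚ
  excess n = k * k - 2ℚ * ℕtoℚ n + 4ℚ * missing n + 2ℚ * k

  -- `covering-bound` for Φ - φ, which lies between 0 and 2Φ. The shift turns a lower bound on
  -- representation counts into the ℓ¹ estimate, tested against φ.
  sumset-bound : ∀ φ Φ → (∀ i → φ i ≤ Φ) → (∀ i → - Φ ≤ φ i) → ∀ n →
    ∑∑ φ ≤ excess n * Φ + 2ℚ * ∑ (range n) (λ m → φ (ℤ.+ m))
  sumset-bound φ Φ φ≤Φ -Φ≤φ n = ≤-by
    (diff (covering-bound (λ i → Φ - φ i) (2ℚ * Φ) (λ i → diff (φ≤Φ i)) (λ i → ≤-by (diff (-Φ≤φ i)) (eq₀ Φ (φ i))) n)
      ⊞ vanish 2ℚ (e₁ (range n) (λ m → φ (ℤ.+ m))) ⊞ vanish (2ℚ * Φ) (cong ℕtoℚ (length-range n)) ⊞ vanish (- 1ℚ) e₂)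
    (eq k Φ (ℕtoℚ n) (ℕtoℚ (length (range n))) (missing n) (∑∑ φ) (∑∑ (λ i → Φ - φ i)) (∑ (range n) (λ m → φ (ℤ.+ m))) (∑ (range n) (λ m → Φ - φ (ℤ.+ m))))
    where
    eq₀ : ∀ c y → 2ℚ * c ≡ c - y + (y - (- c))
    eq₀ = solve-∀ ringℚ
    e₁ : ∀ {B : Set} (bs : List B) (f : B → ℚ) → ∑ bs (λ b → Φ - f b) ≡ ℕtoℚ (length bs) * Φ - ∑ bs f
    e₁ [] f = sym (trans (cong (_- 0ℚ) (*-zeroˡ Φ)) refl)
    e₁ (b ∷ bs) f = trans (cong (Φ - f b +_) (e₁ bs f)) (trans (eq' Φ (f b) (ℕtoℚ (length bs)) (∑ bs f))
      (cong (λ x → x * Φ - (f b + ∑ bs f)) (sym (ℕtoℚ-suc (length bs)))))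
      where
      eq' : ∀ c y l s → c - y + (l * c - s) ≡ (1ℚ + l) * c - (y + s)
      eq' = solve-∀ ringℚ
    e₂ : ∑∑ (λ i → Φ - φ i) ≡ k * (k * Φ) - ∑∑ φ
    e₂ = trans (∑-cong A (λ a → e₁ A (λ b → φ (a ℤ.+ b)))) (trans (∑-+ A _ _)
      (cong₂ _+_ (∑-const A (k * Φ)) (trans (∑-cong A (λ a → eq' (∑ A (λ b → φ (a ℤ.+ b))))) (trans (∑-* A (- 1ℚ) _) (sym (eq' _))))))
      where
      eq' : ∀ x → - x ≡ (- 1ℚ) * x
      eq' = solve-∀ ringℚ
    eq : ∀ k c n n' mi pp pp' s s' → (k * k - 2ℚ * n + 4ℚ * mi + 2ℚ * k) * c + 2ℚ * s ≡ pp
         + (pp' + k * (2ℚ * c) + 2ℚ * (2ℚ * c) * mi - 2ℚ * s' + 2ℚ * (s' - (n' * c - s)) + 2ℚ * c * (n' - n)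
            + (- 1ℚ) * (pp' - (k * (k * c) - pp)))
    eq = solve-∀ ringℚ

-- The Fourier transform at a rational point of the unit circle

infix 4 _+i_
record ℂ : Set where
  constructor _+i_
  field
    re im : ℚ
open ℂ public

ℂ-≡ : ∀ {x y} → re x ≡ re y → im x ≡ im y → x ≡ y
ℂ-≡ refl refl = refl

infixl 7 _·_
_·_ : ℂ → ℂ → ℂ
x · y = (re x * re y - im x * im y) +i (re x * im y + im x * re y)

1ℂ : ℂ
1ℂ = 1ℚ +i 0ℚ

conj : ℂ → ℂ
conj x = re x +i (- im x)

∣_∣² : ℂ → ℚ
∣ x ∣² = re x * re x + im x * im x

Unit : ℂ → Set
Unit x = ∣ x ∣² ≡ 1ℚ

·-comm : ∀ x y → x · y ≡ y · x
·-comm x y = ℂ-≡ (eq₁ (re x) (im x) (re y) (im y)) (eq₂ (re x) (im x) (re y) (im y))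
  where
  eq₁ : ∀ a b c d → a * c - b * d ≡ c * a - d * b
  eq₁ = solve-∀ ringℚ
  eq₂ : ∀ a b c d → a * d + b * c ≡ c * b + d * a
  eq₂ = solve-∀ ringℚ

·-assoc : ∀ x y z → (x · y) · z ≡ x · (y · z)
·-assoc x y z = ℂ-≡ (eq₁ (re x) (im x) (re y) (im y) (re z) (im z)) (eq₂ (re x) (im x) (re y) (im y) (re z) (im z))
  where
  eq₁ : ∀ a b c d e f → (a * c - b * d) * e - (a * d + b * c) * f ≡ a * (c * e - d * f) - b * (c * f + d * e)
  eq₁ = solve-∀ ringℚ
  eq₂ : ∀ a b c d e f → (a * c - b * d) * f + (a * d + b * c) * e ≡ a * (c * f + d * e) + b * (c * e - d * f)
  eq₂ = solve-∀ ringℚ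

·-identityˡ : ∀ x → 1ℂ · x ≡ x
·-identityˡ x = ℂ-≡ (eq₁ (re x) (im x)) (eq₂ (re x) (im x))
  where
  eq₁ : ∀ a b → 1ℚ * a - 0ℚ * b ≡ a
  eq₁ = solve-∀ ringℚ
  eq₂ : ∀ a b → 1ℚ * b + 0ℚ * a ≡ b
  eq₂ = solve-∀ ringℚ

·-interchange : ∀ w x y z → (w · x) · (y · z) ≡ (w · y) · (x · z)
·-interchange w x y z = trans (·-assoc w x (y · z)) (trans (cong (w ·_)
  (trans (sym (·-assoc x y z)) (trans (cong (_· z) (·-comm x y)) (·-assoc y x z)))) (sym (·-assoc w y (x · z))))

∣∣²-· : ∀ x y → ∣ x · y ∣² ≡ ∣ x ∣² * ∣ y ∣²
∣∣²-· x y = eq (re x) (im x) (re y) (im y)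
  where
  eq : ∀ a b c d → (a * c - b * d) * (a * c - b * d) + (a * d + b * c) * (a * d + b * c) ≡ (a * a + b * b) * (c * c + d * d)
  eq = solve-∀ ringℚ

Unit-· : ∀ {x y} → Unit x → Unit y → Unit (x · y)
Unit-· {x} {y} ux uy = trans (∣∣²-· x y) (cong₂ _*_ ux uy)

Unit-conj : ∀ {x} → Unit x → Unit (conj x)
Unit-conj {x} ux = trans (eq (re x) (im x)) ux
  where
  eq : ∀ a b → a * a + - b * - b ≡ a * a + b * b
  eq = solve-∀ ringℚ

conj-inverse : ∀ {x} → Unit x → conj x · x ≡ 1ℂ
conj-inverse {x} ux = ℂ-≡ (trans (eq₁ (re x) (im x)) ux) (eq₂ (re x) (im x))
  where
  eq₁ : ∀ a b → a * a - - b * b ≡ a * a + b * b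
  eq₁ = solve-∀ ringℚ
  eq₂ : ∀ a b → a * b + - b * a ≡ 0ℚ
  eq₂ = solve-∀ ringℚ

conj-· : ∀ x y → conj (x · y) ≡ conj x · conj y
conj-· x y = ℂ-≡ (eq₁ (re x) (im x) (re y) (im y)) (eq₂ (re x) (im x) (re y) (im y))
  where
  eq₁ : ∀ a b c d → a * c - b * d ≡ a * c - - b * - d
  eq₁ = solve-∀ ringℚ
  eq₂ : ∀ a b c d → - (a * d + b * c) ≡ a * - d + - b * c
  eq₂ = solve-∀ ringℚ

infixr 8 _↑_
_↑_ : ℂ → ℕ → ℂ
x ↑ zero = 1ℂ
x ↑ suc n = x · x ↑ n

↑-+ : ∀ x m n → x ↑ (m ℕ.+ n) ≡ x ↑ m · x ↑ n
↑-+ x zero n = sym (·-identityˡ (x ↑ n))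
↑-+ x (suc m) n = trans (cong (x ·_) (↑-+ x m n)) (sym (·-assoc x (x ↑ m) (x ↑ n)))

1↑ : ∀ n → 1ℂ ↑ n ≡ 1ℂ
1↑ zero = refl
1↑ (suc n) = trans (·-identityˡ (1ℂ ↑ n)) (1↑ n)

·-↑ : ∀ x y n → (x · y) ↑ n ≡ x ↑ n · y ↑ n
·-↑ x y zero = sym (·-identityˡ 1ℂ)
·-↑ x y (suc n) = trans (cong (x · y ·_) (·-↑ x y n)) (·-interchange x y (x ↑ n) (y ↑ n))

↑-comm : ∀ x m n → (x ↑ m) ↑ n ≡ (x ↑ n) ↑ m
↑-comm x zero n = 1↑ n
↑-comm x (suc m) n = trans (·-↑ x (x ↑ m) n) (cong (x ↑ n ·_) (↑-comm x m n))

↑-* : ∀ x m n → x ↑ (m ℕ.* n) ≡ (x ↑ n) ↑ m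
↑-* x zero n = refl
↑-* x (suc m) n = trans (↑-+ x n (m ℕ.* n)) (cong (x ↑ n ·_) (↑-* x m n))

conj-↑ : ∀ x n → conj (x ↑ n) ≡ conj x ↑ n
conj-↑ x zero = refl
conj-↑ x (suc n) = trans (conj-· x (x ↑ n)) (cong (conj x ·_) (conj-↑ x n))

Unit-↑ : ∀ {x} n → Unit x → Unit (x ↑ n)
Unit-↑ zero ux = refl
Unit-↑ {x} (suc n) ux = Unit-· {x} {x ↑ n} ux (Unit-↑ {x} n ux)

character : ℂ → ℤ → ℂ
character x (ℤ.+ n) = x ↑ n
character x -[1+ n ] = conj x ↑ suc n

Unit-character : ∀ {x} i → Unit x → Unit (character x i)
Unit-character {x} (ℤ.+ n) ux = Unit-↑ {x} n ux
Unit-character {x} -[1+ n ] ux = Unit-↑ {conj x} (suc n) (Unit-conj {x} ux)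

character-↑ : ∀ x n i → character (x ↑ n) i ≡ character x i ↑ n
character-↑ x n (ℤ.+ m) = ↑-comm x n m
character-↑ x n -[1+ m ] = trans (cong (_↑ suc m) (conj-↑ x n)) (↑-comm (conj x) n (suc m))

module _ {x : ℂ} (ux : Unit x) where

  character-suc : ∀ i → character x (ℤ.suc i) ≡ x · character x i
  character-suc (ℤ.+ n) = refl
  character-suc -[1+ zero ] = sym (trans (cong (x ·_) (trans (·-comm (conj x) 1ℂ) (·-identityˡ (conj x)))) (trans (·-comm x (conj x)) (conj-inverse {x} ux)))
  character-suc -[1+ suc n ] = sym (trans (sym (·-assoc x (conj x) (conj x ↑ suc n)))
    (trans (cong (_· conj x ↑ suc n) (trans (·-comm x (conj x)) (conj-inverse {x} ux))) (·-identityˡ (conj x ↑ suc n))))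

  character-pred : ∀ i → character x (ℤ.pred i) ≡ conj x · character x i
  character-pred i = sym (begin
    conj x · character x i                        ≡⟨ cong (λ j → conj x · character x j) (sym (ℤP.suc-pred i)) ⟩
    conj x · character x (ℤ.suc (ℤ.pred i))       ≡⟨ cong (conj x ·_) (character-suc (ℤ.pred i)) ⟩
    conj x · (x · character x (ℤ.pred i))         ≡⟨ sym (·-assoc (conj x) x _) ⟩
    (conj x · x) · character x (ℤ.pred i)         ≡⟨ cong (_· character x (ℤ.pred i)) (conj-inverse {x} ux) ⟩
    1ℂ · character x (ℤ.pred i)                   ≡⟨ ·-identityˡ _ ⟩
    character x (ℤ.pred i)                        ∎)
    where open ≡-Reasoning

  character-+ : ∀ i j → character x (i ℤ.+ j) ≡ character x i · character x j
  character-+ (ℤ.+ zero) j = trans (cong (character x) (ℤP.+-identityˡ j)) (sym (·-identityˡ _))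
  character-+ (ℤ.+ suc n) j = begin
    character x (ℤ.+ suc n ℤ.+ j)                 ≡⟨ cong (character x) (ℤP.+-assoc (ℤ.+ 1) (ℤ.+ n) j) ⟩
    character x (ℤ.suc (ℤ.+ n ℤ.+ j))             ≡⟨ character-suc (ℤ.+ n ℤ.+ j) ⟩
    x · character x (ℤ.+ n ℤ.+ j)                 ≡⟨ cong (x ·_) (character-+ (ℤ.+ n) j) ⟩
    x · (x ↑ n · character x j)                   ≡⟨ sym (·-assoc x (x ↑ n) (character x j)) ⟩
    x ↑ suc n · character x j                     ∎
    where open ≡-Reasoning
  character-+ -[1+ zero ] j = trans (character-pred j) (cong (_· character x j) (sym (trans (·-comm (conj x) 1ℂ) (·-identityˡ (conj x)))))
  character-+ -[1+ suc n ] j = begin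
    character x (-[1+ suc n ] ℤ.+ j)              ≡⟨ cong (character x) (ℤP.+-assoc (-[1+ 0 ]) -[1+ n ] j) ⟩
    character x (ℤ.pred (-[1+ n ] ℤ.+ j))         ≡⟨ character-pred (-[1+ n ] ℤ.+ j) ⟩
    conj x · character x (-[1+ n ] ℤ.+ j)         ≡⟨ cong (conj x ·_) (character-+ -[1+ n ] j) ⟩
    conj x · (conj x ↑ suc n · character x j)     ≡⟨ sym (·-assoc (conj x) (conj x ↑ suc n) (character x j)) ⟩
    conj x ↑ (2 ℕ.+ n) · character x j            ∎
    where open ≡-Reasoning

dot : ℂ → ℂ → ℚ
dot x y = re x * re y + im x * im y

dot≤ : ∀ x y {r} → 0ℚ ≤ r → ∣ x ∣² * ∣ y ∣² ≤ r * r → dot x y ≤ r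
dot≤ x y 0≤r h = square-cancel-≤ 0≤r (≤-by (diff h ⊞ square-nonneg (re x * im y - im x * re y)) (eq (re x) (im x) (re y) (im y) _))
  where
  eq : ∀ a b c d s → s ≡ (a * c + b * d) * (a * c + b * d) + (s - (a * a + b * b) * (c * c + d * d) + (a * d - b * c) * (a * d - b * c))
  eq = solve-∀ ringℚ

0≤∣∣² : ∀ x → 0ℚ ≤ ∣ x ∣²
0≤∣∣² x = square-nonneg (re x) ⊞ square-nonneg (im x)

module FourierBound (A : List ℤ) {x : ℂ} (ux : Unit x) (n : ℕ)
  (geometric : ∣ ∑ (range n) (λ m → re (x ↑ m)) +i ∑ (range n) (λ m → im (x ↑ m)) ∣² ≤ 1ℚ) where

  open Pairs A

  transform : ℂ
  transform = ∑ A (λ a → re (character x a)) +i ∑ A (λ a → im (character x a))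

  private
    D d : ℂ
    D = ∑ (range n) (λ m → re (x ↑ m)) +i ∑ (range n) (λ m → im (x ↑ m))
    d = transform · transform

    ∑-dot : ∀ {B : Set} (bs : List B) (g : B → ℂ) w → ∑ bs (λ b → dot w (g b)) ≡ dot w (∑ bs (λ b → re (g b)) +i ∑ bs (λ b → im (g b)))
    ∑-dot bs g w = trans (∑-+ bs _ _) (cong₂ _+_ (∑-* bs (re w) _) (∑-* bs (im w) _))

    ∣d∣² : ∣ d ∣² ≡ ∣ transform ∣² * ∣ transform ∣²
    ∣d∣² = ∣∣²-· transform transform

    -- Testing in the direction of F², with F the transform: the sum of φ over all pairs is |F|⁴,
    -- while |φ| is at most |F|². Leaving F² unnormalised avoids a division.
    φ : ℤ → ℚ
    φ i = dot d (character x i)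

    φ≤ : ∀ i → φ i ≤ ∣ transform ∣²
    φ≤ i = dot≤ d (character x i) (0≤∣∣² transform) (≤-reflexive (trans (cong₂ _*_ ∣d∣² (Unit-character {x} i ux)) (*-identityʳ _)))

    -φ≤ : ∀ i → - ∣ transform ∣² ≤ φ i
    -φ≤ i = ≤-by (diff (dot≤ ((- re d) +i (- im d)) (character x i) (0≤∣∣² transform)
        (≤-reflexive (trans (cong₂ _*_ (trans (eq₀ (re d) (im d)) ∣d∣²) (Unit-character {x} i ux)) (*-identityʳ _)))))
      (eq (re d) (im d) (re (character x i)) (im (character x i)) ∣ transform ∣²)
      where
      eq₀ : ∀ a b → - a * - a + - b * - b ≡ a * a + b * b
      eq₀ = solve-∀ ringℚ
      eq : ∀ a b c e f → a * c + b * e ≡ - f + (f - (- a * c + - b * e))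
      eq = solve-∀ ringℚ

    ∑∑φ : ∑∑ φ ≡ ∣ transform ∣² * ∣ transform ∣²
    ∑∑φ = begin
      ∑∑ φ                                                      ≡⟨ ∑-cong A (λ a → trans (∑-cong A (row a)) (∑-dot A (character x) (w a))) ⟩
      ∑ A (λ a → dot (w a) transform)                           ≡⟨ ∑-cong A (λ a → adjoint d (character x a) transform) ⟩
      ∑ A (λ a → dot (d · conj transform) (character x a))      ≡⟨ ∑-dot A (character x) (d · conj transform) ⟩
      dot (d · conj transform) transform                        ≡⟨ eq (re transform) (im transform) ⟩
      ∣ transform ∣² * ∣ transform ∣²                            ∎
      where
      open ≡-Reasoning
      w : ℤ → ℂ
      w a = d · conj (character x a)
      adjoint : ∀ u v y → dot (u · conj v) y ≡ dot (u · conj y) v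
      adjoint u v y = eq' (re u) (im u) (re v) (im v) (re y) (im y)
        where
        eq' : ∀ a b c d e f → (a * c - b * - d) * e + (a * - d + b * c) * f ≡ (a * e - b * - f) * c + (a * - f + b * e) * d
        eq' = solve-∀ ringℚ
      row : ∀ a b → φ (a ℤ.+ b) ≡ dot (w a) (character x b)
      row a b = trans (cong (dot d) (character-+ {x} ux a b)) (eq' (re d) (im d) (re (character x a)) (im (character x a)) (re (character x b)) (im (character x b)))
        where
        eq' : ∀ a b c d e f → a * (c * e - d * f) + b * (c * f + d * e) ≡ (a * c - b * - d) * e + (a * - d + b * c) * f
        eq' = solve-∀ ringℚ
      eq : ∀ a b → ((a * a - b * b) * a - (a * b + b * a) * - b) * a + ((a * a - b * b) * - b + (a * b + b * a) * a) * b
         ≡ (a * a + b * b) * (a * a + b * b)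
      eq = solve-∀ ringℚ

    ∑φ≤ : ∑ (range n) (λ m → φ (ℤ.+ m)) ≤ ∣ transform ∣²
    ∑φ≤ = subst (_≤ ∣ transform ∣²) (sym (∑-dot (range n) (x ↑_) d)) (dot≤ d D (0≤∣∣² transform)
      (≤-by (0≤∣∣² transform ⊠ 0≤∣∣² transform ⊠ diff geometric ⊞ vanish (- ∣ D ∣²) ∣d∣²) (eq ∣ d ∣² ∣ D ∣² ∣ transform ∣²)))
      where
      eq : ∀ a b f → f * f ≡ a * b + (f * f * (1ℚ - b) + - b * (a - f * f))
      eq = solve-∀ ringℚ

  -- `sumset-bound` becomes |F|⁴ ≤ (excess + 2) |F|², where the 2 comes from the geometric sum being
  -- bounded by 1 instead of vanishing. A factor |F|² cancels, as it is positive whenever the claim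
  -- fails.
  transform-bound : ∀ {e} → 0ℚ ≤ e → excess n + 2ℚ ≤ e * e → ∣ transform ∣² ≤ e * e
  transform-bound {e} 0≤e h with ∣ transform ∣² ≤? e * e
  ... | yes p = p
  ... | no ¬p = *-cancel-≤ (≤-<-trans (square-nonneg e) (≰⇒> ¬p)) (≤-by
      (diff (sumset-bound φ ∣ transform ∣² φ≤ -φ≤ n) ⊞ 0≤2 ⊠ diff ∑φ≤ ⊞ vanish 1ℚ ∑∑φ ⊞ 0≤∣∣² transform ⊠ diff h)
      (eq ∣ transform ∣² (excess n) (∑ (range n) (λ m → φ (ℤ.+ m))) (∑∑ φ) (e * e)))
    where
    eq : ∀ f x s t e → f * e ≡ f * f + (x * f + 2ℚ * s - t + 2ℚ * (f - s) + 1ℚ * (t - f * f) + f * (e - (x + 2ℚ)))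
    eq = solve-∀ ringℚ

  transform-re : ∀ {e} → 0ℚ ≤ e → excess n + 2ℚ ≤ e * e → re transform ≤ e
  transform-re {e} 0≤e h = square-cancel-≤ 0≤e (≤-by (diff (transform-bound 0≤e h) ⊞ square-nonneg (im transform)) (eq (re transform) (im transform) (e * e)))
    where
    eq : ∀ a b e → e ≡ a * a + (e - (a * a + b * b) + b * b)
    eq = solve-∀ ringℚ

  transform-im : ∀ {e} → 0ℚ ≤ e → excess n + 2ℚ ≤ e * e → im transform ≤ e
  transform-im {e} 0≤e h = square-cancel-≤ 0≤e (≤-by (diff (transform-bound 0≤e h) ⊞ square-nonneg (re transform)) (eq (re transform) (im transform) (e * e)))
    where
    eq : ∀ a b e → e ≡ b * b + (e - (a * a + b * b) + a * a)
    eq = solve-∀ ringℚ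

-- Rational approximations of e(1/n)

infixl 6 _⊹_ _⊝_
_⊹_ _⊝_ : ℂ → ℂ → ℂ
x ⊹ y = (re x + re y) +i (im x + im y)
x ⊝ y = (re x - re y) +i (im x - im y)

norm-+ : ∀ x y {r s} → 0ℚ ≤ r → 0ℚ ≤ s → ∣ x ∣² ≤ r * r → ∣ y ∣² ≤ s * s → ∣ x ⊹ y ∣² ≤ (r + s) * (r + s)
norm-+ x y {r} {s} 0≤r 0≤s hx hy = ≤-by
  (diff hx ⊞ diff hy ⊞ 0≤2 ⊠ diff (dot≤ x y (0≤r ⊠ 0≤s) product))
  (eq (re x) (im x) (re y) (im y) r s)
  where
  product : ∣ x ∣² * ∣ y ∣² ≤ (r * s) * (r * s)
  product = ≤-by (0≤∣∣² x ⊠ diff hy ⊞ 0≤s ⊠ 0≤s ⊠ diff hx) (eq' ∣ x ∣² ∣ y ∣² r s)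
    where
    eq' : ∀ a b r s → r * s * (r * s) ≡ a * b + (a * (s * s - b) + s * s * (r * r - a))
    eq' = solve-∀ ringℚ
  eq : ∀ a b c d r s → (r + s) * (r + s) ≡ (a + c) * (a + c) + (b + d) * (b + d)
       + (r * r - (a * a + b * b) + (s * s - (c * c + d * d)) + 2ℚ * (r * s - (a * c + b * d)))
  eq = solve-∀ ringℚ

Near : ℂ → ℚ → Set
Near x r = ∣ x ⊝ 1ℂ ∣² ≤ r * r

Near-· : ∀ {x y r s} → Unit x → 0ℚ ≤ r → 0ℚ ≤ s → Near x r → Near y s → Near (x · y) (r + s)
Near-· {x} {y} {r} {s} ux 0≤r 0≤s nx ny = subst (_≤ (r + s) * (r + s)) (eq (re x) (im x) (re y) (im y))
  (norm-+ (x ⊝ 1ℂ) (x · (y ⊝ 1ℂ)) 0≤r 0≤s nx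
    (subst (_≤ s * s) (sym (trans (∣∣²-· x (y ⊝ 1ℂ)) (trans (cong (_* ∣ y ⊝ 1ℂ ∣²) ux) (*-identityˡ _)))) ny))
  where
  eq : ∀ a b c d → (a - 1ℚ + (a * (c - 1ℚ) - b * (d - 0ℚ))) * (a - 1ℚ + (a * (c - 1ℚ) - b * (d - 0ℚ)))
         + (b - 0ℚ + (a * (d - 0ℚ) + b * (c - 1ℚ))) * (b - 0ℚ + (a * (d - 0ℚ) + b * (c - 1ℚ)))
       ≡ (a * c - b * d - 1ℚ) * (a * c - b * d - 1ℚ) + (a * d + b * c - 0ℚ) * (a * d + b * c - 0ℚ)
  eq = solve-∀ ringℚ

Near-↑ : ∀ {x r} → Unit x → 0ℚ ≤ r → Near x r → ∀ n → Near (x ↑ n) (ℕtoℚ n * r)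
Near-↑ {r = r} ux 0≤r nx zero = subst (0ℚ ≤_) refl (square-nonneg (0ℚ * r))
Near-↑ {x} {r} ux 0≤r nx (suc n) = subst (Near (x ↑ suc n)) (trans (eq r (ℕtoℚ n)) (cong (_* r) (sym (ℕtoℚ-suc n))))
  (Near-· {x} {x ↑ n} ux 0≤r (ℕtoℚ-nonneg n ⊠ 0≤r) nx (Near-↑ {x} ux 0≤r nx n))
  where
  eq : ∀ r n → r + n * r ≡ (1ℚ + n) * r
  eq = solve-∀ ringℚ

Near-conj : ∀ {x r} → Near x r → Near (conj x) r
Near-conj {x} {r} = subst (_≤ r * r) (eq (re x) (im x))
  where
  eq : ∀ a b → (a - 1ℚ) * (a - 1ℚ) + (b - 0ℚ) * (b - 0ℚ) ≡ (a - 1ℚ) * (a - 1ℚ) + (- b - 0ℚ) * (- b - 0ℚ)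
  eq = solve-∀ ringℚ

Near-mono : ∀ {x r s} → 0ℚ ≤ r → r ≤ s → Near x r → Near x s
Near-mono {x} {r} {s} 0≤r r≤s h = ≤-trans h (≤-by (diff r≤s ⊠ diff r≤s ⊞ (0≤r ⊠ diff r≤s ⊞ 0≤r ⊠ diff r≤s)) (eq r s))
  where
  eq : ∀ r s → s * s ≡ r * r + ((s - r) * (s - r) + (r * (s - r) + r * (s - r)))
  eq = solve-∀ ringℚ

powerSum : ℂ → ℕ → ℂ
powerSum x n = ∑ (range n) (λ m → re (x ↑ m)) +i ∑ (range n) (λ m → im (x ↑ m))

-- Multiplying a geometric sum by x^R changes it by at most R times the distance of x^n from 1; when x^R
-- lies in the left half plane that change is at least as long as the sum itself.
powerSum-bound : ∀ {x κ} → Unit x → 0ℚ ≤ κ → ∀ n → Near (x ↑ n) κ → ∀ R → re (x ↑ R) ≤ 0ℚ →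
  ∣ powerSum x n ∣² ≤ (ℕtoℚ R * κ) * (ℕtoℚ R * κ)
powerSum-bound {x} {κ} ux 0≤κ n near R left = ≤-trans
  (≤-by (0≤∣∣² D ⊠ (diff left ⊞ diff left ⊞ 0≤1) ⊞ vanish ∣ D ∣² (Unit-↑ {x} R ux)) (eq (re D) (im D) (re (x ↑ R)) (im (x ↑ R))))
  (shift R)
  where
  D : ℂ
  D = powerSum x n
  telescope : ∀ n → x · powerSum x n ⊝ powerSum x n ≡ x · (x ↑ n ⊝ 1ℂ)
  telescope zero = ℂ-≡ (eq₁ (re x) (im x)) (eq₂ (re x) (im x))
    where
    eq₁ : ∀ a b → a * 0ℚ - b * 0ℚ - 0ℚ ≡ a * (1ℚ - 1ℚ) - b * (0ℚ - 0ℚ)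
    eq₁ = solve-∀ ringℚ
    eq₂ : ∀ a b → a * 0ℚ + b * 0ℚ - 0ℚ ≡ a * (0ℚ - 0ℚ) + b * (1ℚ - 1ℚ)
    eq₂ = solve-∀ ringℚ
  telescope (suc n) = ℂ-≡
    (≡-by (null 1ℚ (cong re (telescope n))) (eq₁ (re x) (im x) (re (powerSum x n)) (im (powerSum x n)) (re (x ↑ n)) (im (x ↑ n))))
    (≡-by (null 1ℚ (cong im (telescope n))) (eq₂ (re x) (im x) (re (powerSum x n)) (im (powerSum x n)) (re (x ↑ n)) (im (x ↑ n))))
    where
    eq₁ : ∀ a b c d p q → a * (a * p - b * q + c) - b * (a * q + b * p + d) - (a * p - b * q + c)
        ≡ a * (a * p - b * q - 1ℚ) - b * (a * q + b * p - 0ℚ)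
        + 1ℚ * (a * c - b * d - c - (a * (p - 1ℚ) - b * (q - 0ℚ)))
    eq₁ = solve-∀ ringℚ
    eq₂ : ∀ a b c d p q → a * (a * q + b * p + d) + b * (a * p - b * q + c) - (a * q + b * p + d)
        ≡ a * (a * q + b * p - 0ℚ) + b * (a * p - b * q - 1ℚ)
        + 1ℚ * (a * d + b * c - d - (a * (q - 0ℚ) + b * (p - 1ℚ)))
    eq₂ = solve-∀ ringℚ
  one : ∣ x · D ⊝ D ∣² ≤ κ * κ
  one = subst (_≤ κ * κ) (sym (trans (cong ∣_∣² (telescope n)) (trans (∣∣²-· x (x ↑ n ⊝ 1ℂ)) (trans (cong (_* ∣ x ↑ n ⊝ 1ℂ ∣²) ux) (*-identityˡ _))))) near
  shift : ∀ R → ∣ x ↑ R · D ⊝ D ∣² ≤ (ℕtoℚ R * κ) * (ℕtoℚ R * κ)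
  shift zero = ≤-reflexive (eq₀ (re D) (im D) κ)
    where
    eq₀ : ∀ a b k → (1ℚ * a - 0ℚ * b - a) * (1ℚ * a - 0ℚ * b - a) + (1ℚ * b + 0ℚ * a - b) * (1ℚ * b + 0ℚ * a - b) ≡ 0ℚ * k * (0ℚ * k)
    eq₀ = solve-∀ ringℚ
  shift (suc R) = subst₂ _≤_ (cong ∣_∣² (sym split)) (cong (λ r → r * r) (trans (eq₀ κ (ℕtoℚ R)) (cong (_* κ) (sym (ℕtoℚ-suc R)))))
    (norm-+ (x · D ⊝ D) (x · (x ↑ R · D ⊝ D)) 0≤κ (ℕtoℚ-nonneg R ⊠ 0≤κ) one
      (subst (_≤ _) (sym (trans (∣∣²-· x _) (trans (cong (_* ∣ x ↑ R · D ⊝ D ∣²) ux) (*-identityˡ _)))) (shift R)))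
    where
    eq₀ : ∀ k r → k + r * k ≡ (1ℚ + r) * k
    eq₀ = solve-∀ ringℚ
    split : x ↑ suc R · D ⊝ D ≡ (x · D ⊝ D) ⊹ x · (x ↑ R · D ⊝ D)
    split = ℂ-≡ (eq₁ (re x) (im x) (re (x ↑ R)) (im (x ↑ R)) (re D) (im D)) (eq₂ (re x) (im x) (re (x ↑ R)) (im (x ↑ R)) (re D) (im D))
      where
      eq₁ : ∀ a b p q c d → (a * p - b * q) * c - (a * q + b * p) * d - c
          ≡ a * c - b * d - c + (a * (p * c - q * d - c) - b * (p * d + q * c - d))
      eq₁ = solve-∀ ringℚ
      eq₂ : ∀ a b p q c d → (a * p - b * q) * d + (a * q + b * p) * c - d
          ≡ a * d + b * c - d + (a * (p * d + q * c - d) + b * (p * c - q * d - c))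
      eq₂ = solve-∀ ringℚ
  eq : ∀ c d p q → (p * c - q * d - c) * (p * c - q * d - c) + (p * d + q * c - d) * (p * d + q * c - d)
     ≡ c * c + d * d + ((c * c + d * d) * (0ℚ - p + (0ℚ - p) + 1ℚ) + (c * c + d * d) * (p * p + q * q - 1ℚ))
  eq = solve-∀ ringℚ

record SmallRotation (b : ℚ) : Set where
  field
    ζ : ℂ
    unit : Unit ζ
    near : Near ζ b
    0≤re : 0ℚ ≤ re ζ
    re<1 : re ζ < 1ℚ
    0≤im : 0ℚ ≤ im ζ
    im≤ : im ζ ≤ b

-- The point of the unit circle with tangent half-angle b/2.
smallRotation : ∀ {b} → 0ℚ < b → b ≤ 1ℚ → SmallRotation b
smallRotation {b} 0<b b≤1 = record
  { ζ = ((1ℚ - t * t) * w) +i (b * w)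
  ; unit = ≡-by (null ((1ℚ + t * t) * w + 1ℚ) inv) (eq-unit b w)
  ; near = ≤-by (square-nonneg b ⊠ (square-nonneg t ⊠ <⇒≤ 0<w) ⊞ vanish (- (b * b * 1ℚ + (1ℚ + t * t) * w - 1ℚ)) inv) (eq-near b w)
  ; 0≤re = ≤-by (0≤½ ⊠ (diff b≤1 ⊞ 0≤1) ⊠ (0≤1 ⊞ 0≤½ ⊠ 0≤b) ⊠ <⇒≤ 0<w) (eq-0≤re b w)
  ; re<1 = <-by (+-mono-<-≤ (pos* 0<½ (pos* (pos* 0<b 0<b) 0<w)) (vanish (- 1ℚ) inv)) (eq-re<1 b w)
  ; 0≤im = 0≤b ⊠ <⇒≤ 0<w
  ; im≤ = ≤-by (0≤b ⊠ (square-nonneg t ⊠ <⇒≤ 0<w) ⊞ vanish (- b) inv) (eq-im b w)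
  }
  where
  0≤b : 0ℚ ≤ b
  0≤b = <⇒≤ 0<b
  0<½ : 0ℚ < ½
  0<½ = toWitness {a? = 0ℚ <? ½} _
  t : ℚ
  t = ½ * b
  r : Σ ℚ λ w → 0ℚ < w × (1ℚ + t * t) * w ≡ 1ℚ
  r = reciprocal (+-mono-<-≤ 0<1 (square-nonneg t))
  w : ℚ
  w = proj₁ r
  0<w : 0ℚ < w
  0<w = proj₁ (proj₂ r)
  inv : (1ℚ + t * t) * w ≡ 1ℚ
  inv = proj₂ (proj₂ r)
  eq-unit : ∀ b w → (1ℚ - ½ * b * (½ * b)) * w * ((1ℚ - ½ * b * (½ * b)) * w) + b * w * (b * w)
    ≡ 1ℚ + ((1ℚ + ½ * b * (½ * b)) * w + 1ℚ) * ((1ℚ + ½ * b * (½ * b)) * w - 1ℚ)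
  eq-unit = solve-∀ ringℚ
  -- ∣ζ - 1∣² = 2 - 2 re ζ = b² w modulo (1 + t²) w = 1
  eq-near : ∀ b w → b * b ≡ ((1ℚ - ½ * b * (½ * b)) * w - 1ℚ) * ((1ℚ - ½ * b * (½ * b)) * w - 1ℚ) + (b * w - 0ℚ) * (b * w - 0ℚ)
    + (b * b * (½ * b * (½ * b) * w) + - (b * b * 1ℚ + (1ℚ + ½ * b * (½ * b)) * w - 1ℚ) * ((1ℚ + ½ * b * (½ * b)) * w - 1ℚ))
  eq-near = solve-∀ ringℚ
  eq-0≤re : ∀ b w → (1ℚ - ½ * b * (½ * b)) * w ≡ 0ℚ + ½ * (1ℚ - b + 1ℚ) * (1ℚ + ½ * b) * w
  eq-0≤re = solve-∀ ringℚ
  eq-re<1 : ∀ b w → 1ℚ ≡ (1ℚ - ½ * b * (½ * b)) * w + (½ * (b * b * w) + (- 1ℚ) * ((1ℚ + ½ * b * (½ * b)) * w - 1ℚ))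
  eq-re<1 = solve-∀ ringℚ
  eq-im : ∀ b w → b ≡ b * w + (b * (½ * b * (½ * b) * w) + - b * ((1ℚ + ½ * b * (½ * b)) * w - 1ℚ))
  eq-im = solve-∀ ringℚ

im≤1 : ∀ {x} → Unit x → im x ≤ 1ℚ
im≤1 {x} ux = square-cancel-≤ 0≤1 (≤-by (square-nonneg (re x) ⊞ vanish (- 1ℚ) ux) (eq (re x) (im x)))
  where
  eq : ∀ a b → 1ℚ * 1ℚ ≡ b * b + (a * a + (- 1ℚ) * (a * a + b * b - 1ℚ))
  eq = solve-∀ ringℚ

-1≤im : ∀ {x} → Unit x → - 1ℚ ≤ im x
-1≤im {x} ux = ≤-by (diff (im≤1 {conj x} (Unit-conj {x} ux))) (eq (im x))
  where
  eq : ∀ b → b ≡ - 1ℚ + (1ℚ - - b)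
  eq = solve-∀ ringℚ

module QuarterTurn {b : ℚ} (0≤b : 0ℚ ≤ b) (rotation : SmallRotation b) where

  open SmallRotation rotation

  private
    c s : ℕ → ℚ
    c i = re (ζ ↑ i)
    s i = im (ζ ↑ i)

    unit↑ : ∀ i → Unit (ζ ↑ i)
    unit↑ i = Unit-↑ {ζ} i unit

    Positive<_ : ℕ → Set
    Positive< m = ∀ i → i ℕ.< m → 0ℚ < c i

    im-nonneg : ∀ {m} → Positive< m → ∀ i → i ℕ.≤ m → 0ℚ ≤ s i
    im-nonneg pos zero _ = ≤-refl
    im-nonneg pos (suc i) i<m = 0≤re ⊠ im-nonneg pos i (ℕP.<⇒≤ i<m) ⊞ 0≤im ⊠ <⇒≤ (pos i i<m)

    -- As c (i+2) = 2 (re ζ) c (i+1) - c i, the decrements grow while the real parts are positive,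
    -- and the first decrement is 1 - re ζ.
    drop : ∀ {m} → Positive< m → ∀ i → i ℕ.< m → c (suc i) ≤ c i - (1ℚ - re ζ)
    drop pos zero _ = ≤-reflexive (eq (re ζ) (im ζ))
      where
      eq : ∀ a b → a * 1ℚ - b * 0ℚ ≡ 1ℚ - (1ℚ - a)
      eq = solve-∀ ringℚ
    drop pos (suc i) i<m = ≤-by
      (diff (drop pos i (ℕP.<⇒≤ i<m)) ⊞ 0≤2 ⊠ (diff (<⇒≤ re<1) ⊠ <⇒≤ (pos (suc i) i<m)) ⊞ vanish (c i) unit)
      (eq (re ζ) (im ζ) (c i) (s i))
      where
      eq : ∀ a b p q → a * p - b * q - (1ℚ - a) ≡ a * (a * p - b * q) - b * (a * q + b * p)
        + (p - (1ℚ - a) - (a * p - b * q) + 2ℚ * ((1ℚ - a) * (a * p - b * q)) + p * (a * a + b * b - 1ℚ))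
      eq = solve-∀ ringℚ

    descent : ∀ {m} → Positive< m → ∀ i → i ℕ.≤ m → c i ≤ 1ℚ - ℕtoℚ i * (1ℚ - re ζ)
    descent pos zero _ = ≤-reflexive (eq (re ζ))
      where
      eq : ∀ a → 1ℚ ≡ 1ℚ - 0ℚ * (1ℚ - a)
      eq = solve-∀ ringℚ
    descent pos (suc i) i<m = ≤-by (diff (drop pos i i<m) ⊞ diff (descent pos i (ℕP.<⇒≤ i<m)) ⊞ vanish (- (1ℚ - re ζ)) (ℕtoℚ-suc i))
      (eq (1ℚ - re ζ) (c (suc i)) (c i) (ℕtoℚ i) (ℕtoℚ (suc i)))
      where
      eq : ∀ h c' c n n' → 1ℚ - n' * h ≡ c' + (c - h - c' + (1ℚ - n * h - c) + - h * (n' - (1ℚ + n)))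
      eq = solve-∀ ringℚ

    Crossing : Set
    Crossing = Σ ℕ λ m → Positive< suc m × c (suc m) ≤ 0ℚ

    search : ∀ K → Crossing ⊎ Positive< suc K
    search zero = inj₂ λ { zero _ → 0<1 ; (suc i) (s≤s ()) }
    search (suc K) with search K
    ... | inj₁ found = inj₁ found
    ... | inj₂ pos with c (suc K) ≤? 0ℚ
    ...   | yes c≤0 = inj₁ (K , pos , c≤0)
    ...   | no c≰0 = inj₂ extend
      where
      extend : Positive< suc (suc K)
      extend i i<2+K with ℕP.m≤n⇒m<n∨m≡n (ℕP.≤-pred i<2+K)
      ... | inj₁ i<1+K = pos i i<1+K
      ... | inj₂ refl = ≰⇒> c≰0

    -- By `descent` the real part cannot remain positive beyond 1 / (1 - re ζ) steps, which bounds
    -- the search.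
    crossing : Crossing
    crossing with reciprocal (diff< re<1)
    ... | w , 0<w , inv with archimedean w
    ...   | K , w≤K with search K
    ...     | inj₁ found = found
    ...     | inj₂ pos = ⊥-elim (<-irrefl refl (<-≤-trans (pos K ℕP.≤-refl) (≤-trans (descent pos K (ℕP.n≤1+n K))
                (≤-by (diff (<⇒≤ re<1) ⊠ diff w≤K ⊞ vanish 1ℚ inv) (eq (1ℚ - re ζ) w (ℕtoℚ K))))))
      where
      eq : ∀ h w k → 0ℚ ≡ 1ℚ - k * h + (h * (k - w) + 1ℚ * (h * w - 1ℚ))
      eq = solve-∀ ringℚ

  record Quarter : Set where
    field
      M : ℕ
      positive : ∀ i → i ℕ.< M → 0ℚ < re (ζ ↑ i)
      crossed : re (ζ ↑ M) ≤ 0ℚ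

  quarter : Quarter
  quarter = record { M = suc (proj₁ crossing) ; positive = proj₁ (proj₂ crossing) ; crossed = proj₂ (proj₂ crossing) }

  -- A single step from the right half plane overshoots the imaginary axis by at most im ζ ≤ b. So
  -- the first power past the axis is approximately i.
  step-lower : ∀ {m} → Positive< m → - b ≤ c m
  step-lower {zero} _ = ≤-by (0≤b ⊞ 0≤1) (eq b)
    where
    eq : ∀ b → 1ℚ ≡ - b + (b + 1ℚ)
    eq = solve-∀ ringℚ
  step-lower {suc m} pos = ≤-by
    (0≤re ⊠ <⇒≤ (pos m ℕP.≤-refl) ⊞ 0≤im ⊠ diff (im≤1 {ζ ↑ m} (unit↑ m)) ⊞ diff im≤)
    (eq (re ζ) (im ζ) (c m) (s m) b)
    where
    eq : ∀ x y p q b → x * p - y * q ≡ - b + (x * p + y * (1ℚ - q) + (b - y))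
    eq = solve-∀ ringℚ

  module FullTurn (q : Quarter) where

    open Quarter q renaming (crossed to cM≤0)

    private
      -b≤cM : - b ≤ c M
      -b≤cM = step-lower positive

      -b≤c : ∀ i → i ℕ.≤ M → - b ≤ c i
      -b≤c i i≤M with ℕP.m≤n⇒m<n∨m≡n i≤M
      ... | inj₁ i<M = ≤-trans (≤-by 0≤b (sym (+-inverseˡ b))) (<⇒≤ (positive i i<M))
      ... | inj₂ refl = -b≤cM

      0≤s : ∀ i → i ℕ.≤ M → 0ℚ ≤ s i
      0≤s = im-nonneg positive

      ↑-M+ : ∀ i → ζ ↑ (M ℕ.+ i) ≡ ζ ↑ M · ζ ↑ i
      ↑-M+ i = ↑-+ ζ M i

    im-lower : ∀ i → i ℕ.≤ M ℕ.+ M → - (b + b) ≤ im (ζ ↑ i)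
    im-lower i i≤2M with ℕP.≤-total i M
    ... | inj₁ i≤M = ≤-trans (≤-by (0≤b ⊞ 0≤b) (sym (+-inverseˡ (b + b)))) (0≤s i i≤M)
    ... | inj₂ M≤i = subst (λ k → - (b + b) ≤ s k) (ℕP.m+[n∸m]≡n M≤i) (subst (λ x → - (b + b) ≤ im x) (sym (↑-M+ j))
          (≤-by (0≤b ⊠ diff (im≤1 {ζ ↑ j} (unit↑ j)) ⊞ diff -b≤cM ⊠ 0≤s j j≤M ⊞ 0≤b ⊠ diff (im≤1 {ζ ↑ M} (unit↑ M)) ⊞ diff (-b≤c j j≤M) ⊠ 0≤s M ℕP.≤-refl)
            (eq b (c M) (s M) (c j) (s j))))
      where
      j : ℕ
      j = i ℕ.∸ M
      j≤M : j ℕ.≤ M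
      j≤M = ℕP.+-cancelˡ-≤ M j M (subst (ℕ._≤ M ℕ.+ M) (sym (ℕP.m+[n∸m]≡n M≤i)) i≤2M)
      eq : ∀ b p q p' q' → p * q' + q * p' ≡ - (b + b) + (b * (1ℚ - q') + (p - - b) * q' + b * (1ℚ - q) + (p' - - b) * q)
      eq = solve-∀ ringℚ

    re-left : ∀ i → M ℕ.≤ i → i ℕ.< M ℕ.+ M → re (ζ ↑ i) ≤ 0ℚ
    re-left i M≤i i<2M = subst (λ k → c k ≤ 0ℚ) (ℕP.m+[n∸m]≡n M≤i) (subst (λ x → re x ≤ 0ℚ) (sym (↑-M+ j))
        (≤-by (diff cM≤0 ⊠ <⇒≤ (positive j j<M) ⊞ 0≤s M ℕP.≤-refl ⊠ 0≤s j (ℕP.<⇒≤ j<M)) (eq (c M) (s M) (c j) (s j))))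
      where
      j : ℕ
      j = i ℕ.∸ M
      j<M : j ℕ.< M
      j<M = ℕP.+-cancelˡ-< M j M (subst (ℕ._< M ℕ.+ M) (sym (ℕP.m+[n∸m]≡n M≤i)) i<2M)
      eq : ∀ p q p' q' → 0ℚ ≡ p * p' - q * q' + ((0ℚ - p) * p' + q * q')
      eq = solve-∀ ringℚ

    -- For g on the unit circle 1 + g² = 2 (re g) g, and |re g| ≤ b for g = ζ^M, so -g² has distance
    -- at most 2b from 1. Squaring at most doubles the distance.
    near-full-turn : Near (ζ ↑ (M ℕ.+ M ℕ.+ (M ℕ.+ M))) (b + b + (b + b))
    near-full-turn = subst (λ x → Near x (b + b + (b + b))) (sym power)
      (Near-· {y} {y} unit-y (0≤b ⊞ 0≤b) (0≤b ⊞ 0≤b) near-y near-y)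
      where
      g y : ℂ
      g = ζ ↑ M
      y = (- re (g · g)) +i (- im (g · g))
      power : ζ ↑ (M ℕ.+ M ℕ.+ (M ℕ.+ M)) ≡ y · y
      power = trans (↑-+ ζ (M ℕ.+ M) (M ℕ.+ M)) (trans (cong (λ x → x · x) (↑-M+ M)) (ℂ-≡ (eq₁ (re (g · g)) (im (g · g))) (eq₂ (re (g · g)) (im (g · g)))))
        where
        eq₁ : ∀ a b → a * a - b * b ≡ - a * - a - - b * - b
        eq₁ = solve-∀ ringℚ
        eq₂ : ∀ a b → a * b + b * a ≡ - a * - b + - b * - a
        eq₂ = solve-∀ ringℚ
      unit-y : Unit y
      unit-y = trans (eq (re (g · g)) (im (g · g))) (Unit-· {g} {g} (unit↑ M) (unit↑ M))
        where
        eq : ∀ a b → - a * - a + - b * - b ≡ a * a + b * b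
        eq = solve-∀ ringℚ
      near-y : Near y (b + b)
      near-y = ≤-by
        (ℕtoℚ-nonneg 4 ⊠ (diff -b≤cM ⊠ (0≤b ⊞ diff cM≤0)) ⊞ vanish (- (∣ g ∣² - 1ℚ)) (unit↑ M))
        (eq (re g) (im g) b)
        where
        eq : ∀ p q b → (b + b) * (b + b) ≡ (- (p * p - q * q) - 1ℚ) * (- (p * p - q * q) - 1ℚ) + (- (p * q + q * p) - 0ℚ) * (- (p * q + q * p) - 0ℚ)
          + (ℕtoℚ 4 * ((p - - b) * (b + (0ℚ - p))) + - (p * p + q * q - 1ℚ) * (p * p + q * q - 1ℚ))
        eq = solve-∀ ringℚ

    -- Points of the left half plane are at distance at least 1 from 1, and M steps of length at
    -- most b lead there.
    quarter-large : 1ℚ ≤ ℕtoℚ M * b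
    quarter-large = square-cancel-≤ (ℕtoℚ-nonneg M ⊠ 0≤b) (≤-trans
      (≤-by (diff cM≤0 ⊠ (0≤2 ⊞ diff cM≤0) ⊞ square-nonneg (s M)) (eq (c M) (s M)))
      (Near-↑ {ζ} unit 0≤b near M))
      where
      eq : ∀ p q → (p - 1ℚ) * (p - 1ℚ) + (q - 0ℚ) * (q - 0ℚ) ≡ 1ℚ * 1ℚ + ((0ℚ - p) * (2ℚ + (0ℚ - p)) + q * q)
      eq = solve-∀ ringℚ

-- What is needed of e(1/n): imaginary parts nonnegative up to ν along the first half turn, and
-- bounded sums over [n] for the frequencies 1 to L in place of orthogonality.
record Rotation (n L : ℕ) (ν : ℚ) : Set where
  field
    z : ℂ
    unit : Unit z
    upper : ∀ m → m ℕ.+ m ℕ.≤ n → - ν ≤ im (z ↑ m)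
    geometric : ∀ j → suc j ℕ.≤ L → ∣ powerSum (z ↑ suc j) n ∣² ≤ 1ℚ

module _ {n L : ℕ} (4L<n : 4 ℕ.* L ℕ.< n) {b : ℚ} (0<b : 0ℚ < b) (small : SmallRotation b)
  (b-small : ∀ j → suc j ℕ.≤ L → ℕtoℚ n * (ℕtoℚ (suc j) * (ℕtoℚ n * b + (b + b + (b + b)))) ≤ 1ℚ) (nb≤1 : ℕtoℚ n * b ≤ 1ℚ) where

  private
    0≤b : 0ℚ ≤ b
    0≤b = <⇒≤ 0<b

    instance
      n≢0 : ℕ.NonZero n
      n≢0 = ℕ.>-nonZero (ℕP.≤-<-trans z≤n 4L<n)

    open SmallRotation small using (ζ) renaming (unit to unit-ζ; near to near-ζ)
    open QuarterTurn 0≤b small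

  rotation-from : Quarter → Rotation n L (b + b)
  rotation-from q = record { z = z ; unit = Unit-↑ {ζ} ℓ unit-ζ ; upper = upper ; geometric = geometric }
    where
    open Quarter q using (M)
    open FullTurn q

    -- N steps of ζ nearly complete a full turn, so ℓ steps make about an n-th of it. Then z^n =
    -- ζ^(N-r) stops r < n steps short, a distance of at most n b.
    N ℓ r : ℕ
    N = M ℕ.+ M ℕ.+ (M ℕ.+ M)
    ℓ = N ℕ./ n
    r = N ℕ.% n

    z : ℂ
    z = ζ ↑ ℓ

    N≡ : N ≡ r ℕ.+ ℓ ℕ.* n
    N≡ = ℕD.m≡m%n+[m/n]*n N n

    n≤M : n ℕ.≤ M
    n≤M = ℕtoℚ-cancel-≤ (*-cancel-≤ 0<b (subst₂ _≤_ (*-comm _ b) (*-comm _ b) (≤-trans nb≤1 quarter-large)))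

    1≤ℓ : 1 ℕ.≤ ℓ
    1≤ℓ = ℕD.m≥n⇒m/n>0 (ℕP.≤-trans n≤M (ℕP.≤-trans (ℕP.m≤m+n M M) (ℕP.m≤m+n (M ℕ.+ M) (M ℕ.+ M))))

    ℓn≤N : ℓ ℕ.* n ℕ.≤ N
    ℓn≤N = subst (ℓ ℕ.* n ℕ.≤_) (sym N≡) (ℕP.m≤n+m (ℓ ℕ.* n) r)

    half : ∀ {a b} → a ℕ.+ a ℕ.≤ b ℕ.+ b → a ℕ.≤ b
    half {a} {b} h = ℕP.≮⇒≥ (λ b<a → ℕP.<⇒≱ (ℕP.+-mono-< b<a b<a) h)

    half-< : ∀ {a b} → a ℕ.+ a ℕ.< b ℕ.+ b → a ℕ.< b
    half-< {a} {b} h = ℕP.≰⇒> (λ b≤a → ℕP.<⇒≱ h (ℕP.+-mono-≤ b≤a b≤a))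

    upper : ∀ m → m ℕ.+ m ℕ.≤ n → - (b + b) ≤ im (z ↑ m)
    upper m 2m≤n = subst (λ x → - (b + b) ≤ im x) (↑-* ζ m ℓ) (im-lower (m ℕ.* ℓ) (half (begin
      m ℕ.* ℓ ℕ.+ m ℕ.* ℓ   ≡⟨ sym (ℕP.*-distribʳ-+ ℓ m m) ⟩
      (m ℕ.+ m) ℕ.* ℓ       ≤⟨ ℕP.*-monoˡ-≤ ℓ 2m≤n ⟩
      n ℕ.* ℓ               ≡⟨ ℕP.*-comm n ℓ ⟩
      ℓ ℕ.* n               ≤⟨ ℓn≤N ⟩
      N                     ∎)))
      where open ℕP.≤-Reasoning

    near-z^n : Near (z ↑ n) (ℕtoℚ n * b + (b + b + (b + b)))
    near-z^n = subst (λ x → Near x (ℕtoℚ n * b + (b + b + (b + b)))) (sym split)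
      (Near-· {conj (ζ ↑ r)} {ζ ↑ N} (Unit-conj {ζ ↑ r} unit-r) (ℕtoℚ-nonneg n ⊠ 0≤b) (0≤b ⊞ 0≤b ⊞ (0≤b ⊞ 0≤b))
        (Near-conj {ζ ↑ r} {ℕtoℚ n * b} (Near-mono {ζ ↑ r} (ℕtoℚ-nonneg r ⊠ 0≤b) (≤-by (diff (ℕtoℚ-mono (ℕP.<⇒≤ (ℕD.m%n<n N n))) ⊠ 0≤b) (eq (ℕtoℚ r) (ℕtoℚ n) b))
          (Near-↑ {ζ} unit-ζ 0≤b near-ζ r)))
        near-full-turn)
      where
      unit-r : Unit (ζ ↑ r)
      unit-r = Unit-↑ {ζ} r unit-ζ
      eq : ∀ r n b → n * b ≡ r * b + (n - r) * b
      eq = solve-∀ ringℚ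
      open ≡-Reasoning
      split : z ↑ n ≡ conj (ζ ↑ r) · ζ ↑ N
      split = begin
        z ↑ n                                        ≡⟨ sym (·-identityˡ (z ↑ n)) ⟩
        1ℂ · z ↑ n                                   ≡⟨ cong (_· z ↑ n) (sym (conj-inverse {ζ ↑ r} unit-r)) ⟩
        (conj (ζ ↑ r) · ζ ↑ r) · z ↑ n               ≡⟨ ·-assoc (conj (ζ ↑ r)) (ζ ↑ r) (z ↑ n) ⟩
        conj (ζ ↑ r) · (ζ ↑ r · z ↑ n)               ≡⟨ cong (λ x → conj (ζ ↑ r) · (ζ ↑ r · x)) (trans (sym (↑-* ζ n ℓ)) (cong (ζ ↑_) (ℕP.*-comm n ℓ))) ⟩
        conj (ζ ↑ r) · (ζ ↑ r · ζ ↑ (ℓ ℕ.* n))       ≡⟨ cong (conj (ζ ↑ r) ·_) (sym (↑-+ ζ r (ℓ ℕ.* n))) ⟩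
        conj (ζ ↑ r) · ζ ↑ (r ℕ.+ ℓ ℕ.* n)           ≡⟨ cong (λ i → conj (ζ ↑ r) · ζ ↑ i) (sym N≡) ⟩
        conj (ζ ↑ r) · ζ ↑ N                         ∎

    κ₀ : ℚ
    κ₀ = ℕtoℚ n * b + (b + b + (b + b))

    0≤κ₀ : 0ℚ ≤ κ₀
    0≤κ₀ = ℕtoℚ-nonneg n ⊠ 0≤b ⊞ (0≤b ⊞ 0≤b ⊞ (0≤b ⊞ 0≤b))

    unit-z : Unit z
    unit-z = Unit-↑ {ζ} ℓ unit-ζ

    near-↑n : ∀ i → Near ((z ↑ i) ↑ n) (ℕtoℚ i * κ₀)
    near-↑n i = subst (λ y → Near y (ℕtoℚ i * κ₀)) (↑-comm z n i) (Near-↑ {z ↑ n} (Unit-↑ {z} n unit-z) 0≤κ₀ near-z^n i)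

    left-↑ : ∀ R i → M ℕ.≤ R ℕ.* (i ℕ.* ℓ) → R ℕ.* (i ℕ.* ℓ) ℕ.< M ℕ.+ M → re ((z ↑ i) ↑ R) ≤ 0ℚ
    left-↑ R i lo hi = subst (λ y → re y ≤ 0ℚ) (trans (↑-* ζ R (i ℕ.* ℓ)) (cong (_↑ R) (↑-* ζ i ℓ))) (re-left (R ℕ.* (i ℕ.* ℓ)) lo hi)

    sum-bound : ∀ R i → R ℕ.≤ n → M ℕ.≤ R ℕ.* (i ℕ.* ℓ) → R ℕ.* (i ℕ.* ℓ) ℕ.< M ℕ.+ M →
      ℕtoℚ n * (ℕtoℚ i * κ₀) ≤ 1ℚ → ∣ powerSum (z ↑ i) n ∣² ≤ 1ℚ
    sum-bound R i R≤n lo hi small = ≤-trans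
      (powerSum-bound {z ↑ i} (Unit-↑ {z} i unit-z) 0≤κ n (near-↑n i) R (left-↑ R i lo hi))
      (square-≤1 (ℕtoℚ-nonneg R ⊠ 0≤κ) (≤-trans (≤-by (diff (ℕtoℚ-mono R≤n) ⊠ 0≤κ) (eq (ℕtoℚ R) (ℕtoℚ n) (ℕtoℚ i * κ₀))) small))
      where
      0≤κ : 0ℚ ≤ ℕtoℚ i * κ₀
      0≤κ = ℕtoℚ-nonneg i ⊠ 0≤κ₀
      eq : ∀ r n k → n * k ≡ r * k + (n - r) * k
      eq = solve-∀ ringℚ
      square-≤1 : ∀ {y} → 0ℚ ≤ y → y ≤ 1ℚ → y * y ≤ 1ℚ
      square-≤1 {y} 0≤y y≤1 = ≤-by ((0≤1 ⊞ 0≤y) ⊠ diff y≤1) (eq' y)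
        where
        eq' : ∀ y → 1ℚ ≡ y * y + (1ℚ + y) * (1ℚ - y)
        eq' = solve-∀ ringℚ

    geometric : ∀ j → suc j ℕ.≤ L → ∣ powerSum (z ↑ suc j) n ∣² ≤ 1ℚ
    geometric j j<L = sum-bound R (suc j) R≤n (ℕP.<⇒≤ M<Rd) Rd<2M (b-small j j<L)
      where
      d : ℕ
      d = suc j ℕ.* ℓ
      1≤d : 1 ℕ.≤ d
      1≤d = ℕP.≤-trans 1≤ℓ (ℕP.m≤m+n ℓ (j ℕ.* ℓ))
      instance
        d≢0 : ℕ.NonZero d
        d≢0 = ℕ.>-nonZero 1≤d
      -- R d is the least multiple of d beyond M, and it stays below 2M because d < M, which is
      -- where 4L < n enters. Hence the R-th power of z^(j+1) lies in the left half plane, as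
      -- `powerSum-bound` requires.
      R : ℕ
      R = suc (M ℕ./ d)
      open ℕP.≤-Reasoning
      d<M : d ℕ.< M
      d<M = half-< (half-< (begin-strict
        d ℕ.+ d ℕ.+ (d ℕ.+ d)       ≡⟨ sym (ℕP.+-assoc (d ℕ.+ d) d d) ⟩
        d ℕ.+ d ℕ.+ d ℕ.+ d         ≡⟨ trans (ℕP.+-assoc (d ℕ.+ d) d d) (trans (ℕP.+-assoc d d (d ℕ.+ d)) (cong (λ y → d ℕ.+ (d ℕ.+ (d ℕ.+ y))) (sym (ℕP.+-identityʳ d)))) ⟩
        4 ℕ.* d                     ≡⟨ sym (ℕP.*-assoc 4 (suc j) ℓ) ⟩
        4 ℕ.* suc j ℕ.* ℓ           ≤⟨ ℕP.*-monoˡ-≤ ℓ (ℕP.*-monoʳ-≤ 4 j<L) ⟩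
        4 ℕ.* L ℕ.* ℓ               <⟨ ℕP.*-monoˡ-< ℓ {{ℕ.>-nonZero 1≤ℓ}} 4L<n ⟩
        n ℕ.* ℓ                     ≡⟨ ℕP.*-comm n ℓ ⟩
        ℓ ℕ.* n                     ≤⟨ ℓn≤N ⟩
        M ℕ.+ M ℕ.+ (M ℕ.+ M)       ∎))
      M<Rd : M ℕ.< R ℕ.* d
      M<Rd = begin-strict
        M                                        ≡⟨ ℕD.m≡m%n+[m/n]*n M d ⟩
        M ℕ.% d ℕ.+ M ℕ./ d ℕ.* d              <⟨ ℕP.+-monoˡ-< (M ℕ./ d ℕ.* d) (ℕD.m%n<n M d) ⟩
        R ℕ.* d                                  ∎
      Rd<2M : R ℕ.* d ℕ.< M ℕ.+ M
      Rd<2M = ℕP.+-mono-<-≤ d<M (ℕD.m/n*n≤m M d)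
      M<ℓn : M ℕ.< ℓ ℕ.* n
      M<ℓn = half-< (half-< (begin-strict
        N                                              ≡⟨ N≡ ⟩
        r ℕ.+ ℓ ℕ.* n                                  <⟨ ℕP.+-monoˡ-< (ℓ ℕ.* n) (ℕD.m%n<n N n) ⟩
        n ℕ.+ ℓ ℕ.* n                                  ≤⟨ ℕP.+-monoˡ-≤ (ℓ ℕ.* n) (ℕP.m≤n*m n ℓ {{ℕ.>-nonZero 1≤ℓ}}) ⟩
        ℓ ℕ.* n ℕ.+ ℓ ℕ.* n                            ≤⟨ ℕP.m≤m+n _ _ ⟩
        ℓ ℕ.* n ℕ.+ ℓ ℕ.* n ℕ.+ (ℓ ℕ.* n ℕ.+ ℓ ℕ.* n)  ∎))
      R≤n : R ℕ.≤ n
      R≤n = ℕD.m<n*o⇒m/o<n {M} {n} {d} (begin-strict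
        M                          <⟨ M<ℓn ⟩
        ℓ ℕ.* n                    ≤⟨ ℕP.*-monoˡ-≤ n (ℕP.m≤m+n ℓ (j ℕ.* ℓ)) ⟩
        d ℕ.* n                    ≡⟨ ℕP.*-comm d n ⟩
        n ℕ.* d                    ∎)

  rotation-of-step : Rotation n L (b + b)
  rotation-of-step = rotation-from quarter

module _ {n L : ℕ} {ν : ℚ} (0<ν : 0ℚ < ν) (1/ν : Σ ℚ λ w → 0ℚ < w × ν * w ≡ 1ℚ) where

  private
    w W : ℚ
    w = proj₁ 1/ν
    W = ℕtoℚ n * (ℕtoℚ L * (ℕtoℚ n + 4ℚ))
    0≤w : 0ℚ ≤ w
    0≤w = <⇒≤ (proj₁ (proj₂ 1/ν))
    0≤n : 0ℚ ≤ ℕtoℚ n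
    0≤n = ℕtoℚ-nonneg n
    0≤W : 0ℚ ≤ W
    0≤W = 0≤n ⊠ (ℕtoℚ-nonneg L ⊠ (0≤n ⊞ 0≤4))

  -- b is the reciprocal of a sum of demands: 1 for b ≤ 1, n for n b ≤ 1, 2w = 2/ν for 2b ≤ ν, and W
  -- for the power sums of all frequencies up to L.
  rotation-of-fineness : 4 ℕ.* L ℕ.< n → (Σ ℚ λ b → 0ℚ < b × (1ℚ + (W + ℕtoℚ n + 2ℚ * w)) * b ≡ 1ℚ) → Σ ℚ λ ν' → ν' ≤ ν × Rotation n L ν'
  rotation-of-fineness 4L<n (b , 0<b , inv) = b + b , 2b≤ν , rotation-of-step 4L<n 0<b (smallRotation 0<b b≤1) b-small nb≤1
    where
    0≤b : 0ℚ ≤ b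
    0≤b = <⇒≤ 0<b
    b≤1 : b ≤ 1ℚ
    b≤1 = ≤-by ((0≤W ⊞ 0≤n ⊞ 0≤2 ⊠ 0≤w) ⊠ 0≤b ⊞ vanish (- 1ℚ) inv) (eq b (W + ℕtoℚ n + 2ℚ * w))
      where
      eq : ∀ b x → 1ℚ ≡ b + (x * b + (- 1ℚ) * ((1ℚ + x) * b - 1ℚ))
      eq = solve-∀ ringℚ
    nb≤1 : ℕtoℚ n * b ≤ 1ℚ
    nb≤1 = ≤-by ((0≤1 ⊞ 0≤W ⊞ 0≤2 ⊠ 0≤w) ⊠ 0≤b ⊞ vanish (- 1ℚ) inv) (eq b W (ℕtoℚ n) w)
      where
      eq : ∀ b x n w → 1ℚ ≡ n * b + ((1ℚ + x + 2ℚ * w) * b + (- 1ℚ) * ((1ℚ + (x + n + 2ℚ * w)) * b - 1ℚ))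
      eq = solve-∀ ringℚ
    2b≤ν : b + b ≤ ν
    2b≤ν = ≤-by (<⇒≤ 0<ν ⊠ ((0≤1 ⊞ 0≤W ⊞ 0≤n) ⊠ 0≤b) ⊞ vanish (- ν) inv ⊞ vanish (2ℚ * b) (proj₂ (proj₂ 1/ν)))
      (eq b W (ℕtoℚ n) w ν)
      where
      eq : ∀ b x n w v → v ≡ b + b + (v * ((1ℚ + x + n) * b) + - v * ((1ℚ + (x + n + 2ℚ * w)) * b - 1ℚ) + 2ℚ * b * (v * w - 1ℚ))
      eq = solve-∀ ringℚ
    b-small : ∀ j → suc j ℕ.≤ L → ℕtoℚ n * (ℕtoℚ (suc j) * (ℕtoℚ n * b + (b + b + (b + b)))) ≤ 1ℚ
    b-small j j<L = ≤-by
      ((0≤1 ⊞ 0≤n ⊞ 0≤2 ⊠ 0≤w) ⊠ 0≤b ⊞ 0≤n ⊠ (diff (ℕtoℚ-mono j<L) ⊠ ((0≤n ⊞ 0≤4) ⊠ 0≤b)) ⊞ vanish (- 1ℚ) inv)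
      (eq b (ℕtoℚ n) w (ℕtoℚ (suc j)) (ℕtoℚ L))
      where
      eq : ∀ b n w j l → 1ℚ ≡ n * (j * (n * b + (b + b + (b + b))))
        + ((1ℚ + n + 2ℚ * w) * b + n * ((l - j) * ((n + 4ℚ) * b))
           + (- 1ℚ) * ((1ℚ + (n * (l * (n + 4ℚ)) + n + 2ℚ * w)) * b - 1ℚ))
      eq = solve-∀ ringℚ

  rotation-exists : 4 ℕ.* L ℕ.< n → Σ ℚ λ ν' → ν' ≤ ν × Rotation n L ν'
  rotation-exists 4L<n = rotation-of-fineness 4L<n (reciprocal (+-mono-<-≤ 0<1 (0≤W ⊞ 0≤n ⊞ 0≤2 ⊠ 0≤w)))

rotation : ∀ n L {ν} → 4 ℕ.* L ℕ.< n → 0ℚ < ν → Σ ℚ λ ν' → ν' ≤ ν × Rotation n L ν'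
rotation n L 4L<n 0<ν = rotation-exists 0<ν (reciprocal 0<ν) 4L<n

-- The main inequality

private
  indicator-yes : ∀ {P : Set} (d : Dec P) → P → indicator ⌊ d ⌋ ≡ 1ℚ
  indicator-yes (yes _) _ = refl
  indicator-yes (no ¬p) p = ⊥-elim (¬p p)

  indicator-no : ∀ {P : Set} (d : Dec P) → ¬ P → indicator ⌊ d ⌋ ≡ 0ℚ
  indicator-no (yes p) ¬p = ⊥-elim (¬p p)
  indicator-no (no _) _ = refl

  indicator≤1 : ∀ b → indicator b ≤ 1ℚ
  indicator≤1 true = ≤-refl
  indicator≤1 false = 0≤1

  doubled-bound : ∀ {n a b} → ℤ.+ suc n ℤ.≤ a ℤ.+ a → ℤ.+ suc n ℤ.≤ b ℤ.+ b → ℤ.+ suc n ℤ.≤ a ℤ.+ b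
  doubled-bound {a = a} {b} ha hb with ℤP.≤-total a b
  ... | inj₁ a≤b = ℤP.≤-trans ha (ℤP.+-monoʳ-≤ a a≤b)
  ... | inj₂ b≤a = ℤP.≤-trans hb (ℤP.+-monoˡ-≤ b b≤a)

-- Outside (0 , n/2] the elements of A are either low or high; two of the same kind have their sum outside [n].
module Outliers (A : List ℤ) (n : ℕ) where

  open Pairs A

  low high outside : ℤ → ℚ
  low a = indicator ⌊ a ℤ.≤? ℤ.+ 0 ⌋
  high a = indicator ⌊ ℤ.+ suc n ℤ.≤? a ℤ.+ a ⌋
  outside i = indicator (⌊ i ℤ.≤? ℤ.+ 0 ⌋ ∨ ⌊ ℤ.+ suc n ℤ.≤? i ⌋)

  private
    outside-low : ∀ {i} → i ℤ.≤ ℤ.+ 0 → outside i ≡ 1ℚ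
    outside-low {i} h with i ℤ.≤? ℤ.+ 0
    ... | yes _ = refl
    ... | no ¬h = ⊥-elim (¬h h)

    outside-high : ∀ {i} → ℤ.+ suc n ℤ.≤ i → outside i ≡ 1ℚ
    outside-high {i} h with i ℤ.≤? ℤ.+ 0 | ℤ.+ suc n ℤ.≤? i
    ... | yes _ | _ = refl
    ... | no _ | yes _ = refl
    ... | no _ | no ¬h = ⊥-elim (¬h h)

    outside-inner : ∀ {m} → m ℕ.< n → outside (ℤ.+ suc m) ≡ 0ℚ
    outside-inner {m} m<n with ℤ.+ suc n ℤ.≤? ℤ.+ suc m
    ... | yes h = ⊥-elim (ℕP.<⇒≱ (s≤s m<n) (ℤP.drop‿+≤+ h))
    ... | no _ = refl

    outside-nonneg : ∀ i → 0ℚ ≤ outside i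
    outside-nonneg i = indicator-nonneg (⌊ i ℤ.≤? ℤ.+ 0 ⌋ ∨ ⌊ ℤ.+ suc n ℤ.≤? i ⌋)

    low⇒¬high : ∀ {a} → a ℤ.≤ ℤ.+ 0 → high a ≡ 0ℚ
    low⇒¬high {a} h = indicator-no (ℤ.+ suc n ℤ.≤? a ℤ.+ a) (λ h' → ⊥-elim (n≮0 (ℤP.≤-trans h' (ℤP.+-mono-≤ h h))))
      where
      n≮0 : ¬ (ℤ.+ suc n ℤ.≤ ℤ.+ 0)
      n≮0 (ℤ.+≤+ ())

    same-kind : ∀ a b → low a * low b + high a * high b ≤ outside (a ℤ.+ b)
    same-kind a b with a ℤ.≤? ℤ.+ 0 | b ℤ.≤? ℤ.+ 0
    ... | yes ha | yes hb = ≤-reflexive (trans (cong (λ x → 1ℚ * 1ℚ + x * high b) (low⇒¬high ha))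
            (trans (eq (high b)) (sym (outside-low (ℤP.+-mono-≤ ha hb)))))
      where
      eq : ∀ h → 1ℚ * 1ℚ + 0ℚ * h ≡ 1ℚ
      eq = solve-∀ ringℚ
    ... | yes ha | no _ = ≤-trans (≤-reflexive (trans (cong (λ x → 1ℚ * 0ℚ + x * high b) (low⇒¬high ha)) (eq (high b)))) (outside-nonneg (a ℤ.+ b))
      where
      eq : ∀ h → 1ℚ * 0ℚ + 0ℚ * h ≡ 0ℚ
      eq = solve-∀ ringℚ
    ... | no _ | hb? with ℤ.+ suc n ℤ.≤? a ℤ.+ a | ℤ.+ suc n ℤ.≤? b ℤ.+ b
    ...   | yes ha | yes hb = ≤-reflexive (trans (eq (indicator ⌊ hb? ⌋)) (sym (outside-high (doubled-bound {n} {a} {b} ha hb))))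
      where
      eq : ∀ h → 0ℚ * h + 1ℚ * 1ℚ ≡ 1ℚ
      eq = solve-∀ ringℚ
    ...   | yes _ | no _ = ≤-trans (≤-reflexive (eq (indicator ⌊ hb? ⌋))) (outside-nonneg (a ℤ.+ b))
      where
      eq : ∀ h → 0ℚ * h + 1ℚ * 0ℚ ≡ 0ℚ
      eq = solve-∀ ringℚ
    ...   | no _ | hb = ≤-trans (≤-reflexive (eq (indicator ⌊ hb? ⌋) (indicator ⌊ hb ⌋))) (outside-nonneg (a ℤ.+ b))
      where
      eq : ∀ h h' → 0ℚ * h + 0ℚ * h' ≡ 0ℚ
      eq = solve-∀ ringℚ

    ∑-outside : ∀ m → m ℕ.≤ n → ∑ (range m) (λ i → outside (ℤ.+ i)) ≡ 0ℚ
    ∑-outside zero _ = refl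
    ∑-outside (suc m) m<n = cong₂ _+_ (outside-inner m<n) (∑-outside m (ℕP.<⇒≤ m<n))

    squares : ∑ A (λ a → ∑ A (λ b → low a * low b + high a * high b)) ≡ ∑ A low * ∑ A low + ∑ A high * ∑ A high
    squares = trans (∑-cong A (λ a → trans (∑-+ A _ _) (cong₂ _+_ (trans (∑-* A (low a) low) (*-comm (low a) _)) (trans (∑-* A (high a) high) (*-comm (high a) _)))))
      (trans (∑-+ A _ _) (cong₂ _+_ (∑-* A (∑ A low) low) (∑-* A (∑ A high) high)))

  -- The indicator of the complement of [n] has supremum at most 1 and sum 0 over [n], so at most
  -- `excess n` ordered pairs have their sum outside [n]. Pairs of the same kind are among them.
  outliers-squared : ∑ A low * ∑ A low + ∑ A high * ∑ A high ≤ excess n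
  outliers-squared = subst₂ _≤_ squares (eq (excess n))
    (≤-trans (∑-mono A (λ a → ∑-mono A (same-kind a)))
      (subst (λ x → ∑∑ outside ≤ excess n * 1ℚ + 2ℚ * x) (∑-outside n ℕP.≤-refl)
        (sumset-bound outside 1ℚ (λ i → indicator≤1 (⌊ i ℤ.≤? ℤ.+ 0 ⌋ ∨ ⌊ ℤ.+ suc n ℤ.≤? i ⌋)) (λ i → ≤-trans (toWitness {a? = - 1ℚ ≤? 0ℚ} _) (outside-nonneg i)) n)))
    where
    eq : ∀ x → x * 1ℚ + 2ℚ * 0ℚ ≡ x
    eq = solve-∀ ringℚ

  -- The source of √2 in the constant: (l + h)² ≤ 2 (l² + h²), since low and high elements are
  -- bounded only jointly in squares.
  outliers-bound : ∀ {s e} → 0ℚ ≤ s → 2ℚ ≤ s * s → 0ℚ ≤ e → excess n ≤ e * e → ∑ A (λ a → low a + high a) ≤ s * e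
  outliers-bound {s} {e} 0≤s 2≤ss 0≤e h = subst (_≤ s * e) (sym (∑-+ A low high)) (square-cancel-≤ (0≤s ⊠ 0≤e) (≤-by
    (0≤e ⊠ 0≤e ⊠ diff 2≤ss ⊞ 0≤2 ⊠ (diff h ⊞ diff outliers-squared) ⊞ square-nonneg (∑ A low - ∑ A high))
    (eq s e (excess n) (∑ A low) (∑ A high))))
    where
    eq : ∀ s e x l h → s * e * (s * e) ≡ (l + h) * (l + h)
      + (e * e * (s * s - 2ℚ) + 2ℚ * (e * e - x + (x - (l * l + h * h))) + (l - h) * (l - h))
    eq = solve-∀ ringℚ

-- The minorant is at most |y| for y = im x, and |y| ≤ y + 2ν as soon as y ≥ -ν. For outliers this
-- is used with ν = 1, so each of them costs 2.
minorant-im : ∀ {x ν} → Unit x → 0ℚ ≤ ν → - ν ≤ im x → ∀ J → minorant J (re x) ≤ im x + 2ℚ * ν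
minorant-im {x} {ν} ux 0≤ν -ν≤im J with ≤-total 0ℚ (im x)
... | inj₁ 0≤im = ≤-trans (minorant-≤ {re x} {im x} 0≤im ux J) (≤-by (0≤2 ⊠ 0≤ν) refl)
... | inj₂ im≤0 = ≤-trans (minorant-≤ {re x} {0ℚ - im x} (diff im≤0) (trans (eq (re x) (im x)) ux) J) (≤-by (0≤2 ⊠ diff -ν≤im) (eq' (im x) ν))
  where
  eq : ∀ a b → a * a + (0ℚ - b) * (0ℚ - b) ≡ a * a + b * b
  eq = solve-∀ ringℚ
  eq' : ∀ b v → b + 2ℚ * v ≡ 0ℚ - b + 2ℚ * (b - - v)
  eq' = solve-∀ ringℚ

module Core (A : List ℤ) {n : ℕ} (J : ℕ) {ν e s : ℚ} (0≤ν : 0ℚ ≤ ν)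
  (rot : Rotation n (double (suc J)) ν) (0≤e : 0ℚ ≤ e) (0≤s : 0ℚ ≤ s) (2≤ss : 2ℚ ≤ s * s)
  (excess≤ : Pairs.excess A n + 2ℚ ≤ e * e) where

  open Pairs A
  open Rotation rot
  open Outliers A n

  private
    w : ℤ → ℂ
    w = character z

    unit-w : ∀ a → Unit (w a)
    unit-w a = Unit-character {z} a unit

    x·1 : ∀ x → x · 1ℂ ≡ x
    x·1 x = trans (·-comm x 1ℂ) (·-identityˡ x)

    T-step : ∀ l a → re (w a ↑ (2 ℕ.+ l)) ≡ 2ℚ * re (w a) * re (w a ↑ suc l) - re (w a ↑ l)
    T-step l a = ≡-by (null (- re (w a ↑ l)) (unit-w a)) (eq (re (w a)) (im (w a)) (re (w a ↑ l)) (im (w a ↑ l)))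
      where
      eq : ∀ a b p q → a * (a * p - b * q) - b * (a * q + b * p) ≡ 2ℚ * a * (a * p - b * q) - p + (- p) * (a * a + b * b - 1ℚ)
      eq = solve-∀ ringℚ

    T-bound : ∀ l → suc l ℕ.≤ double (suc J) → ∑ A (λ a → re (w a ↑ suc l)) ≤ e
    T-bound l l<L = subst (_≤ e) (∑-cong A (λ a → cong re (character-↑ z (suc l) a)))
      (FourierBound.transform-re A {z ↑ suc l} (Unit-↑ {z} (suc l) unit) n (geometric l l<L) 0≤e excess≤)

    im-bound : ∑ A (λ a → im (w a)) ≤ e
    im-bound = subst (_≤ e) (∑-cong A (λ a → cong im (trans (character-↑ z 1 a) (x·1 (w a)))))
      (FourierBound.transform-im A {z ↑ 1} (Unit-↑ {z} 1 unit) n (geometric 0 (s≤s z≤n)) 0≤e excess≤)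

    open Moments A (λ a → re (w a)) (λ l a → re (w a ↑ l)) (λ _ → refl) (λ a → cong re (x·1 (w a))) T-step (double (suc J)) e T-bound

    low-nonneg : ∀ a → 0ℚ ≤ low a
    low-nonneg a = indicator-nonneg ⌊ a ℤ.≤? ℤ.+ 0 ⌋

    high-nonneg : ∀ a → 0ℚ ≤ high a
    high-nonneg a = indicator-nonneg ⌊ ℤ.+ suc n ℤ.≤? a ℤ.+ a ⌋

    half-turn : ∀ a → ¬ (a ℤ.≤ ℤ.+ 0) → ¬ (ℤ.+ suc n ℤ.≤ a ℤ.+ a) → - ν ≤ im (w a)
    half-turn (ℤ.+ m) _ ¬high = upper m (ℕP.≮⇒≥ (λ n<2m → ¬high (ℤ.+≤+ n<2m)))
    half-turn -[1+ m ] ¬low _ = ⊥-elim (¬low ℤ.-≤+)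

    outlier : ∀ a → 1ℚ ≤ low a + high a → minorant J (re (w a)) ≤ im (w a) + (2ℚ * ν + 2ℚ * (low a + high a))
    outlier a h = ≤-trans (minorant-im {w a} {1ℚ} (unit-w a) 0≤1 (-1≤im {w a} (unit-w a)) J)
      (≤-by (0≤2 ⊠ 0≤ν ⊞ 0≤2 ⊠ diff h) (eq (im (w a)) ν (low a + high a)))
      where
      eq : ∀ b v t → b + (2ℚ * v + 2ℚ * t) ≡ b + 2ℚ * 1ℚ + (2ℚ * v + 2ℚ * (t - 1ℚ))
      eq = solve-∀ ringℚ

    pointwise : ∀ a → minorant J (re (w a)) ≤ im (w a) + (2ℚ * ν + 2ℚ * (low a + high a))
    pointwise a = cases (a ℤ.≤? ℤ.+ 0) (ℤ.+ suc n ℤ.≤? a ℤ.+ a)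
      where
      cases : Dec (a ℤ.≤ ℤ.+ 0) → Dec (ℤ.+ suc n ℤ.≤ a ℤ.+ a) → minorant J (re (w a)) ≤ im (w a) + (2ℚ * ν + 2ℚ * (low a + high a))
      cases (yes is-low) _ = outlier a (≤-by (high-nonneg a) (cong (_+ high a) (indicator-yes (a ℤ.≤? ℤ.+ 0) is-low)))
      cases (no _) (yes is-high) = outlier a (≤-by (low-nonneg a) (trans (+-comm (low a) (high a))
        (cong (_+ low a) (indicator-yes (ℤ.+ suc n ℤ.≤? a ℤ.+ a) is-high))))
      cases (no ¬low) (no ¬high) = ≤-trans (minorant-im {w a} (unit-w a) 0≤ν (half-turn a ¬low ¬high) J)
        (≤-by (0≤2 ⊠ (low-nonneg a ⊞ high-nonneg a)) (sym (+-assoc (im (w a)) (2ℚ * ν) (2ℚ * (low a + high a))) ))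

  -- The imaginary parts add up to at most e and the at most s e outliers cost 2 each; together this
  -- is the factor 1 + 2s of `constBelow`.
  core : (k - e) * (wallis J - C J * C (suc J)) ≤ e + (2ℚ * ν * k + 2ℚ * (s * e))
  core = ≤-trans (minorant-mean J ℕP.≤-refl) (≤-trans (∑-mono A pointwise) (≤-by
    (diff im-bound ⊞ 0≤2 ⊠ diff (outliers-bound 0≤s 2≤ss 0≤e excess≤e²) ⊞ vanish (- 1ℚ) split)
    (eq e (s * e) (∑ A (λ a → im (w a))) (∑ A (λ a → low a + high a)) ν k (∑ A (λ a → im (w a) + (2ℚ * ν + 2ℚ * (low a + high a)))))))
    where
    excess≤e² : excess n ≤ e * e
    excess≤e² = ≤-trans (≤-by 0≤2 refl) excess≤
    split : ∑ A (λ a → im (w a) + (2ℚ * ν + 2ℚ * (low a + high a))) ≡ ∑ A (λ a → im (w a)) + (k * (2ℚ * ν) + 2ℚ * ∑ A (λ a → low a + high a))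
    split = trans (∑-+ A _ _) (cong (∑ A (λ a → im (w a)) +_) (trans (∑-+ A _ _) (cong₂ _+_ (∑-const A (2ℚ * ν)) (∑-* A 2ℚ _))))
    eq : ∀ e se i b v k t → e + (2ℚ * v * k + 2ℚ * se) ≡ t + (e - i + 2ℚ * (se - b) + (- 1ℚ) * (t - (i + (k * (2ℚ * v) + 2ℚ * b))))
    eq = solve-∀ ringℚ

-- Choice of the parameters

sign-+ : ∀ m → sign (m ℕ.+ m) ≡ 1ℚ
sign-+ zero = refl
sign-+ (suc m) = trans (cong (λ i → - sign i) (ℕP.+-suc m m)) (trans (eq (sign (m ℕ.+ m))) (sign-+ m))
  where
  eq : ∀ x → - (- x) ≡ x
  eq = solve-∀ ringℚ

module _ {p θ : ℚ} (π≤p : AtLeastPi p) (0≤p : 0ℚ ≤ p) (0<θ : 0ℚ < θ) where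

  private
    ceiling : ∀ x → Σ ℕ λ n → x ≤ ℕtoℚ n * θ
    ceiling x = multiple (reciprocal 0<θ)
      where
      multiple : (Σ ℚ λ w → 0ℚ < w × θ * w ≡ 1ℚ) → Σ ℕ λ n → x ≤ ℕtoℚ n * θ
      multiple (w , _ , inv) = proj₁ (archimedean (x * w)) ,
        ≤-by (diff (proj₂ (archimedean (x * w))) ⊠ <⇒≤ 0<θ ⊞ vanish x inv) (eq x w θ (ℕtoℚ (proj₁ (archimedean (x * w)))))
        where
        eq : ∀ x w t n → n * t ≡ x + ((n - x * w) * t + x * (t * w - 1ℚ))
        eq = solve-∀ ringℚ

    ℕ≤odd : ∀ n → ℕtoℚ n ≤ odd n
    ℕ≤odd n = ≤-by (0≤1 ⊞ ℕtoℚ-nonneg n ⊞ vanish 1ℚ (odd-linear n)) (eq (ℕtoℚ n) (odd n))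
      where
      eq : ∀ n o → o ≡ n + (1ℚ + n + 1ℚ * (o - (1ℚ + 2ℚ * n)))
      eq = solve-∀ ringℚ

    m : ℕ
    m = proj₁ (ceiling 4ℚ)

    t Q : ℚ
    t = leibnizTerm (m ℕ.+ m)
    Q = smoothingError (m ℕ.+ m)

    t-odd : odd (m ℕ.+ m) * t ≡ 4ℚ
    t-odd = trans (leibnizTerm-odd (m ℕ.+ m)) (cong (4ℚ *_) (sign-+ m))

    t≤θ : t ≤ θ
    t≤θ = *-cancel-≤ (odd-pos (m ℕ.+ m)) (≤-by
      (diff (proj₂ (ceiling 4ℚ)) ⊞ diff (≤-trans (ℕtoℚ-mono (ℕP.m≤m+n m m)) (ℕ≤odd (m ℕ.+ m))) ⊠ <⇒≤ 0<θ ⊞ vanish (- 1ℚ) t-odd)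
      (eq (odd (m ℕ.+ m)) t θ (ℕtoℚ m)))
      where
      eq : ∀ o t th n → o * th ≡ o * t + (n * th - 4ℚ + (o - n) * th + (- 1ℚ) * (o * t - 4ℚ))
      eq = solve-∀ ringℚ

    0≤t : 0ℚ ≤ t
    0≤t = *-cancel-≤ (odd-pos (m ℕ.+ m)) (≤-by 0≤4 (trans t-odd (eq (odd (m ℕ.+ m)))))
      where
      eq : ∀ o → 4ℚ ≡ o * 0ℚ + 4ℚ
      eq = solve-∀ ringℚ

    J : ℕ
    J = proj₁ (ceiling (Q + p))

    C²-small : C J * C J * (Q + p) ≤ θ
    C²-small = *-cancel-≤ (odd-pos J) (≤-by
      (diff (wallis≤1 J) ⊠ (smoothingError-nonneg (m ℕ.+ m) ⊞ 0≤p) ⊞ diff (proj₂ (ceiling (Q + p))) ⊞ diff (ℕ≤odd J) ⊠ <⇒≤ 0<θ)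
      (eq (odd J) (C J) (Q + p) θ (ℕtoℚ J)))
      where
      smoothingError-nonneg : ∀ L → 0ℚ ≤ smoothingError L
      smoothingError-nonneg zero = 0≤4 ⊠ 0≤2
      smoothingError-nonneg (suc L) = smoothingError-nonneg L ⊞ 0≤4 ⊠ (0≤2 ⊠ square-nonneg (ℕtoℚ (2 ℕ.+ L)))
      eq : ∀ o c q th n → o * th ≡ o * (c * c * q) + ((1ℚ - o * (c * c)) * q + (n * th - q) + (o - n) * th)
      eq = solve-∀ ringℚ

  abstract
    -- `wallis-leibniz` at an even cutoff involves an odd number of Leibniz terms, which exceeds p
    -- by at most the last term t. One θ pays for t, by the choice of m. The other, by the choice of
    -- J, pays for both the smoothing error and `p * (C J * C (suc J))`, because `C J * C J` is at
    -- most 1 / `odd J`.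
    mean-near-2/π : Σ ℕ λ J → 2ℚ - 2ℚ * θ ≤ p * (wallis J - C J * C (suc J))
    mean-near-2/π = J , ≤-by
      (diff (wallis-leibniz J (m ℕ.+ m) (sign-+ m))
        ⊞ <⇒≤ (odd-pos J) ⊠ (C-nonneg J ⊠ C-nonneg J) ⊠ diff (π≤p m)
        ⊞ diff (wallis≤1 J) ⊠ 0≤t ⊞ diff t≤θ ⊞ diff C²-small ⊞ 0≤p ⊠ (C-nonneg J ⊠ diff (C-antitone J)))
      (eq (wallis J) (leibniz (m ℕ.+ m)) t (C J) (C (suc J)) Q p θ)
      where
      eq : ∀ a l t c c' q p th → p * (a - c * c') ≡ 2ℚ - 2ℚ * th
        + (a * (l + t) + c * c * q - 2ℚ + a * (p - l) + (1ℚ - a) * t + (th - t) + (th - c * c * (q + p)) + p * (c * (c - c')))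
      eq = solve-∀ ringℚ

module Bound {q s p : ℚ} (0≤s : 0ℚ ≤ s) (2≤ss : 2ℚ ≤ s * s) (π≤p : AtLeastPi p) (below : constBelow s p q) (q≤½ : q ≤ ½) where

  private
    ⅛ : ℚ
    ⅛ = ½ * ½ * ½

    0<½ : 0ℚ < ½
    0<½ = toWitness {a? = 0ℚ <? ½} _

    0<⅛ : 0ℚ < ⅛
    0<⅛ = toWitness {a? = 0ℚ <? ⅛} _

    2≤p : 2ℚ ≤ p
    2≤p = ≤-trans (toWitness {a? = 2ℚ ≤? leibniz 2} _) (π≤p 1)

    0<p : 0ℚ < p
    0<p = <-≤-trans (ℕtoℚ-pos 1) 2≤p

    0≤p : 0ℚ ≤ p
    0≤p = <⇒≤ 0<p

    D g : ℚ
    D = 2ℚ + (1ℚ + 2ℚ * s) * p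
    g = 4ℚ - (1ℚ - 2ℚ * q) * D * D

    4≤D : 4ℚ ≤ D
    4≤D = ≤-by (diff 2≤p ⊞ 0≤2 ⊠ 0≤s ⊠ 0≤p) (eq s p)
      where
      eq : ∀ s p → 2ℚ + (1ℚ + 2ℚ * s) * p ≡ 4ℚ + (p - 2ℚ + 2ℚ * s * p)
      eq = solve-∀ ringℚ

    0<D : 0ℚ < D
    0<D = <-≤-trans (ℕtoℚ-pos 3) 4≤D

    0<g : 0ℚ < g
    0<g = subst (0ℚ <_) (eq q D) (pos* (ℕtoℚ-pos 1) (diff< below))
      where
      eq : ∀ q d → 2ℚ * (2ℚ - (½ - q) * d * d) ≡ 4ℚ - (1ℚ - 2ℚ * q) * d * d
      eq = solve-∀ ringℚ

    0≤y : 0ℚ ≤ 1ℚ - 2ℚ * q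
    0≤y = subst (0ℚ ≤_) (eq q) (0≤2 ⊠ diff q≤½)
      where
      eq : ∀ q → 2ℚ * (½ - q) ≡ 1ℚ - 2ℚ * q
      eq = solve-∀ ringℚ

    1/D : Σ ℚ λ w → 0ℚ < w × D * w ≡ 1ℚ
    1/D = reciprocal 0<D

    w : ℚ
    w = proj₁ 1/D

    0<w : 0ℚ < w
    0<w = proj₁ (proj₂ 1/D)

    Dw≡1 : D * w ≡ 1ℚ
    Dw≡1 = proj₂ (proj₂ 1/D)

    -- If √(1 - 2q) is a little below ρ, then D ρ = 2 - κ leaves the slack κ.
    κ ρ τ θ : ℚ
    κ = ⅛ * g
    ρ = (2ℚ - κ) * w
    τ = ½ * (g * (w * w))
    θ = ⅛ * κ

    0<κ : 0ℚ < κ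
    0<κ = pos* 0<⅛ 0<g

    0<θ : 0ℚ < θ
    0<θ = pos* 0<⅛ 0<κ

    0<τ : 0ℚ < τ
    0<τ = pos* 0<½ (pos* 0<g (pos* 0<w 0<w))

    κ≤½ : κ ≤ ½
    κ≤½ = ≤-by (<⇒≤ 0<⅛ ⊠ (0≤y ⊠ <⇒≤ 0<D ⊠ <⇒≤ 0<D)) (eq ((1ℚ - 2ℚ * q) * D * D))
      where
      eq : ∀ x → ½ ≡ ½ * ½ * ½ * (4ℚ - x) + ½ * ½ * ½ * x
      eq = solve-∀ ringℚ

    0≤ρ : 0ℚ ≤ ρ
    0≤ρ = ≤-by (diff κ≤½ ⊞ <⇒≤ 0<½ ⊞ 0≤1) (eq κ) ⊠ <⇒≤ 0<w
      where
      eq : ∀ k → 2ℚ - k ≡ 0ℚ + (½ - k + ½ + 1ℚ)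
      eq = solve-∀ ringℚ

    ρ≤1 : ρ ≤ 1ℚ
    ρ≤1 = ≤-by (<⇒≤ 0<κ ⊠ <⇒≤ 0<w ⊞ diff 4≤D ⊠ <⇒≤ 0<w ⊞ 0≤2 ⊠ <⇒≤ 0<w ⊞ vanish (- 1ℚ) Dw≡1) (eq D w κ)
      where
      eq : ∀ d w k → 1ℚ ≡ (2ℚ - k) * w + (k * w + (d - 4ℚ) * w + 2ℚ * w + (- 1ℚ) * (d * w - 1ℚ))
      eq = solve-∀ ringℚ

    -- (2 - κ)² = 4 - g/2 + κ² and 4 - g = (1 - 2q) D², so half of the slack g survives as τ = g /
    -- (2 D²).
    ρ² : 1ℚ - 2ℚ * q + τ ≤ ρ * ρ
    ρ² = ≤-by (square-nonneg κ ⊠ square-nonneg w ⊞ vanish ((1ℚ - 2ℚ * q) * (D * w + 1ℚ)) Dw≡1) (eq q D w)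
      where
      eq : ∀ q d w → (2ℚ - ½ * ½ * ½ * (4ℚ - (1ℚ - 2ℚ * q) * d * d)) * w * ((2ℚ - ½ * ½ * ½ * (4ℚ - (1ℚ - 2ℚ * q) * d * d)) * w)
        ≡ 1ℚ - 2ℚ * q + ½ * ((4ℚ - (1ℚ - 2ℚ * q) * d * d) * (w * w))
          + (½ * ½ * ½ * (4ℚ - (1ℚ - 2ℚ * q) * d * d) * (½ * ½ * ½ * (4ℚ - (1ℚ - 2ℚ * q) * d * d)) * (w * w)
             + (1ℚ - 2ℚ * q) * (d * w + 1ℚ) * (d * w - 1ℚ))
      eq = solve-∀ ringℚ

    ¼≤q : ½ * ½ ≤ q
    ¼≤q = *-cancel-≤ {c = 4ℚ * 4ℚ} (pos* (ℕtoℚ-pos 3) (ℕtoℚ-pos 3)) (≤-by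
      (diff (<⇒≤ below) ⊞ diff q≤½ ⊠ (diff 4≤D ⊠ (<⇒≤ 0<D ⊞ 0≤4)) ⊞ 0≤2) (eq q D))
      where
      eq : ∀ q d → 4ℚ * 4ℚ * q ≡ 4ℚ * 4ℚ * (½ * ½) + (2ℚ - (½ - q) * d * d + (½ - q) * ((d - 4ℚ) * (d + 4ℚ)) + 2ℚ)
      eq = solve-∀ ringℚ

    J : ℕ
    J = proj₁ (mean-near-2/π π≤p 0≤p 0<θ)

    α : ℚ
    α = wallis J - C J * C (suc J)

    mean : 2ℚ - 2ℚ * θ ≤ p * α
    mean = proj₂ (mean-near-2/π π≤p 0≤p 0<θ)

    L : ℕ
    L = double (suc J)

    1/p : Σ ℚ λ u → 0ℚ < u × p * u ≡ 1ℚ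
    1/p = reciprocal 0<p

    ν : ℚ
    ν = θ * proj₁ 1/p

    0<ν : 0ℚ < ν
    0<ν = pos* 0<θ (proj₁ (proj₂ 1/p))

    pν : p * ν ≡ θ
    pν = ≡-by (null θ (proj₂ (proj₂ 1/p))) (eq p θ (proj₁ 1/p))
      where
      eq : ∀ p t u → p * (t * u) ≡ t + t * (p * u - 1ℚ)
      eq = solve-∀ ringℚ

    1/τ : Σ ℚ λ u → 0ℚ < u × τ * u ≡ 1ℚ
    1/τ = reciprocal 0<τ

    u : ℚ
    u = proj₁ 1/τ

    0≤u : 0ℚ ≤ u
    0≤u = <⇒≤ (proj₁ (proj₂ 1/τ))

    -- T is 1/δ, a lower bound for k. The 4 gives 4δ ≤ 1, the multiple of L ensures 4L < n, and 16u
    -- = 16/τ gives 16δ ≤ τ.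
    T₀ : Σ ℕ λ T → 4ℚ + 4ℚ * 4ℚ * ℕtoℚ L + 4ℚ * 4ℚ * u ≤ ℕtoℚ T
    T₀ = archimedean _

    T : ℚ
    T = ℕtoℚ (proj₁ T₀)

    0≤L : 0ℚ ≤ ℕtoℚ L
    0≤L = ℕtoℚ-nonneg L

    4≤T : 4ℚ ≤ T
    4≤T = ≤-trans (≤-by (0≤4 ⊠ 0≤4 ⊠ 0≤L ⊞ 0≤4 ⊠ 0≤4 ⊠ 0≤u) (+-assoc 4ℚ (4ℚ * 4ℚ * ℕtoℚ L) (4ℚ * 4ℚ * u))) (proj₂ T₀)

    16L≤T : 4ℚ * 4ℚ * ℕtoℚ L ≤ T
    16L≤T = ≤-trans (≤-by (0≤4 ⊞ 0≤4 ⊠ 0≤4 ⊠ 0≤u) (eq (4ℚ * 4ℚ * ℕtoℚ L) (4ℚ * 4ℚ * u))) (proj₂ T₀)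
      where
      eq : ∀ l u → 4ℚ + l + u ≡ l + (4ℚ + u)
      eq = solve-∀ ringℚ

    16≤Tτ : 4ℚ * 4ℚ ≤ T * τ
    16≤Tτ = ≤-by (diff (proj₂ T₀) ⊠ <⇒≤ 0<τ ⊞ (0≤4 ⊞ 0≤4 ⊠ 0≤4 ⊠ 0≤L) ⊠ <⇒≤ 0<τ ⊞ vanish (4ℚ * 4ℚ) (proj₂ (proj₂ 1/τ))) (eq T τ (ℕtoℚ L) u)
      where
      eq : ∀ t x l u → t * x ≡ 4ℚ * 4ℚ + ((t - (4ℚ + 4ℚ * 4ℚ * l + 4ℚ * 4ℚ * u)) * x + (4ℚ + 4ℚ * 4ℚ * l) * x + 4ℚ * 4ℚ * (x * u - 1ℚ))
      eq = solve-∀ ringℚ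

    0<T : 0ℚ < T
    0<T = <-≤-trans (ℕtoℚ-pos 3) 4≤T

    1/T : Σ ℚ λ δ → 0ℚ < δ × T * δ ≡ 1ℚ
    1/T = reciprocal 0<T

  δ₀ : ℚ
  δ₀ = proj₁ 1/T

  0<δ₀ : 0ℚ < δ₀
  0<δ₀ = proj₁ (proj₂ 1/T)

  private
    0≤δ : 0ℚ ≤ δ₀
    0≤δ = <⇒≤ 0<δ₀

    16δ≤τ : 4ℚ * 4ℚ * δ₀ ≤ τ
    16δ≤τ = ≤-by (0≤δ ⊠ diff 16≤Tτ ⊞ vanish (- τ) (proj₂ (proj₂ 1/T))) (eq T τ δ₀)
      where
      eq : ∀ t x d → x ≡ 4ℚ * 4ℚ * d + (d * (t * x - 4ℚ * 4ℚ) + (- x) * (t * d - 1ℚ))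
      eq = solve-∀ ringℚ

    4δ≤1 : 4ℚ * δ₀ ≤ 1ℚ
    4δ≤1 = ≤-by (diff 4≤T ⊠ 0≤δ ⊞ vanish (- 1ℚ) (proj₂ (proj₂ 1/T))) (eq T δ₀)
      where
      eq : ∀ t d → 1ℚ ≡ 4ℚ * d + ((t - 4ℚ) * d + (- 1ℚ) * (t * d - 1ℚ))
      eq = solve-∀ ringℚ

  module _ (A : List ℤ) (n : ℕ) {ε : ℚ} (0<ε : 0ℚ < ε) (ε<δ : ε < δ₀) (1<kδ : 1ℚ < ℕtoℚ (length A) * δ₀)
    (covers : (1ℚ - ε) * ℕtoℚ n ≤ ℕtoℚ (sumsetCount A n)) where

    open Pairs A

    private
      N : ℚ
      N = ℕtoℚ n

      0≤N : 0ℚ ≤ N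
      0≤N = ℕtoℚ-nonneg n

      0≤k : 0ℚ ≤ k
      0≤k = ℕtoℚ-nonneg (length A)

      T≤k : T ≤ k
      T≤k = ≤-by (<⇒≤ 0<T ⊠ diff (<⇒≤ 1<kδ) ⊞ vanish (- k) (proj₂ (proj₂ 1/T))) (eq T k δ₀)
        where
        eq : ∀ t k d → k ≡ t + (t * (k * d - 1ℚ) + (- k) * (t * d - 1ℚ))
        eq = solve-∀ ringℚ

      4≤k : 4ℚ ≤ k
      4≤k = ≤-trans 4≤T T≤k

      1≤k : 1ℚ ≤ k
      1≤k = ≤-trans (toWitness {a? = 1ℚ ≤? 4ℚ} _) 4≤k

      0<k : 0ℚ < k
      0<k = <-≤-trans 0<1 1≤k

      missing≤ : missing n ≤ δ₀ * N
      missing≤ = ≤-by (diff covers ⊞ diff (<⇒≤ ε<δ) ⊠ 0≤N) (eq ε δ₀ N (ℕtoℚ (sumsetCount A n)))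
        where
        eq : ∀ e d n c → d * n ≡ n - c + (c - (1ℚ - e) * n + (d - e) * n)
        eq = solve-∀ ringℚ

      0≤excess : 0ℚ ≤ excess n
      0≤excess = subst₂ _≤_ zero-pairs (trans (cong (λ x → excess n * 1ℚ + 2ℚ * x) (trans (∑-const (range n) 0ℚ) (*-zeroʳ (ℕtoℚ (length (range n)))))) (eq (excess n)))
        (sumset-bound (λ _ → 0ℚ) 1ℚ (λ _ → 0≤1) (λ _ → toWitness {a? = - 1ℚ ≤? 0ℚ} _) n)
        where
        zero-pairs : ∑∑ (λ _ → 0ℚ) ≡ 0ℚ
        zero-pairs = trans (∑-cong A (λ _ → trans (∑-const A 0ℚ) (*-zeroʳ k))) (trans (∑-const A 0ℚ) (*-zeroʳ k))
        eq : ∀ x → x * 1ℚ + 2ℚ * 0ℚ ≡ x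
        eq = solve-∀ ringℚ

      -- A crude consequence of `0≤excess`, which expresses the at most δ n missing points in terms
      -- of k².
      n≤3k² : N ≤ (2ℚ + 1ℚ) * (k * k)
      n≤3k² = ≤-by (0≤excess ⊞ 0≤4 ⊠ diff missing≤ ⊞ diff 4δ≤1 ⊠ 0≤N ⊞ 0≤2 ⊠ 0≤k ⊠ diff 1≤k) (eq N k (missing n) δ₀)
        where
        eq : ∀ n k m d → (2ℚ + 1ℚ) * (k * k) ≡ n + (k * k - 2ℚ * n + 4ℚ * m + 2ℚ * k + 4ℚ * (d * n - m) + (1ℚ - 4ℚ * d) * n + 2ℚ * k * (k - 1ℚ))
        eq = solve-∀ ringℚ

      module Large (large : q * (k * k) < N) where

        e : ℚ
        e = ρ * k

        0≤e : 0ℚ ≤ e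
        0≤e = 0≤ρ ⊠ 0≤k

        -- The error terms fit into 16 δ k² ≤ τ k²: 12 parts for the missing points, as 4 δ n ≤ 12 δ
        -- k², and 4 parts for 2k + 2, as k δ > 1 and k ≥ 1.
        excess≤ : excess n + 2ℚ ≤ e * e
        excess≤ = ≤-by
          (diff ρ² ⊠ (0≤k ⊠ 0≤k) ⊞ diff 16δ≤τ ⊠ (0≤k ⊠ 0≤k) ⊞ 0≤2 ⊠ diff (<⇒≤ large) ⊞ 0≤4 ⊠ diff missing≤
            ⊞ 0≤4 ⊠ (0≤δ ⊠ diff n≤3k²) ⊞ 0≤2 ⊠ 0≤k ⊠ diff (<⇒≤ 1<kδ) ⊞ 0≤2 ⊠ (diff (<⇒≤ 1<kδ)) ⊞ 0≤2 ⊠ (0≤k ⊠ 0≤δ) ⊠ diff 1≤k)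
          (eq N k (missing n) δ₀ q τ ρ)
          where
          eq : ∀ n k m d q t r → r * k * (r * k) ≡ k * k - 2ℚ * n + 4ℚ * m + 2ℚ * k + 2ℚ
            + ((r * r - (1ℚ - 2ℚ * q + t)) * (k * k) + (t - 4ℚ * 4ℚ * d) * (k * k) + 2ℚ * (n - q * (k * k)) + 4ℚ * (d * n - m)
               + 4ℚ * (d * ((2ℚ + 1ℚ) * (k * k) - n)) + 2ℚ * k * (k * d - 1ℚ) + 2ℚ * (k * d - 1ℚ) + 2ℚ * (k * d) * (k - 1ℚ))
          eq = solve-∀ ringℚ

        4L<n : 4 ℕ.* L ℕ.< n
        4L<n = ℕtoℚ-cancel-< (subst (_< N) (sym (ℕtoℚ-* 4 L)) (≤-<-trans
          (≤-by (0≤½ ⊠ 0≤½ ⊠ diff (≤-trans 16L≤T T≤k) ⊞ 0≤½ ⊠ 0≤½ ⊠ (0≤k ⊠ diff 1≤k) ⊞ diff ¼≤q ⊠ (0≤k ⊠ 0≤k)) (eq k q (ℕtoℚ L))) large))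
          where
          eq : ∀ k q l → q * (k * k) ≡ 4ℚ * l + (½ * ½ * (k - 4ℚ * 4ℚ * l) + ½ * ½ * (k * (k - 1ℚ)) + (q - ½ * ½) * (k * k))
          eq = solve-∀ ringℚ

        refute : (Σ ℚ λ ν' → ν' ≤ ν × Rotation n L ν') → ⊥
        refute (ν' , ν'≤ν , rot') = <-irrefl refl (≤-<-trans impossible (pos* (pos* 0<½ 0<κ) 0<k))
          where
          rot : Rotation n L ν
          rot = record { Rotation rot' hiding (upper) ; upper = λ m h → ≤-trans (neg-antimono-≤ ν'≤ν) (Rotation.upper rot' m h) }
          -- Multiplied by p, the core inequality reads (2 - 2θ)(1 - ρ) k ≤ (D - 2) ρ k + 2θ k; as D ρ = 2 - κ and θ = κ/8, this fails.
          impossible : ½ * κ * k ≤ 0ℚ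
          impossible = ≤-by
            (0≤p ⊠ diff (Core.core A J (<⇒≤ 0<ν) rot 0≤e 0≤s 2≤ss excess≤)
              ⊞ diff mean ⊠ (diff ρ≤1 ⊠ 0≤k) ⊞ 0≤2 ⊠ <⇒≤ 0<θ ⊠ 0≤e
              ⊞ vanish (- (2ℚ * k)) pν ⊞ vanish (- ((2ℚ - κ) * k)) Dw≡1)
            (eq p s w k ν α κ)
            where
            eq : ∀ p s w k v a c → 0ℚ ≡ ½ * c * k
              + (p * ((2ℚ - c) * w * k + (2ℚ * v * k + 2ℚ * (s * ((2ℚ - c) * w * k))) - (k - (2ℚ - c) * w * k) * a)
                 + (p * a - (2ℚ - 2ℚ * (½ * ½ * ½ * c))) * ((1ℚ - (2ℚ - c) * w) * k) + 2ℚ * (½ * ½ * ½ * c) * ((2ℚ - c) * w * k)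
                 + - (2ℚ * k) * (p * v - ½ * ½ * ½ * c) + - ((2ℚ - c) * k) * ((2ℚ + (1ℚ + 2ℚ * s) * p) * w - 1ℚ))
            eq = solve-∀ ringℚ

    size-bound : N ≤ q * (k * k)
    size-bound = ≮⇒≥ (λ large → Large.refute large (rotation n L (Large.4L<n large) 0<ν))

EventuallyBounded : ℚ → Set
EventuallyBounded q = Σ ℚ λ δ → 0ℚ < δ ×
    ((ε : ℚ) → 0ℚ < ε → ε < δ → (k : ℕ) → 1ℚ < ℕtoℚ k * δ →
    (n : ℕ) → Admissible ε k n → ℕtoℚ n ≤ q * (ℕtoℚ k * ℕtoℚ k))

eventuallyBounded : ∀ {q} → q ≤ ½ → ConstLt q → EventuallyBounded q
eventuallyBounded {q} q≤½ (s , p , (0≤s , 2≤ss) , π≤p , below) = δ₀ , 0<δ₀ , λ where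
    ε 0<ε ε<δ k 1<kδ n (A , _ , refl , covers) → size-bound A n 0<ε ε<δ 1<kδ covers
  where open Bound {q} 0≤s 2≤ss π≤p below q≤½

eventuallyBounded-mono : ∀ {q r} → q ≤ r → EventuallyBounded q → EventuallyBounded r
eventuallyBounded-mono {q} {r} q≤r (δ , 0<δ , bound) = δ , 0<δ , λ ε 0<ε ε<δ k 1<kδ n adm →
    ≤-trans (bound ε 0<ε ε<δ k 1<kδ n adm) (≤-by (diff q≤r ⊠ (ℕtoℚ-nonneg k ⊠ ℕtoℚ-nonneg k)) (eq (ℕtoℚ k) q r))
  where
  eq : ∀ k q r → r * (k * k) ≡ q * (k * k) + (r - q) * (k * k)
  eq = solve-∀ ringℚ

-- The choice of parameters relies on 1 - 2q ≥ 0, so larger q are reduced to ½. There `constBelow`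
-- reads 0 < 2, whatever s and p are.
constLt-½ : ∀ {q} → ConstLt q → ConstLt ½
constLt-½ (s , p , s≥√2 , p≥π , _) = s , p , s≥√2 , p≥π , subst (_< 2ℚ) (sym (eq (2ℚ + (1ℚ + 2ℚ * s) * p))) (ℕtoℚ-pos 1)
  where
  eq : ∀ d → (½ - ½) * d * d ≡ 0ℚ
  eq = solve-∀ ringℚ

theorem6 : (q : ℚ) → ConstLt q →
    Σ ℚ λ δ → 0ℚ < δ ×
    ((ε : ℚ) → 0ℚ < ε → ε < δ → (k : ℕ) → 1ℚ < ℕtoℚ k * δ →
    (n : ℕ) → Admissible ε k n → ℕtoℚ n ≤ q * (ℕtoℚ k * ℕtoℚ k))
theorem6 q h =
  [ (λ q≤½ → eventuallyBounded {q} q≤½ h)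
  , (λ ½≤q → eventuallyBounded-mono ½≤q (eventuallyBounded {½} ≤-refl (constLt-½ {q} h)))
  ]′ (≤-total q ½)
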